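{- For every fixed integer $k \ge 0$, as $n \to \infty$, \[ N_{\rm bi}(n, k) \sim \frac{1}{2^{k-1}}\, N(n,k). \]
   Context: $N(n,k)$ is the number of connected simple graphs on the labeled vertex set $\{1,\dots,n\}$ with exactly $n-1+k$ edges (i.e. with Betti number $k$). For integers $r,s\ge 0$ and $k$, $N_{\rm bi}(r,s,k)$ is the number of connected bipartite simple graphs with labeled bipartition $V_1\sqcup V_2$, $|V_1|=r$, $|V_2|=s$, having exactly $r+s+k-1$ edges; equivalently, the number of connected spanning subgraphs of the complete bipartite graph $K_{r,s}$ with $r+s+k-1$ edges (so the Betti number is $k$). Conventions: if $rs=0$, then $N_{\rm bi}(r,s,k)=1$ if $k=0$ and $(r,s)\in\{(1,0),(0,1)\}$, and $0$ otherwise. Define \[ N_{\rm bi}(n,k) := \sum_{r+s=n}\binom{n}{r}N_{\rm bi}(r,s,k). \] Here $a_n\sim b_n$ means $a_n/b_n\to1$. -}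

module Defs where

open import Data.Nat as ℕ using (ℕ; zero; suc; _∸_; _^_)
open import Data.Nat.Properties using (m^n≢0)
open import Data.Nat.Combinatorics using (_C_)
open import Data.Fin using (Fin; _↑ˡ_; _↑ʳ_; _<?_)
open import Data.Fin.Properties using (_≟_; all?)
open import Data.Integer using (+_)
open import Data.Rational as ℚ using (ℚ; 0ℚ; 1ℚ; _÷_; _-_; ∣_∣; _<_; _/_)
open import Data.List using (List; []; _∷_; [_]; _++_; map; filter; length; upTo; allFin; cartesianProduct)
open import Data.Nat.ListAction using (sum)
open import Data.List.Membership.Propositional using (_∈_)
open import Data.List.Relation.Unary.Any using (here; there)
open import Data.Product using (_×_; _,_; Σ; ∃; uncurry)
open import Data.Sum using (_⊎_; inj₁; inj₂)
open import Relation.Nullary using (Dec)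
open import Relation.Nullary.Decidable using (map′; _×-dec_; _⊎-dec_)
open import Relation.Binary.PropositionalEquality using (_≡_; refl)
open import Relation.Binary.Construct.Closure.Equivalence as Eq using (EqClosure)
open import Relation.Binary.Construct.Closure.ReflexiveTransitive using (ε; _◅_; _◅◅_)
open import Relation.Binary.Construct.Closure.Symmetric using (fwd; bwd)

-- An edge {u , v} is stored once, as a single ordered pair.  A simple graph
-- on Fin n is a set of such edges, i.e. a sublist of `complete n`.

Edges : ℕ → Set
Edges n = List (Fin n × Fin n)

complete : (n : ℕ) → Edges n
complete n = filter (uncurry _<?_) (cartesianProduct (allFin n) (allFin n))

-- K_{r,s}: the first r vertices form V₁, the remaining s form V₂.
completeBipartite : (r s : ℕ) → Edges (r ℕ.+ s)
completeBipartite r s =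
  cartesianProduct (map (_↑ˡ s) (allFin r)) (map (r ↑ʳ_) (allFin s))

Joined : ∀ {n} → Edges n → Fin n → Fin n → Set
Joined F = EqClosure (λ u v → (u , v) ∈ F)

-- The graph without vertices is not connected.
Connected : ∀ {n} → Edges n → Set
Connected {n} F = ℕ.NonZero n × (∀ u v → Joined F u v)

-- Adding an edge {a , b} merges the components of a and b.
joined? : ∀ {n} (F : Edges n) (u v : Fin n) → Dec (Joined F u v)
joined? [] u v = map′ (λ { refl → ε }) to (u ≟ v)
  where
  to : ∀ {u v} → Joined [] u v → u ≡ v
  to ε = refl
  to (fwd () ◅ _)
  to (bwd () ◅ _)
joined? {n} ((a , b) ∷ F) u v =
  map′ from to
    (joined? F u v
      ⊎-dec ((joined? F u a ×-dec joined? F b v)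
      ⊎-dec  (joined? F u b ×-dec joined? F a v)))
  where
  Merged : Fin n → Fin n → Set
  Merged x y = Joined F x y
    ⊎ ((Joined F x a × Joined F b y) ⊎ (Joined F x b × Joined F a y))

  weaken : ∀ {x y} → Joined F x y → Joined ((a , b) ∷ F) x y
  weaken = Eq.map there

  from : ∀ {x y} → Merged x y → Joined ((a , b) ∷ F) x y
  from (inj₁ p)              = weaken p
  from (inj₂ (inj₁ (p , q))) = weaken p ◅◅ fwd (here refl) ◅ weaken q
  from (inj₂ (inj₂ (p , q))) = weaken p ◅◅ bwd (here refl) ◅ weaken q

  prepend : ∀ {x y z} → Joined F x y → Merged y z → Merged x z
  prepend p (inj₁ q)              = inj₁ (p ◅◅ q)
  prepend p (inj₂ (inj₁ (q , r))) = inj₂ (inj₁ (p ◅◅ q , r))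
  prepend p (inj₂ (inj₂ (q , r))) = inj₂ (inj₂ (p ◅◅ q , r))

  fromA : ∀ {y} → Merged b y → Merged a y
  fromA (inj₁ q)              = inj₂ (inj₁ (ε , q))
  fromA (inj₂ (inj₁ (_ , r))) = inj₂ (inj₁ (ε , r))
  fromA (inj₂ (inj₂ (_ , r))) = inj₁ r

  fromB : ∀ {y} → Merged a y → Merged b y
  fromB (inj₁ q)              = inj₂ (inj₂ (ε , q))
  fromB (inj₂ (inj₁ (_ , r))) = inj₁ r
  fromB (inj₂ (inj₂ (_ , r))) = inj₂ (inj₂ (ε , r))

  to : ∀ {x y} → Joined ((a , b) ∷ F) x y → Merged x y
  to ε                       = inj₁ ε
  to (fwd (here refl) ◅ ps)  = fromA (to ps)
  to (bwd (here refl) ◅ ps)  = fromB (to ps)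
  to (fwd (there e)   ◅ ps)  = prepend (fwd e ◅ ε) (to ps)
  to (bwd (there e)   ◅ ps)  = prepend (bwd e ◅ ε) (to ps)

connected? : ∀ {n} (F : Edges n) → Dec (Connected F)
connected? {n} F = ℕ.nonZero? n ×-dec all? (λ u → all? (λ v → joined? F u v))

sublists : {A : Set} → List A → List (List A)
sublists []       = [ [] ]
sublists (x ∷ xs) = sublists xs ++ map (x ∷_) (sublists xs)

-- Connected graphs on n vertices with n - 1 + k edges; the edge count is
-- written without truncated subtraction.
ConnectedWithBetti : ∀ {n} → ℕ → Edges n → Set
ConnectedWithBetti {n} k F = Connected F × length F ℕ.+ 1 ≡ n ℕ.+ k

connectedWithBetti? : ∀ {n} k (F : Edges n) → Dec (ConnectedWithBetti k F)
connectedWithBetti? {n} k F = connected? F ×-dec (length F ℕ.+ 1 ℕ.≟ n ℕ.+ k)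

countConnected : ∀ {n} → Edges n → ℕ → ℕ
countConnected E k = length (filter (connectedWithBetti? k) (sublists E))

N : ℕ → ℕ → ℕ
N n k = countConnected (complete n) k

-- If r or s is 0 there are no edges, so this is 1 when k = 0 and r + s = 1,
-- and 0 otherwise.
Nbi₂ : ℕ → ℕ → ℕ → ℕ
Nbi₂ r s k = countConnected (completeBipartite r s) k

Nbi : ℕ → ℕ → ℕ
Nbi n k = sum (map (λ r → (n C r) ℕ.* Nbi₂ r (n ∸ r) k) (upTo (suc n)))

fromℕ : ℕ → ℚ
fromℕ m = + m / 1

-- 1 / 2^(k-1), written as 2 / 2^k so that k = 0 gives 2.
1/2^[_-1] : ℕ → ℚ
1/2^[ k -1] = (+ 2 / (2 ^ k)) {{m^n≢0 2 k}}

-- a n / b n → 1; the quotient is only required to be defined for large n.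
infix 4 _∼_
_∼_ : (ℕ → ℚ) → (ℕ → ℚ) → Set
a ∼ b = ∀ (δ : ℚ) → 0ℚ < δ →
  ∃ λ M → ∀ n → M ℕ.≤ n →
    Σ (ℚ.NonZero (b n)) λ b≢0 → ∣ (a n ÷ b n) {{b≢0}} - 1ℚ ∣ < δ

{-# OPTIONS --safe #-}

-- Write a_k(n) = N(n,k), v_k(n) = N_bi(n,k), θf(n) = n f(n), f ⋆ g for the
-- binomial convolution and f ⊛ g = θf ⋆ θg.  Deleting an edge of a connected
-- graph leaves it connected or leaves two components, whence
--   2(n+j) (a_{j+1} + a_j) = (n² - n + 2) a_j + Σ_{i ≤ j+1} a_i ⊛ a_{j+1-i},
-- and, with sizes r and s of the colour classes, an analogous recursion for
-- N_bi(r,s,k).  Summed over r + s = n it has the same shape, except that n²/4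
-- is replaced by the average of r s; the recursion also bounds the average of
-- (r-s)² = n² - 4 r s by O(n).  Hence the families 2 a_k and 2^k v_k agree for
-- k = 0 and satisfy the same recursion up to lower order terms.
--
-- The terms i = 0 and i = j + 1 of the convolution contain the unknown; the
-- others come from smaller k and so are asymptotically equal by induction.
-- What remains is a linear recursion with nonnegative coefficients, so two
-- solutions with asymptotically equal forcing terms differ by a small multiple
-- of either plus a multiple of the supersolution t(n) = n a_0(n), which counts
-- rooted trees.  The latter is negligible, because a_k / t tends to infinity
-- for k ≥ 1.

module Submission where

-- The normalisations come from recolouring. A connected bipartite graph has two proper
-- 2-colourings, whence the factor 2 at k = 0. When parts with class sizes (i , j) and (i′ , j′) are
-- joined by an edge, i j′ + i′ j edges respect the colouring; after swapping the colours of one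
-- part there are i i′ + j j′. Together these are all (i + j)(i′ + j′) pairs, so an edge is
-- admissible half of the time, whence 2^k. The same swap controls the imbalance. With x = i - j and
-- y = i′ - j′ the two colourings have imbalance x + y and, up to sign, x - y. The one with the
-- larger imbalance admits fewer edges, so the cross terms of the squares have a favourable sign and
-- squared imbalances add up at most, as for independent signs. The obstacle in the comparison is
-- that convolution with a_0 is critical: a_0 ⊛ t = (n - 1) t, against the coefficient n + j on the
-- other side. The recursion gives no contraction, and small n are controlled only up to a multiple
-- of t. No asymptotic formula for either count enters; only two solutions of one recursion are
-- compared.

open import Defs
open import Data.Nat using (ℕ; zero; suc; _+_; _*_; _∸_; _^_; _≤_; _<_; z≤n; s≤s; s≤s⁻¹; z<s; s<s; ∣_-_∣; NonZero; nonZero; ≢-nonZero)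
open import Data.Nat.Properties renaming (_≟_ to _≟ℕ_)
open import Algebra.Properties.CommutativeSemigroup +-commutativeSemigroup using () renaming (interchange to +-interchange; x∙yz≈y∙xz to +-left-comm; xy∙z≈xz∙y to +-right-comm)
open import Algebra.Properties.CommutativeSemigroup *-commutativeSemigroup using () renaming (x∙yz≈y∙xz to *-left-comm)
open import Data.Nat.Tactic.RingSolver using (solve-∀)
open import Data.Nat.ListAction using (sum)
open import Data.Bool using (Bool; T; true; false; if_then_else_; _∧_; _∨_; not)
open import Data.Bool.Properties using (T?) renaming (_≟_ to _≟ᵇ_)
open import Data.Fin as Fin using (Fin; zero; suc; _↑ˡ_; _↑ʳ_)
open import Data.Fin.Properties as Fin using (any?; all?)
open import Data.Vec using (Vec; []; _∷_; lookup; tabulate; replicate)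
open import Data.Vec.Properties using (lookup∘tabulate; lookup-replicate)
open import Data.List using (List; []; _∷_; _++_; map; filter; filterᵇ; length; allFin; cartesianProduct; upTo)
open import Data.List.Properties using (map-tabulate; map-applyUpTo)
open import Data.List.Membership.Propositional using (_∈_)
open import Data.List.Membership.Propositional.Properties using (∈-++⁻; ∈-++⁺ˡ; ∈-++⁺ʳ; ∈-map⁻; ∈-map⁺; ∈-filter⁻; ∈-filter⁺; ∈-cartesianProduct⁻)
open import Data.List.Relation.Binary.Subset.Propositional using (_⊆_)
open import Data.List.Relation.Binary.Subset.Propositional.Properties using (∷⁺ʳ)
open import Data.List.Relation.Unary.Any using (here; there)
open import Data.Product using (Σ; ∃; _×_; _,_; proj₁; proj₂; uncurry)
open import Data.Sum using (_⊎_; inj₁; inj₂)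
open import Data.Empty using (⊥-elim)
open import Function using (_∘_; id; case_of_)
open import Relation.Binary using (tri<; tri≈; tri>)
import Relation.Binary.Construct.Closure.Equivalence as Eq
open import Relation.Binary.Construct.Closure.ReflexiveTransitive using (ε; _◅_; _◅◅_)
open import Relation.Binary.Construct.Closure.Symmetric using (fwd; bwd)
open import Relation.Binary.PropositionalEquality using (_≡_; _≢_; refl; sym; trans; cong; cong₂; subst; subst₂; module ≡-Reasoning)
open import Relation.Nullary using (Dec; yes; no; does; ¬_; contradiction)
open import Relation.Nullary.Decidable using (_×-dec_; _→-dec_; decidable-stable)


-- Finite sums

∑ : {A : Set} → List A → (A → ℕ) → ℕ
∑ xs f = sum (map f xs)

∑₂ : {A B : Set} → List (A × B) → (A → B → ℕ) → ℕ
∑₂ xs f = ∑ xs (uncurry f)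

module _ {A : Set} where

  ∑-cong : (xs : List A) {f g : A → ℕ} → (∀ {x} → x ∈ xs → f x ≡ g x) → ∑ xs f ≡ ∑ xs g
  ∑-cong []       eq = refl
  ∑-cong (x ∷ xs) eq = cong₂ _+_ (eq (here refl)) (∑-cong xs (eq ∘ there))

  ∑-cong′ : (xs : List A) {f g : A → ℕ} → (∀ x → f x ≡ g x) → ∑ xs f ≡ ∑ xs g
  ∑-cong′ xs eq = ∑-cong xs (λ {x} _ → eq x)

  ∑-mono : (xs : List A) {f g : A → ℕ} → (∀ {x} → x ∈ xs → f x ≤ g x) → ∑ xs f ≤ ∑ xs g
  ∑-mono []       le = z≤n
  ∑-mono (x ∷ xs) le = +-mono-≤ (le (here refl)) (∑-mono xs (le ∘ there))

  ∑-0 : (xs : List A) {f : A → ℕ} → (∀ {x} → x ∈ xs → f x ≡ 0) → ∑ xs f ≡ 0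
  ∑-0 []       eq = refl
  ∑-0 (x ∷ xs) eq = cong₂ _+_ (eq (here refl)) (∑-0 xs (eq ∘ there))

  ∑-+ : (xs : List A) (f g : A → ℕ) → ∑ xs (λ x → f x + g x) ≡ ∑ xs f + ∑ xs g
  ∑-+ []       f g = refl
  ∑-+ (x ∷ xs) f g = trans (cong ((f x + g x) +_) (∑-+ xs f g)) (+-interchange (f x) (g x) _ _)

  ∑-*ˡ : (xs : List A) (c : ℕ) (f : A → ℕ) → ∑ xs (λ x → c * f x) ≡ c * ∑ xs f
  ∑-*ˡ []       c f = sym (*-zeroʳ c)
  ∑-*ˡ (x ∷ xs) c f = trans (cong (c * f x +_) (∑-*ˡ xs c f)) (sym (*-distribˡ-+ c (f x) _))

  ∑-*ʳ : (xs : List A) (c : ℕ) (f : A → ℕ) → ∑ xs (λ x → f x * c) ≡ ∑ xs f * c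
  ∑-*ʳ xs c f = trans (∑-cong′ xs (λ x → *-comm (f x) c)) (trans (∑-*ˡ xs c f) (*-comm c _))

  ∑-++ : (xs ys : List A) (f : A → ℕ) → ∑ (xs ++ ys) f ≡ ∑ xs f + ∑ ys f
  ∑-++ []       ys f = refl
  ∑-++ (x ∷ xs) ys f = trans (cong (f x +_) (∑-++ xs ys f)) (sym (+-assoc (f x) _ _))

  ∑-map : {B : Set} (h : B → A) (xs : List B) (f : A → ℕ) → ∑ (map h xs) f ≡ ∑ xs (f ∘ h)
  ∑-map h []       f = refl
  ∑-map h (x ∷ xs) f = cong (f (h x) +_) (∑-map h xs f)

∑-swap : {A B : Set} (xs : List A) (ys : List B) (f : A → B → ℕ) →
           ∑ xs (λ x → ∑ ys (f x)) ≡ ∑ ys (λ y → ∑ xs (λ x → f x y))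
∑-swap []       ys f = sym (∑-0 ys (λ _ → refl))
∑-swap (x ∷ xs) ys f = trans (cong (∑ ys (f x) +_) (∑-swap xs ys f)) (sym (∑-+ ys (f x) _))

∑-*-∑ : {A B : Set} (xs : List A) (ys : List B) (f : A → ℕ) (g : B → ℕ) →
        ∑ xs f * ∑ ys g ≡ ∑ xs (λ x → ∑ ys (λ y → f x * g y))
∑-*-∑ xs ys f g = sym (trans (∑-cong′ xs (λ x → ∑-*ˡ ys (f x) g)) (∑-*ʳ xs (∑ ys g) f))

𝟙 : {P : Set} → Dec P → ℕ
𝟙 d = if does d then 1 else 0

module _ {P : Set} where

  𝟙-yes : (d : Dec P) → P → 𝟙 d ≡ 1
  𝟙-yes (yes _) p = refl
  𝟙-yes (no ¬p) p = contradiction p ¬p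

  𝟙-no : (d : Dec P) → ¬ P → 𝟙 d ≡ 0
  𝟙-no (yes p) ¬p = contradiction p ¬p
  𝟙-no (no _)  ¬p = refl

  𝟙≢0 : (d : Dec P) → 𝟙 d ≢ 0 → P
  𝟙≢0 (yes p) _  = p
  𝟙≢0 (no ¬p) ≢0 = contradiction refl ≢0

𝟙-cong : {P Q : Set} (d : Dec P) (e : Dec Q) → (P → Q) → (Q → P) → 𝟙 d ≡ 𝟙 e
𝟙-cong (yes p) e f g = sym (𝟙-yes e (f p))
𝟙-cong (no ¬p) e f g = sym (𝟙-no e (¬p ∘ g))

length-filter-∑ : {A : Set} {P : A → Set} (P? : ∀ x → Dec (P x)) (xs : List A) →
                  length (filter P? xs) ≡ ∑ xs (λ x → 𝟙 (P? x))
length-filter-∑ P? []       = refl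
length-filter-∑ P? (x ∷ xs) with does (P? x)
... | true  = cong suc (length-filter-∑ P? xs)
... | false = length-filter-∑ P? xs

∑-filter : {A : Set} {P : A → Set} (P? : ∀ x → Dec (P x)) (xs : List A) (f : A → ℕ) →
           ∑ (filter P? xs) f ≡ ∑ xs (λ x → 𝟙 (P? x) * f x)
∑-filter P? []       f = refl
∑-filter P? (x ∷ xs) f with does (P? x)
... | true  = cong₂ _+_ (sym (+-identityʳ (f x))) (∑-filter P? xs f)
... | false = ∑-filter P? xs f

∑-cartesianProduct : {A B : Set} (xs : List A) (ys : List B) (f : A → B → ℕ) →
  ∑₂ (cartesianProduct xs ys) f ≡ ∑ xs (λ x → ∑ ys (f x))
∑-cartesianProduct []       ys f = refl
∑-cartesianProduct (x ∷ xs) ys f =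
  trans (∑-++ (map (x ,_) ys) (cartesianProduct xs ys) (uncurry f))
        (cong₂ _+_ (∑-map (x ,_) ys (uncurry f)) (∑-cartesianProduct xs ys f))

antidiagonal : ℕ → List (ℕ × ℕ)
antidiagonal zero    = (0 , 0) ∷ []
antidiagonal (suc k) = (0 , suc k) ∷ map (λ (i , j) → suc i , j) (antidiagonal k)

∑ᵃ : ℕ → (ℕ → ℕ → ℕ) → ℕ
∑ᵃ k = ∑₂ (antidiagonal k)

∑-antidiagonal-suc : ∀ k (f : ℕ → ℕ → ℕ) →
  ∑ᵃ (suc k) f ≡ f 0 (suc k) + ∑ᵃ k (λ i j → f (suc i) j)
∑-antidiagonal-suc k f = cong (f 0 (suc k) +_) (∑-map _ (antidiagonal k) (uncurry f))

∑-antidiagonal-last : ∀ k (f : ℕ → ℕ → ℕ) →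
  ∑ᵃ (suc k) f ≡ ∑ᵃ k (λ i j → f i (suc j)) + f (suc k) 0
∑-antidiagonal-last zero    f = solve′ (f 0 1) (f 1 0)
  where
  solve′ : ∀ a b → a + (b + 0) ≡ (a + 0) + b
  solve′ = solve-∀
∑-antidiagonal-last (suc k) f = begin
  ∑ᵃ (suc (suc k)) f
    ≡⟨ ∑-antidiagonal-suc (suc k) f ⟩
  f 0 (2 + k) + ∑ᵃ (suc k) (λ i j → f (suc i) j)
    ≡⟨ cong (f 0 (2 + k) +_) (∑-antidiagonal-last k (λ i j → f (suc i) j)) ⟩
  f 0 (2 + k) + (∑ᵃ k (λ i j → f (suc i) (suc j)) + f (2 + k) 0)
    ≡⟨ +-assoc (f 0 (2 + k)) _ _ ⟨
  f 0 (2 + k) + ∑ᵃ k (λ i j → f (suc i) (suc j)) + f (2 + k) 0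
    ≡⟨ cong (_+ f (2 + k) 0) (∑-antidiagonal-suc k (λ i j → f i (suc j))) ⟨
  ∑ᵃ (suc k) (λ i j → f i (suc j)) + f (2 + k) 0 ∎
  where open ≡-Reasoning

∑-antidiagonal-swap : ∀ k (f : ℕ → ℕ → ℕ) →
  ∑ᵃ k f ≡ ∑ᵃ k (λ i j → f j i)
∑-antidiagonal-swap zero    f = refl
∑-antidiagonal-swap (suc k) f =
  trans (∑-antidiagonal-suc k f)
  (trans (cong (f 0 (suc k) +_) (∑-antidiagonal-swap k (λ i j → f (suc i) j)))
  (trans (+-comm (f 0 (suc k)) _) (sym (∑-antidiagonal-last k (λ i j → f j i)))))

antidiagonal-+ : ∀ k {i j} → (i , j) ∈ antidiagonal k → i + j ≡ k
antidiagonal-+ zero    (here refl) = refl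
antidiagonal-+ (suc k) (here refl) = refl
antidiagonal-+ (suc k) (there p) with ∈-map⁻ _ p
... | _ , q , refl = cong suc (antidiagonal-+ k q)

-- Sums over sublists

module _ {A : Set} where

  ∑-sublists-∷ : ∀ (x : A) E f →
    ∑ (sublists (x ∷ E)) f ≡ ∑ (sublists E) (λ F → f F + f (x ∷ F))
  ∑-sublists-∷ x E f =
    trans (∑-++ (sublists E) _ f)
    (trans (cong (∑ (sublists E) f +_) (∑-map (x ∷_) (sublists E) f))
           (sym (∑-+ (sublists E) f (λ F → f (x ∷ F)))))

  sublists-⊆ : ∀ (E : List A) {F} → F ∈ sublists E → ∀ {x} → x ∈ F → x ∈ E
  sublists-⊆ []      (here refl) ()
  sublists-⊆ (y ∷ E) F∈ x∈ with ∈-++⁻ (sublists E) F∈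
  ... | inj₁ p = there (sublists-⊆ E p x∈)
  ... | inj₂ p with ∈-map⁻ (y ∷_) p | x∈
  ...   | _ , q , refl | here eq  = here eq
  ...   | _ , q , refl | there x∈′ = there (sublists-⊆ E q x∈′)

  ∑-sublists-empty : ∀ (E : List A) (f : List A → ℕ) →
    ∑ (sublists E) (λ F → 𝟙 (length F ≟ℕ 0) * f F) ≡ f []
  ∑-sublists-empty []      f = trans (+-identityʳ _) (+-identityʳ _)
  ∑-sublists-empty (x ∷ E) f =
    trans (∑-sublists-∷ x E _)
    (trans (∑-cong′ (sublists E) (λ F → +-identityʳ _)) (∑-sublists-empty E f))

  -- Prepending an edge creates lists with repetitions and in varying order; a property such as
  -- connectedness depends only on the underlying set.
  SetInvariant : (List A → ℕ) → Set
  SetInvariant h = ∀ {F G} → F ⊆ G → G ⊆ F → h F ≡ h G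

  -- A pair (F , e ∈ E) with e ∉ F is a set of size 1 + |F| with a
  -- distinguished element, and in a pair with e ∈ F the edge e is redundant.
  double-count : ∀ (E : List A) (w : ℕ → ℕ) (h : List A → ℕ) → SetInvariant h →
    ∑ (sublists E) (λ F → length F * (w (length F) + w (suc (length F))) * h F)
      ≡ ∑ (sublists E) (λ F → ∑ E (λ e → w (suc (length F)) * h (e ∷ F)))
  double-count []      w h inv = refl
  double-count (x ∷ E) w h inv = begin
    ∑ (sublists (x ∷ E)) (λ F → length F * (w (length F) + w (suc (length F))) * h F)
      ≡⟨ ∑-sublists-∷ x E _ ⟩
    ∑F (λ F → length F * (w (length F) + w₁ F) * h F + (1 + length F) * (w₁ F + w₂ F) * h (x ∷ F))
      ≡⟨ ∑-cong′ (sublists E) (λ F → regroup (length F) (w (length F)) (w₁ F) (w₂ F) (h F) (h (x ∷ F))) ⟩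
    ∑F (λ F → (length F * (w (length F) + w₁ F) * h F + length F * (w₁ F + w₂ F) * h (x ∷ F))
                          + (w₁ F * h (x ∷ F) + w₂ F * h (x ∷ F)))
      ≡⟨ ∑-+ (sublists E) _ _ ⟩
    ∑F (λ F → length F * (w (length F) + w₁ F) * h F + length F * (w₁ F + w₂ F) * h (x ∷ F))
      + ∑F (λ F → w₁ F * h (x ∷ F) + w₂ F * h (x ∷ F))
      -- For the sublists containing `x` the induction hypothesis is applied to the shifted weight
      -- and to `h (x ∷ F)`. The 1 in the length 1 + |F| supplies the terms with e = x, for both `F`
      -- and `x ∷ F`.
      ≡⟨ cong₂ _+_
           (trans (∑-+ (sublists E) _ _)
             (cong₂ _+_ (double-count E w h inv)
               (double-count E (w ∘ suc) (h ∘ (x ∷_)) (λ p q → inv (∷⁺ʳ x p) (∷⁺ʳ x q)))))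
           (∑-cong′ (sublists E) (λ F → cong (λ z → w₁ F * h (x ∷ F) + w₂ F * z) (inv there contract))) ⟩
    (∑F (λ F → ∑ E (λ e → w₁ F * h (e ∷ F)))
      + ∑F (λ F → ∑ E (λ e → w₂ F * h (x ∷ e ∷ F))))
      + ∑F (λ F → w₁ F * h (x ∷ F) + w₂ F * h (x ∷ x ∷ F))
      ≡⟨ cong (_+ ∑F (λ F → w₁ F * h (x ∷ F) + w₂ F * h (x ∷ x ∷ F))) (∑-+ (sublists E) _ _) ⟨
    ∑F (λ F → ∑ E (λ e → w₁ F * h (e ∷ F)) + ∑ E (λ e → w₂ F * h (x ∷ e ∷ F)))
      + ∑F (λ F → w₁ F * h (x ∷ F) + w₂ F * h (x ∷ x ∷ F))
      ≡⟨ ∑-+ (sublists E) _ _ ⟨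
    ∑F (λ F → (∑ E (λ e → w₁ F * h (e ∷ F)) + ∑ E (λ e → w₂ F * h (x ∷ e ∷ F)))
                          + (w₁ F * h (x ∷ F) + w₂ F * h (x ∷ x ∷ F)))
      ≡⟨ ∑-cong′ (sublists E) (λ F → trans
           (cong (λ z → (∑ E (λ e → w₁ F * h (e ∷ F)) + z) + (w₁ F * h (x ∷ F) + w₂ F * h (x ∷ x ∷ F)))
             (∑-cong′ E (λ e → cong (w₂ F *_) (inv exchange exchange))))
           (shuffle (∑ E (λ e → w₁ F * h (e ∷ F))) _ (w₁ F * h (x ∷ F)) _)) ⟩
    ∑F (λ F → (w₁ F * h (x ∷ F) + ∑ E (λ e → w₁ F * h (e ∷ F)))
                          + (w₂ F * h (x ∷ x ∷ F) + ∑ E (λ e → w₂ F * h (e ∷ x ∷ F))))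
      ≡⟨ ∑-sublists-∷ x E _ ⟨
    ∑ (sublists (x ∷ E)) (λ F → ∑ (x ∷ E) (λ e → w (suc (length F)) * h (e ∷ F))) ∎
    where
    open ≡-Reasoning
    ∑F : (List A → ℕ) → ℕ
    ∑F = ∑ (sublists E)
    w₁ w₂ : List A → ℕ
    w₁ F = w (suc (length F))
    w₂ F = w (suc (suc (length F)))
    regroup : ∀ l a b c g g′ → l * (a + b) * g + (1 + l) * (b + c) * g′
              ≡ (l * (a + b) * g + l * (b + c) * g′) + (b * g′ + c * g′)
    regroup = solve-∀
    shuffle : ∀ a b c d → (a + b) + (c + d) ≡ (c + a) + (d + b)
    shuffle = solve-∀
    contract : ∀ {F} → x ∷ x ∷ F ⊆ x ∷ F
    contract (here eq) = here eq
    contract (there p) = p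
    exchange : ∀ {y z F} → y ∷ z ∷ F ⊆ z ∷ y ∷ F
    exchange (here eq)         = there (here eq)
    exchange (there (here eq)) = here eq
    exchange (there (there p)) = there (there p)

-- Vertex sets and their splits

VertexSet : ℕ → Set
VertexSet = Vec Bool

infix 4 _∈ᵛ_
_∈ᵛ_ : ∀ {n} → Fin n → VertexSet n → Set
u ∈ᵛ A = lookup A u ≡ true

full : ∀ n → VertexSet n
full n = replicate n true

⟨_⟩ : Bool → ℕ
⟨ b ⟩ = if b then 1 else 0

⟨⟩≢0 : ∀ {b} → ⟨ b ⟩ ≢ 0 → b ≡ true
⟨⟩≢0 {true}  _  = refl
⟨⟩≢0 {false} ≢0 = contradiction refl ≢0

-- Ordered splits, empty sides included. The order records which endpoint of a deleted edge lies on
-- which side.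
splits : ∀ {n} → VertexSet n → List (VertexSet n × VertexSet n)
splits []          = ([] , []) ∷ []
splits (false ∷ A) = map (λ (B , C) → false ∷ B , false ∷ C) (splits A)
splits (true  ∷ A) = map (λ (B , C) → true ∷ B , false ∷ C) (splits A)
                  ++ map (λ (B , C) → false ∷ B , true ∷ C) (splits A)

∑-splits-∷ : ∀ {n} (A : VertexSet n) f → ∑₂ (splits (true ∷ A)) f ≡
  ∑₂ (splits A) (λ B C → f (true ∷ B) (false ∷ C)) + ∑₂ (splits A) (λ B C → f (false ∷ B) (true ∷ C))
∑-splits-∷ A f = trans (∑-++ (map _ (splits A)) _ (uncurry f))
  (cong₂ _+_ (∑-map _ (splits A) (uncurry f)) (∑-map _ (splits A) (uncurry f)))

data Side : Bool → Bool → Bool → Set where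
  outside : Side false false false
  left    : Side true  true  false
  right   : Side true  false true

record IsSplit {n} (A B C : VertexSet n) : Set where
  constructor sides
  field side : ∀ u → Side (lookup A u) (lookup B u) (lookup C u)
open IsSplit

side-∷ : ∀ {n a b c} {A B C : VertexSet n} → Side a b c → IsSplit A B C → IsSplit (a ∷ A) (b ∷ B) (c ∷ C)
side-∷ s ss .side zero    = s
side-∷ s ss .side (suc u) = ss .side u

splits-sound : ∀ {n} (A : VertexSet n) {B C} → (B , C) ∈ splits A → IsSplit A B C
splits-sound []          (here refl) = sides λ ()
splits-sound (false ∷ A) p with ∈-map⁻ _ p
... | _ , q , refl = side-∷ outside (splits-sound A q)
splits-sound (true ∷ A) p with ∈-++⁻ (map _ (splits A)) p
... | inj₁ q with ∈-map⁻ _ q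
...   | _ , r , refl = side-∷ left (splits-sound A r)
splits-sound (true ∷ A) p | inj₂ q with ∈-map⁻ _ q
...   | _ , r , refl = side-∷ right (splits-sound A r)

module _ {n} {A B C : VertexSet n} (split : IsSplit A B C) where

  left⇒ : ∀ {u} → u ∈ᵛ B → u ∈ᵛ A
  left⇒ {u} p with lookup A u | lookup B u | lookup C u | split .side u
  ... | _ | _ | _ | left = refl

  right⇒ : ∀ {u} → u ∈ᵛ C → u ∈ᵛ A
  right⇒ {u} p with lookup A u | lookup B u | lookup C u | split .side u
  ... | _ | _ | _ | right = refl

  disjoint : ∀ {u} → u ∈ᵛ B → ¬ (u ∈ᵛ C)
  disjoint {u} p q with lookup A u | lookup B u | lookup C u | split .side u
  disjoint {u} p  () | _ | _ | _ | left
  disjoint {u} () q  | _ | _ | _ | right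

  cover : ∀ {u} → u ∈ᵛ A → u ∈ᵛ B ⊎ u ∈ᵛ C
  cover {u} p with lookup A u | lookup B u | lookup C u | split .side u
  ... | _ | _ | _ | left  = inj₁ refl
  ... | _ | _ | _ | right = inj₂ refl

  not-left : ∀ {u} → u ∈ᵛ C → lookup B u ≡ false
  not-left {u} p with lookup A u | lookup B u | lookup C u | split .side u
  ... | _ | _ | _ | right = refl

part₁ part₂ : ∀ {n} → VertexSet n → (Fin n → Bool) → VertexSet n
part₁ A P = tabulate (λ u → lookup A u ∧ P u)
part₂ A P = tabulate (λ u → lookup A u ∧ not (P u))

side-∧ : ∀ a p → Side a (a ∧ p) (a ∧ not p)
side-∧ false _     = outside
side-∧ true  true  = left
side-∧ true  false = right

part-split : ∀ {n} (A : VertexSet n) P → IsSplit A (part₁ A P) (part₂ A P)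
part-split A P .side u
  rewrite lookup∘tabulate (λ u → lookup A u ∧ P u) u
        | lookup∘tabulate (λ u → lookup A u ∧ not (P u)) u = side-∧ (lookup A u) (P u)

-- A nonzero term forces every vertex of `A` onto the side prescribed by `P`, so one term survives.
∑-splits-unique : ∀ {n} (A : VertexSet n) (P : Fin n → Bool) (f : VertexSet n → VertexSet n → ℕ) →
  (∀ B C → IsSplit A B C → f B C ≢ 0 → ∀ u → u ∈ᵛ A → lookup B u ≡ P u) →
  ∑₂ (splits A) f ≡ f (part₁ A P) (part₂ A P)
∑-splits-unique []          P f only = +-identityʳ _
∑-splits-unique (false ∷ A) P f only = trans (∑-map _ (splits A) (uncurry f))
  (∑-splits-unique A (P ∘ suc) _ (λ B C ss ≢0 u → only _ _ (side-∷ outside ss) ≢0 (suc u)))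
∑-splits-unique (true ∷ A) P f only with P zero in eq
... | true  = trans (∑-splits-∷ A f) (trans (cong₂ _+_
  (∑-splits-unique A (P ∘ suc) _ (λ B C ss ≢0 u → only _ _ (side-∷ left ss) ≢0 (suc u)))
  (∑-0 (splits A) (λ {(B , C)} p → decidable-stable (_ ≟ℕ 0) (λ ≢0 →
     case trans (only _ _ (side-∷ right (splits-sound A p)) ≢0 zero refl) eq of λ ()))))
  (+-identityʳ _))
... | false = trans (∑-splits-∷ A f) (cong₂ _+_
  (∑-0 (splits A) (λ {(B , C)} p → decidable-stable (_ ≟ℕ 0) (λ ≢0 →
     case trans (only _ _ (side-∷ left (splits-sound A p)) ≢0 zero refl) eq of λ ())))
  (∑-splits-unique A (P ∘ suc) _ (λ B C ss ≢0 u → only _ _ (side-∷ right ss) ≢0 (suc u))))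

-- Induced subgraphs and separated edge sets

inside : ∀ {n} → VertexSet n → Fin n × Fin n → Bool
inside A (u , v) = lookup A u ∧ lookup A v

infixl 20 _⟦_⟧
_⟦_⟧ : ∀ {n} → Edges n → VertexSet n → Edges n
F ⟦ A ⟧ = filterᵇ (inside A) F

separated : ∀ {n} → VertexSet n → VertexSet n → Edges n → ℕ
separated B C []      = 1
separated B C (e ∷ F) = if inside B e ∨ inside C e then separated B C F else 0

∧-true : ∀ {a b} → a ∧ b ≡ true → a ≡ true × b ≡ true
∧-true {true} p = refl , p

inside-both : ∀ {n} (A : VertexSet n) {u v} → u ∈ᵛ A → v ∈ᵛ A → inside A (u , v) ≡ true
inside-both A p q rewrite p | q = refl

separated⇒ : ∀ {n} (B C : VertexSet n) F → separated B C F ≢ 0 →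
  ∀ {e} → e ∈ F → inside B e ≡ true ⊎ inside C e ≡ true
separated⇒ B C (e ∷ F) ≢0 p with inside B e in eqB | inside C e in eqC
separated⇒ B C (e ∷ F) ≢0 (here refl) | true  | _     = inj₁ eqB
separated⇒ B C (e ∷ F) ≢0 (here refl) | false | true  = inj₂ eqC
separated⇒ B C (e ∷ F) ≢0 (there p)   | true  | _     = separated⇒ B C F ≢0 p
separated⇒ B C (e ∷ F) ≢0 (there p)   | false | true  = separated⇒ B C F ≢0 p
separated⇒ B C (e ∷ F) ≢0 p           | false | false = contradiction refl ≢0

separated⇐ : ∀ {n} (B C : VertexSet n) F →
  (∀ {e} → e ∈ F → inside B e ≡ true ⊎ inside C e ≡ true) → separated B C F ≡ 1
separated⇐ B C []      sep = refl
separated⇐ B C (e ∷ F) sep with inside B e | inside C e | sep (here refl)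
... | true  | _    | _      = separated⇐ B C F (sep ∘ there)
... | false | true | _      = separated⇐ B C F (sep ∘ there)
... | false | false | inj₁ ()
... | false | false | inj₂ ()

module _ {n} (B C : VertexSet n) (disj : ∀ {u} → u ∈ᵛ B → ¬ (u ∈ᵛ C)) where

  inside-disjoint : ∀ e → inside B e ≡ true → ¬ (inside C e ≡ true)
  inside-disjoint e p q = disj (proj₁ (∧-true p)) (proj₁ (∧-true q))

  length-separated : ∀ F → separated B C F ≢ 0 → length F ≡ length (F ⟦ B ⟧) + length (F ⟦ C ⟧)
  length-separated []      ≢0 = refl
  length-separated (e ∷ F) ≢0 with inside B e in eqB | inside C e in eqC
  ... | true  | true  = contradiction eqC (inside-disjoint e eqB)
  ... | true  | false = cong suc (length-separated F ≢0)
  ... | false | true  = trans (cong suc (length-separated F ≢0)) (sym (+-suc _ _))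
  ... | false | false = contradiction refl ≢0

  -- Edges inside neither `B` nor `C` cannot be chosen, and the choices inside `B` and inside `C`
  -- are independent because the two sets are disjoint.
  ∑-separated : ∀ E (g : Edges n → Edges n → ℕ) →
    ∑ (sublists E) (λ F → separated B C F * g (F ⟦ B ⟧) (F ⟦ C ⟧))
      ≡ ∑ (sublists (E ⟦ B ⟧)) (λ F₁ → ∑ (sublists (E ⟦ C ⟧)) (g F₁))
  ∑-separated []      g = refl
  ∑-separated (e ∷ E) g = trans (∑-sublists-∷ e E _) step
    where
    open ≡-Reasoning
    step : ∑ (sublists E) (λ F → separated B C F * g (F ⟦ B ⟧) (F ⟦ C ⟧)
                               + separated B C (e ∷ F) * g ((e ∷ F) ⟦ B ⟧) ((e ∷ F) ⟦ C ⟧))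
      ≡ ∑ (sublists ((e ∷ E) ⟦ B ⟧)) (λ F₁ → ∑ (sublists ((e ∷ E) ⟦ C ⟧)) (g F₁))
    step with inside B e in eqB | inside C e in eqC
    ... | true  | true  = contradiction eqC (inside-disjoint e eqB)
    ... | true  | false = begin
      _ ≡⟨ ∑-+ (sublists E) _ _ ⟩
      _ ≡⟨ cong₂ _+_ (∑-separated E g) (∑-separated E (g ∘ (e ∷_))) ⟩
      _ ≡⟨ ∑-+ (sublists (E ⟦ B ⟧)) _ _ ⟨
      _ ≡⟨ ∑-sublists-∷ e (E ⟦ B ⟧) _ ⟨
      _ ∎
    ... | false | true  = begin
      _ ≡⟨ ∑-+ (sublists E) _ _ ⟩
      _ ≡⟨ cong₂ _+_ (∑-separated E g) (∑-separated E (λ F₁ → g F₁ ∘ (e ∷_))) ⟩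
      _ ≡⟨ ∑-+ (sublists (E ⟦ B ⟧)) _ _ ⟨
      _ ≡⟨ ∑-cong′ (sublists (E ⟦ B ⟧)) (λ F₁ → trans (sym (∑-+ (sublists (E ⟦ C ⟧)) _ _)) (sym (∑-sublists-∷ e (E ⟦ C ⟧) (g F₁)))) ⟩
      _ ∎
    ... | false | false = begin
      _ ≡⟨ ∑-cong′ (sublists E) (λ F → +-identityʳ _) ⟩
      _ ≡⟨ ∑-separated E g ⟩
      _ ∎

-- The deletion recursion

-- Paths may use all of `F`; in the counts below `F` consists of edges inside `A`, so they stay in
-- `A`. Nonemptiness keeps an empty side of a split from counting as a component.
ConnectedOn : ∀ {n} → VertexSet n → Edges n → Set
ConnectedOn A F = (∃ λ u → u ∈ᵛ A) × (∀ u v → u ∈ᵛ A → v ∈ᵛ A → Joined F u v)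

abstract
  connectedOn? : ∀ {n} (A : VertexSet n) F → Dec (ConnectedOn A F)
  connectedOn? A F =
    any? (λ u → lookup A u ≟ᵇ true) ×-dec
    all? (λ u → all? (λ v → (lookup A u ≟ᵇ true) →-dec ((lookup A v ≟ᵇ true) →-dec joined? F u v)))

count : ∀ {n} → Edges n → VertexSet n → ℕ → ℕ
count E A m = ∑ (sublists (E ⟦ A ⟧)) (λ F → 𝟙 (length F ≟ℕ m) * 𝟙 (connectedOn? A F))

joined-sym : ∀ {n} {F : Edges n} {u v} → Joined F u v → Joined F v u
joined-sym = Eq.symmetric _

joined-⊆ : ∀ {n} {F G : Edges n} {u v} → F ⊆ G → Joined F u v → Joined G u v
joined-⊆ F⊆G = Eq.map F⊆G

connectedOn-⊆ : ∀ {n} (A : VertexSet n) {F G} → F ⊆ G → ConnectedOn A F → ConnectedOn A G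
connectedOn-⊆ A F⊆G (ne , c) = ne , λ u v p q → joined-⊆ F⊆G (c u v p q)

⟦⟧-⊆ : ∀ {n} (A : VertexSet n) {F} → F ⟦ A ⟧ ⊆ F
⟦⟧-⊆ A {F} p = proj₁ (∈-filter⁻ (T? ∘ inside A) {xs = F} p)

∈-⟦⟧ : ∀ {n} (A : VertexSet n) {F e} → e ∈ F ⟦ A ⟧ → inside A e ≡ true
∈-⟦⟧ A {F} {e} p with inside A e | proj₂ (∈-filter⁻ (T? ∘ inside A) {xs = F} p)
... | true | _ = refl

⟦⟧-∈ : ∀ {n} (A : VertexSet n) {F e} → e ∈ F → inside A e ≡ true → e ∈ F ⟦ A ⟧
⟦⟧-∈ A p eq = ∈-filter⁺ (T? ∘ inside A) p (subst T (sym eq) _)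

⟦⟧-⟦⟧ : ∀ {n} (E : Edges n) (A B : VertexSet n) → (∀ {u} → u ∈ᵛ B → u ∈ᵛ A) → E ⟦ A ⟧ ⟦ B ⟧ ≡ E ⟦ B ⟧
⟦⟧-⟦⟧ []            A B B⊆A = refl
⟦⟧-⟦⟧ ((u , v) ∷ E) A B B⊆A with lookup B u in equ | lookup B v in eqv | inside A (u , v) in eq
... | true  | true  | true  rewrite equ | eqv = cong (_ ∷_) (⟦⟧-⟦⟧ E A B B⊆A)
... | true  | true  | false = contradiction (trans (sym eq) (inside-both A (B⊆A equ) (B⊆A eqv))) λ ()
... | true  | false | true  rewrite equ | eqv = ⟦⟧-⟦⟧ E A B B⊆A
... | true  | false | false = ⟦⟧-⟦⟧ E A B B⊆A
... | false | _     | true  rewrite equ = ⟦⟧-⟦⟧ E A B B⊆A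
... | false | _     | false = ⟦⟧-⟦⟧ E A B B⊆A

joined-closed : ∀ {n} {F : Edges n} (B : VertexSet n) →
  (∀ {u v} → (u , v) ∈ F → (u ∈ᵛ B → v ∈ᵛ B) × (v ∈ᵛ B → u ∈ᵛ B)) →
  ∀ {u v} → Joined F u v → u ∈ᵛ B → v ∈ᵛ B
joined-closed B cl ε            p = p
joined-closed B cl (fwd e ◅ ps) p = joined-closed B cl ps (proj₁ (cl e) p)
joined-closed B cl (bwd e ◅ ps) p = joined-closed B cl ps (proj₂ (cl e) p)

joined-restrict : ∀ {n} {F : Edges n} (B : VertexSet n) →
  (∀ {u v} → (u , v) ∈ F → (u ∈ᵛ B → v ∈ᵛ B) × (v ∈ᵛ B → u ∈ᵛ B)) →
  ∀ {u v} → Joined F u v → u ∈ᵛ B → Joined (F ⟦ B ⟧) u v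
joined-restrict B cl ε            p = ε
joined-restrict B cl (fwd e ◅ ps) p =
  fwd (⟦⟧-∈ B e (inside-both B p (proj₁ (cl e) p))) ◅ joined-restrict B cl ps (proj₁ (cl e) p)
joined-restrict B cl (bwd e ◅ ps) p =
  bwd (⟦⟧-∈ B e (inside-both B (proj₂ (cl e) p) p)) ◅ joined-restrict B cl ps (proj₂ (cl e) p)

module _ {n} {F : Edges n} {u v : Fin n} where

  -- Walking along the path, each use of the new edge restarts at `u` or at `v`, so only the
  -- attachment of the current vertex to one of them has to be tracked.
  joined-split : ∀ {x y} → Joined ((u , v) ∷ F) x y →
    Joined F u x ⊎ Joined F v x → Joined F u y ⊎ Joined F v y
  joined-split ε                      p        = p
  joined-split (fwd (here refl) ◅ ps) p        = joined-split ps (inj₂ ε)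
  joined-split (bwd (here refl) ◅ ps) p        = joined-split ps (inj₁ ε)
  joined-split (fwd (there e) ◅ ps)   (inj₁ p) = joined-split ps (inj₁ (p ◅◅ fwd e ◅ ε))
  joined-split (fwd (there e) ◅ ps)   (inj₂ p) = joined-split ps (inj₂ (p ◅◅ fwd e ◅ ε))
  joined-split (bwd (there e) ◅ ps)   (inj₁ p) = joined-split ps (inj₁ (p ◅◅ bwd e ◅ ε))
  joined-split (bwd (there e) ◅ ps)   (inj₂ p) = joined-split ps (inj₂ (p ◅◅ bwd e ◅ ε))

  joined-redundant : Joined F u v → ∀ {x y} → Joined ((u , v) ∷ F) x y → Joined F x y
  joined-redundant uv ε                      = ε
  joined-redundant uv (fwd (here refl) ◅ ps) = uv ◅◅ joined-redundant uv ps
  joined-redundant uv (bwd (here refl) ◅ ps) = joined-sym uv ◅◅ joined-redundant uv ps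
  joined-redundant uv (fwd (there e) ◅ ps)   = fwd e ◅ joined-redundant uv ps
  joined-redundant uv (bwd (there e) ◅ ps)   = bwd e ◅ joined-redundant uv ps

-- For a split (`B` , `C`) this is the indicator that `B` and `C` are the vertex sets of the two
-- components of `F`.
connectedPair : ∀ {n} → Edges n → VertexSet n → VertexSet n → ℕ
connectedPair F B C = separated B C F * (𝟙 (connectedOn? B (F ⟦ B ⟧)) * 𝟙 (connectedOn? C (F ⟦ C ⟧)))

crosses : ∀ {n} → Fin n × Fin n → VertexSet n → VertexSet n → ℕ
crosses (u , v) B C = ⟨ lookup B u ⟩ * ⟨ lookup C v ⟩

*≢0ˡ : ∀ {a b} → a * b ≢ 0 → a ≢ 0
*≢0ˡ ≢0 refl = ≢0 refl

*≢0ʳ : ∀ {a b} → a * b ≢ 0 → b ≢ 0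
*≢0ʳ {a} ≢0 refl = ≢0 (*-zeroʳ a)

module _ {n} (A : VertexSet n) (F : Edges n) (F⊆A : ∀ {e} → e ∈ F → inside A e ≡ true)
         {u v : Fin n} (u∈A : u ∈ᵛ A) (v∈A : v ∈ᵛ A) where

  private
    term : VertexSet n → VertexSet n → ℕ
    term B C = crosses (u , v) B C * connectedPair F B C

    -- A nonzero term certifies that `B` is the component of `u` and `C` that of `v`.
    module Term B C (split : IsSplit A B C) (≢0 : term B C ≢ 0) where
      pair≢0 : connectedPair F B C ≢ 0
      pair≢0 = *≢0ʳ {crosses (u , v) B C} ≢0
      u∈B : u ∈ᵛ B
      u∈B = ⟨⟩≢0 (*≢0ˡ (*≢0ˡ ≢0))
      v∈C : v ∈ᵛ C
      v∈C = ⟨⟩≢0 (*≢0ʳ {⟨ lookup B u ⟩} (*≢0ˡ ≢0))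
      sep : ∀ {e} → e ∈ F → inside B e ≡ true ⊎ inside C e ≡ true
      sep = separated⇒ B C F (*≢0ˡ pair≢0)
      connB : ConnectedOn B (F ⟦ B ⟧)
      connB = 𝟙≢0 (connectedOn? B (F ⟦ B ⟧)) (*≢0ˡ (*≢0ʳ {separated B C F} pair≢0))
      connC : ConnectedOn C (F ⟦ C ⟧)
      connC = 𝟙≢0 (connectedOn? C (F ⟦ C ⟧))
                (*≢0ʳ {𝟙 (connectedOn? B (F ⟦ B ⟧))} (*≢0ʳ {separated B C F} pair≢0))
      closed : ∀ {x y} → (x , y) ∈ F → (x ∈ᵛ B → y ∈ᵛ B) × (y ∈ᵛ B → x ∈ᵛ B)
      closed e with sep e
      ... | inj₁ i = (λ _ → proj₂ (∧-true i)) , (λ _ → proj₁ (∧-true i))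
      ... | inj₂ i = (λ p → ⊥-elim (disjoint split p (proj₁ (∧-true i))))
                   , (λ p → ⊥-elim (disjoint split p (proj₂ (∧-true i))))
      u⇝ : ∀ {w} → w ∈ᵛ B → Joined F u w
      u⇝ q = joined-⊆ (⟦⟧-⊆ B) (proj₂ connB _ _ u∈B q)
      u↛ : ∀ {w} → w ∈ᵛ C → ¬ Joined F u w
      u↛ q uw = disjoint split (joined-closed B closed uw u∈B) q

    term≡0 : (∀ {B C} → IsSplit A B C → ¬ (term B C ≢ 0)) → ∑₂ (splits A) term ≡ 0
    term≡0 none = ∑-0 (splits A) (λ p → decidable-stable (_ ≟ℕ 0) (none (splits-sound A p)))

    reached : Fin n → Bool
    reached w = does (joined? F u w)

    reached-yes : ∀ {w} → Joined F u w → reached w ≡ true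
    reached-yes {w} p with joined? F u w
    ... | yes _ = refl
    ... | no ¬p = contradiction p ¬p

    reached-no : ∀ {w} → ¬ Joined F u w → reached w ≡ false
    reached-no {w} ¬p with joined? F u w
    ... | yes p = contradiction p ¬p
    ... | no _  = refl

    -- If the new edge is what makes the graph connected, the split is forced: `B` is the set of
    -- vertices reached from `u` without it.
    module Component (¬conn : ¬ ConnectedOn A F) (conn : ConnectedOn A ((u , v) ∷ F)) where
      B C : VertexSet n
      B = part₁ A reached
      C = part₂ A reached

      split : IsSplit A B C
      split = part-split A reached

      ¬uv : ¬ Joined F u v
      ¬uv uv = ¬conn ((u , u∈A) , λ x y p q → joined-redundant uv (proj₂ conn x y p q))

      ∈B⁺ : ∀ {w} → w ∈ᵛ A → Joined F u w → w ∈ᵛ B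
      ∈B⁺ {w} p j rewrite lookup∘tabulate (λ u → lookup A u ∧ reached u) w | p = reached-yes j

      ∈C⁺ : ∀ {w} → w ∈ᵛ A → ¬ Joined F u w → w ∈ᵛ C
      ∈C⁺ {w} p ¬j rewrite lookup∘tabulate (λ u → lookup A u ∧ not (reached u)) w | p | reached-no ¬j = refl

      ∈B⁻ : ∀ {w} → w ∈ᵛ B → Joined F u w
      ∈B⁻ {w} p with joined? F u w
      ... | yes j = j
      ... | no ¬j = contradiction (∈C⁺ (left⇒ split p) ¬j) (disjoint split p)

      ∈C⁻ : ∀ {w} → w ∈ᵛ C → ¬ Joined F u w
      ∈C⁻ p j = disjoint split (∈B⁺ (right⇒ split p) j) p

      v⇝ : ∀ {w} → w ∈ᵛ C → Joined F v w
      v⇝ {w} p with joined-split (proj₂ conn u w u∈A (right⇒ split p)) (inj₁ ε)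
      ... | inj₁ j = contradiction j (∈C⁻ p)
      ... | inj₂ j = j

      u∈B : u ∈ᵛ B
      u∈B = ∈B⁺ u∈A ε

      v∈C : v ∈ᵛ C
      v∈C = ∈C⁺ v∈A ¬uv

      closedB : ∀ {x y} → (x , y) ∈ F → (x ∈ᵛ B → y ∈ᵛ B) × (y ∈ᵛ B → x ∈ᵛ B)
      closedB e = (λ p → ∈B⁺ (proj₂ (∧-true (F⊆A e))) (∈B⁻ p ◅◅ fwd e ◅ ε))
                , (λ p → ∈B⁺ (proj₁ (∧-true (F⊆A e))) (∈B⁻ p ◅◅ bwd e ◅ ε))

      closedC : ∀ {x y} → (x , y) ∈ F → (x ∈ᵛ C → y ∈ᵛ C) × (y ∈ᵛ C → x ∈ᵛ C)
      closedC e = (λ p → ∈C⁺ (proj₂ (∧-true (F⊆A e))) (λ j → ∈C⁻ p (j ◅◅ bwd e ◅ ε)))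
                , (λ p → ∈C⁺ (proj₁ (∧-true (F⊆A e))) (λ j → ∈C⁻ p (j ◅◅ fwd e ◅ ε)))

      sep : ∀ {e} → e ∈ F → inside B e ≡ true ⊎ inside C e ≡ true
      sep {x , y} e with cover split (proj₁ (∧-true (F⊆A e)))
      ... | inj₁ p = inj₁ (inside-both B p (proj₁ (closedB e) p))
      ... | inj₂ p = inj₂ (inside-both C p (proj₁ (closedC e) p))

      term≡1 : term B C ≡ 1
      term≡1
        rewrite u∈B | v∈C | separated⇐ B C F sep
              | 𝟙-yes (connectedOn? B (F ⟦ B ⟧))
                  ((u , u∈B) , λ x y p q → joined-restrict B closedB (joined-sym (∈B⁻ p) ◅◅ ∈B⁻ q) p)
              | 𝟙-yes (connectedOn? C (F ⟦ C ⟧))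
                  ((v , v∈C) , λ x y p q → joined-restrict C closedC (joined-sym (v⇝ p) ◅◅ v⇝ q) p)
        = refl

      only : ∀ B′ C′ → IsSplit A B′ C′ → term B′ C′ ≢ 0 → ∀ w → w ∈ᵛ A → lookup B′ w ≡ reached w
      only B′ C′ ss ≢0 w p with cover ss p
      ... | inj₁ q = trans q (sym (reached-yes (Term.u⇝ B′ C′ ss ≢0 q)))
      ... | inj₂ q = trans (not-left ss q) (sym (reached-no (Term.u↛ B′ C′ ss ≢0 q)))

  -- Deleting an edge from a connected graph leaves it connected or leaves
  -- exactly two components, one for each endpoint.
  add-edge : 𝟙 (connectedOn? A ((u , v) ∷ F)) ≡
    𝟙 (connectedOn? A F) + ∑₂ (splits A) (λ B C → crosses (u , v) B C * connectedPair F B C)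
  add-edge with connectedOn? A F
  ... | yes conn = trans (𝟙-yes (connectedOn? A ((u , v) ∷ F)) (connectedOn-⊆ A there conn))
          (cong suc (sym (term≡0 (λ {B} {C} split ≢0 →
            Term.u↛ B C split ≢0 (Term.v∈C B C split ≢0) (proj₂ conn u v u∈A v∈A)))))
  ... | no ¬conn with connectedOn? A ((u , v) ∷ F)
  ...   | yes conn = sym (trans (∑-splits-unique A reached term (Component.only ¬conn conn))
                                (Component.term≡1 ¬conn conn))
  ...   | no ¬conn′ = sym (term≡0 (λ split ≢0 → ¬conn′ (joins split ≢0)))
    where
    joins : ∀ {B C} → IsSplit A B C → term B C ≢ 0 → ConnectedOn A ((u , v) ∷ F)
    joins {B} {C} split ≢0 = (u , u∈A) , λ x y p q → joined-sym (from-u p) ◅◅ from-u q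
      where
      open Term B C split ≢0
      from-u : ∀ {x} → x ∈ᵛ A → Joined ((u , v) ∷ F) u x
      from-u p with cover split p
      ... | inj₁ q = joined-⊆ there (u⇝ q)
      ... | inj₂ q = fwd (here refl) ◅ joined-⊆ (there ∘ ⟦⟧-⊆ C) (proj₂ connC _ _ v∈C q)

crossings : ∀ {n} → Edges n → VertexSet n → VertexSet n → ℕ
crossings E B C = ∑ E (λ e → crosses e B C)

∑-const : {A : Set} (xs : List A) (c : ℕ) → ∑ xs (λ _ → c) ≡ length xs * c
∑-const []       c = refl
∑-const (x ∷ xs) c = cong (c +_) (∑-const xs c)

*-𝟙-≟ : ∀ l c → l * 𝟙 (l ≟ℕ c) ≡ c * 𝟙 (l ≟ℕ c)
*-𝟙-≟ l c = helper (l ≟ℕ c)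
  where
  helper : (d : Dec (l ≡ c)) → l * 𝟙 d ≡ c * 𝟙 d
  helper (yes refl) = refl
  helper (no _)     = trans (*-zeroʳ l) (sym (*-zeroʳ c))

𝟙-suc : ∀ l m → 𝟙 (suc l ≟ℕ suc m) ≡ 𝟙 (l ≟ℕ m)
𝟙-suc l m = 𝟙-cong (suc l ≟ℕ suc m) (l ≟ℕ m) suc-injective (cong suc)

𝟙-+-antidiagonal : ∀ a b m →
  𝟙 (a + b ≟ℕ m) ≡ ∑ᵃ m (λ i j → 𝟙 (a ≟ℕ i) * 𝟙 (b ≟ℕ j))
𝟙-+-antidiagonal zero    b zero    = sym (trans (+-identityʳ _) (+-identityʳ _))
𝟙-+-antidiagonal zero    b (suc m) = sym (trans (∑-antidiagonal-suc m (λ i j → 𝟙 (0 ≟ℕ i) * 𝟙 (b ≟ℕ j)))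
  (trans (cong₂ _+_ (+-identityʳ (𝟙 (b ≟ℕ suc m))) (∑-0 (antidiagonal m) (λ _ → refl))) (+-identityʳ (𝟙 (b ≟ℕ suc m)))))
𝟙-+-antidiagonal (suc a) b zero    = refl
𝟙-+-antidiagonal (suc a) b (suc m) = trans (𝟙-suc (a + b) m) (trans (𝟙-+-antidiagonal a b m)
  (sym (trans (∑-antidiagonal-suc m (λ i j → 𝟙 (suc a ≟ℕ i) * 𝟙 (b ≟ℕ j)))
    (∑-cong (antidiagonal m) (λ {(i , j)} _ → cong (_* 𝟙 (b ≟ℕ j)) (𝟙-suc a i))))))

connectedOn-invariant : ∀ {n} (A : VertexSet n) → SetInvariant (λ F → 𝟙 (connectedOn? A F))
connectedOn-invariant A {F} {G} F⊆G G⊆F =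
  𝟙-cong (connectedOn? A F) (connectedOn? A G) (connectedOn-⊆ A F⊆G) (connectedOn-⊆ A G⊆F)

crosses-inside : ∀ {n} {A B C : VertexSet n} → IsSplit A B C → ∀ e →
  𝟙 (T? (inside A e)) * crosses e B C ≡ crosses e B C
crosses-inside {A = A} {B} {C} split (u , v) with lookup B u in p | lookup C v in q
... | true  | true
  rewrite left⇒ split p | right⇒ split q = refl
... | true  | false = *-zeroʳ (𝟙 (T? (inside A (u , v))))
... | false | _     = *-zeroʳ (𝟙 (T? (inside A (u , v))))

crossings-⟦⟧ : ∀ {n} (E : Edges n) {A B C} → IsSplit A B C → crossings (E ⟦ A ⟧) B C ≡ crossings E B C
crossings-⟦⟧ E {A} split = trans (∑-filter (T? ∘ inside A) E _) (∑-cong′ E (crosses-inside split))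

module _ {n} (E : Edges n) {A B C : VertexSet n} (split : IsSplit A B C) (m : ℕ) where

  -- A graph with components `B` and `C` is a pair of connected graphs on `B` and on `C`, between
  -- which the m edges are distributed.
  ∑-connectedPair :
    ∑ (sublists (E ⟦ A ⟧)) (λ F → 𝟙 (length F ≟ℕ m) * connectedPair F B C)
      ≡ ∑ᵃ m (λ i j → count E B i * count E C j)
  ∑-connectedPair = begin
    ∑ (sublists (E ⟦ A ⟧)) (λ F → 𝟙 (length F ≟ℕ m) * connectedPair F B C)
      ≡⟨ ∑-cong′ (sublists (E ⟦ A ⟧)) by-length ⟩
    ∑ (sublists (E ⟦ A ⟧)) (λ F → separated B C F * g (F ⟦ B ⟧) (F ⟦ C ⟧))
      ≡⟨ ∑-separated B C (disjoint split) (E ⟦ A ⟧) g ⟩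
    ∑ (sublists (E ⟦ A ⟧ ⟦ B ⟧)) (λ F₁ → ∑ (sublists (E ⟦ A ⟧ ⟦ C ⟧)) (g F₁))
      ≡⟨ cong₂ (λ X Y → ∑ (sublists X) (λ F₁ → ∑ (sublists Y) (g F₁)))
           (⟦⟧-⟦⟧ E A B (left⇒ split)) (⟦⟧-⟦⟧ E A C (right⇒ split)) ⟩
    ∑ (sublists (E ⟦ B ⟧)) (λ F₁ → ∑ (sublists (E ⟦ C ⟧)) (g F₁))
      ≡⟨ ∑-cong′ (sublists (E ⟦ B ⟧)) (λ F₁ → ∑-cong′ (sublists (E ⟦ C ⟧)) (expand F₁)) ⟩
    ∑ (sublists (E ⟦ B ⟧)) (λ F₁ → ∑ (sublists (E ⟦ C ⟧)) (λ F₂ → ∑ᵃ m (λ i j → x F₁ i * y F₂ j)))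
      ≡⟨ ∑-cong′ (sublists (E ⟦ B ⟧)) (λ F₁ → ∑-swap (sublists (E ⟦ C ⟧)) (antidiagonal m) _) ⟩
    ∑ (sublists (E ⟦ B ⟧)) (λ F₁ → ∑ᵃ m (λ i j → ∑ (sublists (E ⟦ C ⟧)) (λ F₂ → x F₁ i * y F₂ j)))
      ≡⟨ ∑-swap (sublists (E ⟦ B ⟧)) (antidiagonal m) _ ⟩
    ∑ᵃ m (λ i j → ∑ (sublists (E ⟦ B ⟧)) (λ F₁ → ∑ (sublists (E ⟦ C ⟧)) (λ F₂ → x F₁ i * y F₂ j)))
      ≡⟨ ∑-cong′ (antidiagonal m) (λ (i , j) →
           sym (∑-*-∑ (sublists (E ⟦ B ⟧)) (sublists (E ⟦ C ⟧)) (λ F₁ → x F₁ i) (λ F₂ → y F₂ j))) ⟩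
    ∑ᵃ m (λ i j → count E B i * count E C j) ∎
    where
    open ≡-Reasoning
    x y : Edges n → ℕ → ℕ
    x F i = 𝟙 (length F ≟ℕ i) * 𝟙 (connectedOn? B F)
    y F j = 𝟙 (length F ≟ℕ j) * 𝟙 (connectedOn? C F)
    g : Edges n → Edges n → ℕ
    g F₁ F₂ = 𝟙 (length F₁ + length F₂ ≟ℕ m) * (𝟙 (connectedOn? B F₁) * 𝟙 (connectedOn? C F₂))
    regroup : ∀ a b c d → (a * b) * (c * d) ≡ (a * c) * (b * d)
    regroup = solve-∀
    by-length : ∀ F → 𝟙 (length F ≟ℕ m) * connectedPair F B C ≡ separated B C F * g (F ⟦ B ⟧) (F ⟦ C ⟧)
    by-length F with separated B C F ≟ℕ 0
    ... | yes ≡0 rewrite ≡0 = *-zeroʳ (𝟙 (length F ≟ℕ m))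
    ... | no ≢0 = trans (*-left-comm (𝟙 (length F ≟ℕ m)) (separated B C F) κ)
      (cong (λ l → separated B C F * (𝟙 (l ≟ℕ m) * κ)) (length-separated B C (disjoint split) F ≢0))
      where κ = 𝟙 (connectedOn? B (F ⟦ B ⟧)) * 𝟙 (connectedOn? C (F ⟦ C ⟧))
    expand : ∀ F₁ F₂ → g F₁ F₂ ≡ ∑ᵃ m (λ i j → x F₁ i * y F₂ j)
    expand F₁ F₂ = trans
      (cong (_* (𝟙 (connectedOn? B F₁) * 𝟙 (connectedOn? C F₂))) (𝟙-+-antidiagonal (length F₁) (length F₂) m))
      (trans (sym (∑-*ʳ (antidiagonal m) _ _))
        (∑-cong′ (antidiagonal m) (λ (i , j) → regroup (𝟙 (length F₁ ≟ℕ i)) _ _ _)))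

-- Counts the pairs of an m-edge set `F` and an edge e of the host such that `e ∷ F` is connected:
-- on the left by the resulting set, on the right by `F` with `add-edge`. The pairs with e already
-- in `F` give the term `m * count E A m`.
count-step : ∀ {n} (E : Edges n) A m →
  suc m * count E A (suc m) + m * count E A m ≡
  length (E ⟦ A ⟧) * count E A m
    + ∑₂ (splits A) (λ B C → crossings E B C * ∑ᵃ m (λ i j → count E B i * count E C j))
count-step {n} E A m = begin
  suc m * count E A (suc m) + m * count E A m
    ≡⟨ cong₂ _+_ (sym (∑-*ˡ (sublists E′) (suc m) _)) (sym (∑-*ˡ (sublists E′) m _)) ⟩
  ∑F (λ F → suc m * (𝟙 (length F ≟ℕ suc m) * h F)) + ∑F (λ F → m * (𝟙 (length F ≟ℕ m) * h F))
    ≡⟨ sym (∑-+ (sublists E′) _ _) ⟩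
  ∑F (λ F → suc m * (𝟙 (length F ≟ℕ suc m) * h F) + m * (𝟙 (length F ≟ℕ m) * h F))
    ≡⟨ ∑-cong′ (sublists E′) (λ F → sym (edge-weights (length F) (h F))) ⟩
  ∑F (λ F → length F * (w (length F) + w (suc (length F))) * h F)
    ≡⟨ double-count E′ w h (connectedOn-invariant A) ⟩
  ∑F (λ F → ∑ E′ (λ e → w (suc (length F)) * h (e ∷ F)))
    ≡⟨ ∑-cong (sublists E′) delete ⟩
  ∑F (λ F → length E′ * (𝟙 (length F ≟ℕ m) * h F)
                        + ∑₂ (splits A) (pairs F))
    ≡⟨ ∑-+ (sublists E′) _ _ ⟩
  ∑F (λ F → length E′ * (𝟙 (length F ≟ℕ m) * h F))
    + ∑F (λ F → ∑₂ (splits A) (pairs F))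
    ≡⟨ cong₂ _+_ (∑-*ˡ (sublists E′) (length E′) _) (∑-swap (sublists E′) (splits A) _) ⟩
  length E′ * count E A m
    + ∑₂ (splits A) (λ B C → ∑F (λ F → pairs F B C))
    ≡⟨ cong (length E′ * count E A m +_) (∑-cong (splits A) (λ {(B , C)} p →
         trans (∑-*ˡ (sublists E′) (crossings E B C) _)
               (cong (crossings E B C *_) (∑-connectedPair E (splits-sound A p) m)))) ⟩
  length E′ * count E A m
    + ∑₂ (splits A) (λ B C → crossings E B C * ∑ᵃ m (λ i j → count E B i * count E C j)) ∎
  where
  open ≡-Reasoning
  E′ = E ⟦ A ⟧
  ∑F : (Edges n → ℕ) → ℕ
  ∑F = ∑ (sublists E′)
  h : Edges n → ℕ
  h F = 𝟙 (connectedOn? A F)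
  pairs : Edges n → VertexSet n → VertexSet n → ℕ
  pairs F B C = crossings E B C * (𝟙 (length F ≟ℕ m) * connectedPair F B C)
  -- This weight selects the sets with m + 1 edges, obtained by adding a new edge, and through
  -- `w (suc l)` those with m edges, where the edge was already present.
  w : ℕ → ℕ
  w l = 𝟙 (l ≟ℕ suc m)
  edge-weights : ∀ l x → l * (w l + w (suc l)) * x ≡ suc m * (𝟙 (l ≟ℕ suc m) * x) + m * (𝟙 (l ≟ℕ m) * x)
  edge-weights l x = trans (expand l (w l) (w (suc l)) x)
    (cong₂ _+_ (trans (cong (_* x) (*-𝟙-≟ l (suc m))) (*-assoc (suc m) (w l) x))
               (trans (cong (_* x) (trans (cong (l *_) (𝟙-suc l m)) (*-𝟙-≟ l m))) (*-assoc m (𝟙 (l ≟ℕ m)) x)))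
    where
    expand : ∀ l a b x → l * (a + b) * x ≡ l * a * x + l * b * x
    expand = solve-∀
  delete : ∀ {F} → F ∈ sublists E′ → ∑ E′ (λ e → w (suc (length F)) * h (e ∷ F)) ≡
    length E′ * (𝟙 (length F ≟ℕ m) * h F)
      + ∑₂ (splits A) (pairs F)
  delete {F} F∈ = begin
    ∑ E′ (λ e → w (suc (length F)) * h (e ∷ F))
      ≡⟨ ∑-cong E′ (λ {e} e∈ → cong₂ _*_ (𝟙-suc (length F) m)
           (add-edge A F (∈-⟦⟧ A {E} ∘ sublists-⊆ E′ F∈) (proj₁ (∧-true (∈-⟦⟧ A {E} e∈))) (proj₂ (∧-true (∈-⟦⟧ A {E} e∈))))) ⟩
    ∑ E′ (λ e → δ * (h F + ∑₂ (splits A) (λ B C → crosses e B C * connectedPair F B C)))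
      ≡⟨ ∑-cong′ E′ (λ e → trans (*-distribˡ-+ δ (h F) _)
           (cong (δ * h F +_) (trans (sym (∑-*ˡ (splits A) δ _))
             (∑-cong′ (splits A) (λ (B , C) → *-left-comm δ (crosses e B C) (connectedPair F B C)))))) ⟩
    ∑ E′ (λ e → δ * h F + ∑₂ (splits A) (λ B C → crosses e B C * (δ * connectedPair F B C)))
      ≡⟨ ∑-+ E′ _ _ ⟩
    ∑ E′ (λ _ → δ * h F) + ∑ E′ (λ e → ∑₂ (splits A) (λ B C → crosses e B C * (δ * connectedPair F B C)))
      ≡⟨ cong₂ _+_ (∑-const E′ (δ * h F)) (∑-swap E′ (splits A) _) ⟩
    length E′ * (δ * h F) + ∑₂ (splits A) (λ B C → ∑ E′ (λ e → crosses e B C * (δ * connectedPair F B C)))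
      ≡⟨ cong (length E′ * (δ * h F) +_) (∑-cong (splits A) (λ {(B , C)} p →
           trans (∑-*ʳ E′ (δ * connectedPair F B C) _)
                 (cong (_* (δ * connectedPair F B C)) (crossings-⟦⟧ E (splits-sound A p))))) ⟩
    length E′ * (δ * h F) + ∑₂ (splits A) (pairs F) ∎
    where
    δ = 𝟙 (length F ≟ℕ m)

-- Cardinalities and graphs without edges

∑-allFin-suc : ∀ n (f : Fin (suc n) → ℕ) → ∑ (allFin (suc n)) f ≡ f zero + ∑ (allFin n) (f ∘ suc)
∑-allFin-suc n f = cong (f zero +_)
  (trans (cong (λ xs → ∑ xs f) (sym (map-tabulate id suc))) (∑-map suc (allFin n) f))

card : ∀ {n} → VertexSet n → ℕ
card {n} A = ∑ (allFin n) (λ u → ⟨ lookup A u ⟩)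

card-∷ : ∀ {n} b (A : VertexSet n) → card (b ∷ A) ≡ ⟨ b ⟩ + card A
card-∷ {n} b A = ∑-allFin-suc n (λ u → ⟨ lookup (b ∷ A) u ⟩)

card-full : ∀ n → card (full n) ≡ n
card-full zero    = refl
card-full (suc n) = trans (card-∷ true (full n)) (cong suc (card-full n))

card-split : ∀ {n} {A B C : VertexSet n} → IsSplit A B C → card B + card C ≡ card A
card-split {n} {A} {B} {C} split = trans (sym (∑-+ (allFin n) _ _)) (∑-cong′ (allFin n) pointwise)
  where
  pointwise : ∀ u → ⟨ lookup B u ⟩ + ⟨ lookup C u ⟩ ≡ ⟨ lookup A u ⟩
  pointwise u with lookup A u | lookup B u | lookup C u | split .IsSplit.side u
  ... | _ | _ | _ | outside = refl
  ... | _ | _ | _ | left    = refl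
  ... | _ | _ | _ | right   = refl

card≡0⇒ : ∀ {n} (A : VertexSet n) → card A ≡ 0 → ∀ {u} → ¬ (u ∈ᵛ A)
card≡0⇒ (false ∷ A) eq {suc u} p = card≡0⇒ A (trans (sym (card-∷ false A)) eq) {u} p
card≡0⇒ (true  ∷ A) eq           = contradiction (trans (sym (card-∷ true A)) eq) λ ()

card≡0⇐ : ∀ {n} (A : VertexSet n) → (∀ {u} → ¬ (u ∈ᵛ A)) → card A ≡ 0
card≡0⇐ []          none = refl
card≡0⇐ (false ∷ A) none = trans (card-∷ false A) (card≡0⇐ A (λ {u} → none {suc u}))
card≡0⇐ (true  ∷ A) none = contradiction refl (none {zero})

IsSingleton : ∀ {n} → VertexSet n → Set
IsSingleton A = (∃ λ u → u ∈ᵛ A) × (∀ u v → u ∈ᵛ A → v ∈ᵛ A → u ≡ v)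

singleton⇒card : ∀ {n} (A : VertexSet n) → IsSingleton A → card A ≡ 1
singleton⇒card (true  ∷ A) (_ , same) = trans (card-∷ true A)
  (cong suc (card≡0⇐ A (λ {u} p → contradiction (same zero (suc u) refl p) λ ())))
singleton⇒card (false ∷ A) ((suc u , p) , same) = trans (card-∷ false A)
  (singleton⇒card A ((u , p) , λ x y q r → Fin.suc-injective (same (suc x) (suc y) q r)))

card⇒singleton : ∀ {n} (A : VertexSet n) → card A ≡ 1 → IsSingleton A
card⇒singleton (true ∷ A) eq = (zero , refl) , same
  where
  none : ∀ {u} → ¬ (u ∈ᵛ A)
  none = card≡0⇒ A (suc-injective (trans (sym (card-∷ true A)) eq))
  same : ∀ u v → u ∈ᵛ (true ∷ A) → v ∈ᵛ (true ∷ A) → u ≡ v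
  same zero    zero    _ _ = refl
  same (suc u) _       p _ = contradiction p none
  same zero    (suc v) _ q = contradiction q none
card⇒singleton (false ∷ A) eq with card⇒singleton A (trans (sym (card-∷ false A)) eq)
... | (u , p) , same = (suc u , p) , same′
  where
  same′ : ∀ u v → u ∈ᵛ (false ∷ A) → v ∈ᵛ (false ∷ A) → u ≡ v
  same′ (suc u) (suc v) p q = cong suc (same u v p q)

joined-[] : ∀ {n} {u v : Fin n} → Joined [] u v → u ≡ v
joined-[] ε = refl
joined-[] (fwd () ◅ _)
joined-[] (bwd () ◅ _)

connectedOn-[] : ∀ {n} (A : VertexSet n) → 𝟙 (connectedOn? A []) ≡ 𝟙 (card A ≟ℕ 1)
connectedOn-[] A = 𝟙-cong (connectedOn? A []) (card A ≟ℕ 1)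
  (λ (ne , c) → singleton⇒card A (ne , λ u v p q → joined-[] (c u v p q)))
  (λ eq → let (ne , same) = card⇒singleton A eq in
          ne , λ u v p q → subst (Joined [] u) (same u v p q) ε)

∑-splits-swap : ∀ {n} (A : VertexSet n) (f : VertexSet n → VertexSet n → ℕ) →
  ∑₂ (splits A) f ≡ ∑₂ (splits A) (λ B C → f C B)
∑-splits-swap []          f = refl
∑-splits-swap (false ∷ A) f = trans (∑-map _ (splits A) (uncurry f))
  (trans (∑-splits-swap A (λ B C → f (false ∷ B) (false ∷ C))) (sym (∑-map _ (splits A) _)))
∑-splits-swap (true ∷ A) f = trans (∑-splits-∷ A f) (trans (cong₂ _+_
  (∑-splits-swap A (λ B C → f (true ∷ B) (false ∷ C))) (∑-splits-swap A (λ B C → f (false ∷ B) (true ∷ C))))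
  (trans (+-comm (∑₂ (splits A) (λ C B → f (true ∷ B) (false ∷ C))) _) (sym (∑-splits-∷ A (λ B C → f C B)))))

∑-antidiagonal-shiftˡ : ∀ a k (f : ℕ → ℕ → ℕ) → (∀ i j → i < a → f i j ≡ 0) →
  ∑ᵃ (a + k) f ≡ ∑ᵃ k (λ i j → f (a + i) j)
∑-antidiagonal-shiftˡ zero    k f low = refl
∑-antidiagonal-shiftˡ (suc a) k f low = trans (∑-antidiagonal-suc (a + k) f)
  (trans (cong (_+ ∑ᵃ (a + k) (λ i j → f (suc i) j)) (low 0 (suc (a + k)) z<s))
         (∑-antidiagonal-shiftˡ a k (λ i j → f (suc i) j) (λ i j i<a → low (suc i) j (s<s i<a))))

-- Used to pass from edge numbers to Betti numbers: a and b are the least edge numbers of the two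
-- parts.
∑-antidiagonal-shift : ∀ a b k (f g : ℕ → ℕ) → (∀ i → i < a → f i ≡ 0) → (∀ j → j < b → g j ≡ 0) →
  ∑ᵃ (a + (b + k)) (λ i j → f i * g j) ≡ ∑ᵃ k (λ i j → f (a + i) * g (b + j))
∑-antidiagonal-shift a b k f g lowf lowg = begin
  ∑ᵃ (a + (b + k)) (λ i j → f i * g j)
    ≡⟨ ∑-antidiagonal-shiftˡ a (b + k) _ (λ i j i<a → cong (_* g j) (lowf i i<a)) ⟩
  ∑ᵃ (b + k) (λ i j → f (a + i) * g j)
    ≡⟨ ∑-antidiagonal-swap (b + k) _ ⟩
  ∑ᵃ (b + k) (λ j i → f (a + i) * g j)
    ≡⟨ ∑-antidiagonal-shiftˡ b k _ (λ j i j<b → trans (cong (f (a + i) *_) (lowg j j<b)) (*-zeroʳ (f (a + i)))) ⟩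
  ∑ᵃ k (λ j i → f (a + i) * g (b + j))
    ≡⟨ ∑-antidiagonal-swap k _ ⟩
  ∑ᵃ k (λ i j → f (a + i) * g (b + j)) ∎
  where open ≡-Reasoning

-- For a split with an empty side: the weight vanishes, so nothing has to be known about the counts
-- that it multiplies.
0*-irrelevant : ∀ {a b c} → a ≡ 0 → a * b ≡ a * c
0*-irrelevant refl = refl

-- A family of host graphs indexed by a "size" in S such that every vertex
-- subset of a host spans a graph that is, up to isomorphism, again a host.
-- Isomorphisms are not needed: the deletion recursion determines the counts.
module HostFamily
  {S : Set} (order : S → ℕ) (vertices : S → ℕ) (host : ∀ σ → Edges (vertices σ))
  (size : ∀ σ → VertexSet (vertices σ) → S) (parts : S → List (S × S))
  (weight : S → S → ℕ) (inner : S → ℕ)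
  (size-full : ∀ σ → size σ (full (vertices σ)) ≡ σ)
  (order-size : ∀ σ A → order (size σ A) ≡ card A)
  (∑-parts : ∀ σ A (g : S → S → ℕ) →
    ∑₂ (splits A) (λ B C → g (size σ B) (size σ C)) ≡ ∑₂ (parts (size σ A)) g)
  (parts-order : ∀ τ {τ₁ τ₂} → (τ₁ , τ₂) ∈ parts τ → order τ₁ + order τ₂ ≡ order τ)
  (weight-crossings : ∀ σ {A B C} → IsSplit A B C →
    crossings (host σ) B C + crossings (host σ) C B ≡ weight (size σ B) (size σ C))
  (weight-0ˡ : ∀ τ₁ τ₂ → order τ₁ ≡ 0 → weight τ₁ τ₂ ≡ 0)
  (weight-0ʳ : ∀ τ₁ τ₂ → order τ₂ ≡ 0 → weight τ₁ τ₂ ≡ 0)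
  (inner-edges : ∀ σ A → 2 * length (host σ ⟦ A ⟧) ≡ inner (size σ A))
  where

  canonical : S → ℕ → ℕ
  canonical τ m = count (host τ) (full (vertices τ)) m

  convolution : S → ℕ → ℕ
  convolution τ m = ∑₂ (parts τ) (λ τ₁ τ₂ → weight τ₁ τ₂ *
    ∑ᵃ m (λ i j → canonical τ₁ i * canonical τ₂ j))

  record Recursion (τ : S) (x : ℕ → ℕ) : Set where
    field
      initial : x 0 ≡ 𝟙 (order τ ≟ℕ 1)
      step    : ∀ m → 2 * (suc m * x (suc m) + m * x m) ≡ inner τ * x m + convolution τ m
  open Recursion

  -- The convolution involves only the canonical counts, hence is the same for both sequences, and
  -- the new value has the nonzero coefficient 2 (m + 1).
  recursion-unique : ∀ {τ x y} → Recursion τ x → Recursion τ y → ∀ m → x m ≡ y m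
  recursion-unique rx ry zero = trans (rx .initial) (sym (ry .initial))
  recursion-unique {τ} {x} {y} rx ry (suc m) =
    *-cancelˡ-≡ (x (suc m)) (y (suc m)) (suc m)
      (+-cancelʳ-≡ (m * x m) (suc m * x (suc m)) (suc m * y (suc m))
        (*-cancelˡ-≡ _ _ 2 (begin
          2 * (suc m * x (suc m) + m * x m) ≡⟨ rx .step m ⟩
          inner τ * x m + convolution τ m   ≡⟨ cong (λ z → inner τ * z + convolution τ m) ih ⟩
          inner τ * y m + convolution τ m   ≡⟨ ry .step m ⟨
          2 * (suc m * y (suc m) + m * y m) ≡⟨ cong (λ z → 2 * (suc m * y (suc m) + m * z)) ih ⟨
          2 * (suc m * y (suc m) + m * x m) ∎)))
    where
    open ≡-Reasoning
    ih : x m ≡ y m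
    ih = recursion-unique rx ry m

  pairs : ∀ σ → VertexSet (vertices σ) → VertexSet (vertices σ) → ℕ → ℕ
  pairs σ B C m = ∑ᵃ m (λ i j → count (host σ) B i * count (host σ) C j)

  pairs-comm : ∀ σ B C m → pairs σ B C m ≡ pairs σ C B m
  pairs-comm σ B C m = trans (∑-antidiagonal-swap m _)
    (∑-cong′ (antidiagonal m) (λ (i , j) → *-comm (count (host σ) B j) (count (host σ) C i)))

  -- Each edge is stored in one orientation, so the crossings from `B` to `C` alone do not depend on
  -- sizes only. Adding the swapped split counts both orientations, at the price of the factor 2.
  count-step₂ : ∀ σ A m →
    2 * (suc m * count (host σ) A (suc m) + m * count (host σ) A m) ≡
    inner (size σ A) * count (host σ) A m
      + ∑₂ (splits A) (λ B C → weight (size σ B) (size σ C) * pairs σ B C m)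
  count-step₂ σ A m = begin
    2 * (suc m * count E A (suc m) + m * count E A m)
      ≡⟨ cong (2 *_) (count-step E A m) ⟩
    2 * (length (E ⟦ A ⟧) * count E A m + X)
      ≡⟨ distrib (length (E ⟦ A ⟧)) (count E A m) X ⟩
    2 * length (E ⟦ A ⟧) * count E A m + (X + X)
      ≡⟨ cong₂ _+_ (cong (_* count E A m) (inner-edges σ A)) (cong (X +_) (∑-splits-swap A _)) ⟩
    inner (size σ A) * count E A m
      + (X + ∑₂ (splits A) (λ B C → crossings E C B * pairs σ C B m))
      ≡⟨ cong (inner (size σ A) * count E A m +_) (trans (sym (∑-+ (splits A) _ _)) (∑-cong (splits A) merge)) ⟩
    inner (size σ A) * count E A m
      + ∑₂ (splits A) (λ B C → weight (size σ B) (size σ C) * pairs σ B C m) ∎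
    where
    open ≡-Reasoning
    E = host σ
    X = ∑₂ (splits A) (λ B C → crossings E B C * pairs σ B C m)
    distrib : ∀ l c x → 2 * (l * c + x) ≡ 2 * l * c + (x + x)
    distrib = solve-∀
    merge : ∀ {p} → p ∈ splits A →
      uncurry (λ B C → crossings E B C * pairs σ B C m) p + uncurry (λ B C → crossings E C B * pairs σ C B m) p
        ≡ uncurry (λ B C → weight (size σ B) (size σ C) * pairs σ B C m) p
    merge {B , C} p = begin
      crossings E B C * pairs σ B C m + crossings E C B * pairs σ C B m
        ≡⟨ cong (λ z → crossings E B C * pairs σ B C m + crossings E C B * z) (pairs-comm σ C B m) ⟩
      crossings E B C * pairs σ B C m + crossings E C B * pairs σ B C m
        ≡⟨ *-distribʳ-+ (pairs σ B C m) (crossings E B C) (crossings E C B) ⟨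
      (crossings E B C + crossings E C B) * pairs σ B C m
        ≡⟨ cong (_* pairs σ B C m) (weight-crossings σ (splits-sound A p)) ⟩
      weight (size σ B) (size σ C) * pairs σ B C m ∎

  count-recursion : ∀ σ A →
    (∀ B → card B < card A → ∀ m → count (host σ) B m ≡ canonical (size σ B) m) →
    Recursion (size σ A) (count (host σ) A)
  count-recursion σ A ih .initial =
    trans (∑-sublists-empty (host σ ⟦ A ⟧) (λ F → 𝟙 (connectedOn? A F)))
          (trans (connectedOn-[] A) (cong (λ c → 𝟙 (c ≟ℕ 1)) (sym (order-size σ A))))
  count-recursion σ A ih .step m = trans (count-step₂ σ A m)
    (cong (inner (size σ A) * count (host σ) A m +_)
      (trans (∑-cong (splits A) by-size) (∑-parts σ A _)))
    where
    by-size : ∀ {p} → p ∈ splits A →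
      uncurry (λ B C → weight (size σ B) (size σ C) * pairs σ B C m) p ≡
      uncurry (λ B C → weight (size σ B) (size σ C) *
        ∑ᵃ m (λ i j → canonical (size σ B) i * canonical (size σ C) j)) p
    -- With the empty sides removed by their zero weight, both parts are strictly smaller than `A`
    -- and the induction hypothesis applies.
    by-size {B , C} p with card B in eqB | card C in eqC
    ... | zero  | _    = 0*-irrelevant (weight-0ˡ (size σ B) (size σ C) (trans (order-size σ B) eqB))
    ... | suc b | zero = 0*-irrelevant (weight-0ʳ (size σ B) (size σ C) (trans (order-size σ C) eqC))
    ... | suc b | suc c = cong (weight (size σ B) (size σ C) *_)
      (∑-cong′ (antidiagonal m) (λ (i , j) → cong₂ _*_
        (ih B (subst (card B <_) total (subst (card B <_) (cong (card B +_) (sym eqC)) (m<m+n (card B) z<s))) i)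
        (ih C (subst (card C <_) total (subst (λ z → card C < z + card C) (sym eqB) (s≤s (m≤n+m (card C) b)))) j)))
      where
      total : card B + card C ≡ card A
      total = card-split (splits-sound A p)

  -- Induction on the number of vertices, over all hosts at once, because the canonical host for the
  -- size of `A` differs from the host containing `A`.
  count-size : ∀ σ A m → count (host σ) A m ≡ canonical (size σ A) m
  count-size σ A = go (suc (card A)) σ A ≤-refl
    where
    go : ∀ b σ A → card A < b → ∀ m → count (host σ) A m ≡ canonical (size σ A) m
    go (suc b) σ A (s≤s A≤b) = recursion-unique
      (count-recursion σ A (λ B B<A → go b σ B (≤-trans B<A A≤b)))
      (subst (λ ρ → Recursion ρ (canonical τ)) (size-full τ)
        (count-recursion τ (full (vertices τ)) (λ B B<τ → go b τ B
          (≤-trans B<τ (≤-trans (≤-reflexive card≡) A≤b)))))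
      where
      τ = size σ A
      card≡ : card (full (vertices τ)) ≡ card A
      card≡ = trans (sym (order-size τ _)) (trans (cong order (size-full τ)) (order-size σ A))

  canonical-recursion : ∀ τ → Recursion τ (canonical τ)
  canonical-recursion τ = subst (λ ρ → Recursion ρ (canonical τ)) (size-full τ)
    (count-recursion τ (full (vertices τ)) (λ B _ → count-size τ B))

  -- Induction through the recursion: parts carrying connected graphs with i and j edges have at
  -- most i + 1 and j + 1 vertices, hence at most m + 2 together when i + j = m, which is too few to
  -- cover `τ`.
  too-few-edges : ∀ τ m → suc m < order τ → canonical τ m ≡ 0
  too-few-edges τ m = go (suc m) m ≤-refl τ
    where
    go : ∀ b m → m < b → ∀ τ → suc m < order τ → canonical τ m ≡ 0
    go (suc b) zero    _         τ 1<o = trans (canonical-recursion τ .initial)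
      (𝟙-no (order τ ≟ℕ 1) (λ eq → <-irrefl (sym eq) 1<o))
    go (suc b) (suc m) (s≤s m<b) τ m<o = m+n≡0⇒m≡0 _ (m+n≡0⇒m≡0 _ (m+n≡0⇒m≡0 _ (trans
      (canonical-recursion τ .step m)
      (cong₂ _+_ (trans (cong (inner τ *_) (go b m m<b τ (<-trans (n<1+n _) m<o))) (*-zeroʳ (inner τ)))
        (∑-0 (parts τ) (λ {(τ₁ , τ₂)} p → trans (cong (weight τ₁ τ₂ *_)
          (∑-0 (antidiagonal m) (λ {(i , j)} q → product≡0 p q))) (*-zeroʳ (weight τ₁ τ₂))))))))
      where
      product≡0 : ∀ {τ₁ τ₂ i j} → (τ₁ , τ₂) ∈ parts τ → (i , j) ∈ antidiagonal m →
                  canonical τ₁ i * canonical τ₂ j ≡ 0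
      product≡0 {τ₁} {τ₂} {i} {j} p q with suc i <? order τ₁ | suc j <? order τ₂
      ... | yes i<o₁ | _ = cong (_* canonical τ₂ j)
        (go b i (≤-trans (s≤s (m+n≤o⇒m≤o i (≤-reflexive (antidiagonal-+ m q)))) m<b) τ₁ i<o₁)
      ... | no _ | yes j<o₂ = trans (cong (canonical τ₁ i *_)
        (go b j (≤-trans (s≤s (m+n≤o⇒n≤o i (≤-reflexive (antidiagonal-+ m q)))) m<b) τ₂ j<o₂))
        (*-zeroʳ (canonical τ₁ i))
      ... | no i≮o₁ | no j≮o₂ = contradiction m<o (≤⇒≯ (begin
        order τ           ≡⟨ parts-order τ p ⟨
        order τ₁ + order τ₂ ≤⟨ +-mono-≤ (≮⇒≥ i≮o₁) (≮⇒≥ j≮o₂) ⟩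
        suc i + suc j     ≡⟨ cong suc (+-suc i j) ⟩
        suc (suc (i + j)) ≡⟨ cong (λ z → suc (suc z)) (antidiagonal-+ m q) ⟩
        suc (suc m)       ∎))
        where open ≤-Reasoning

  -- On p + 1 vertices, Betti number k means p + k edges. Order 0 gets the value 0, in line with the
  -- graph without vertices not being connected.
  betti : S → ℕ → ℕ
  betti τ k = with-order (order τ)
    where
    with-order : ℕ → ℕ
    with-order zero    = 0
    with-order (suc p) = canonical τ (p + k)

  betti-0 : ∀ τ k → order τ ≡ 0 → betti τ k ≡ 0
  betti-0 τ k eq rewrite eq = refl

  betti-suc : ∀ τ k {p} → order τ ≡ suc p → betti τ k ≡ canonical τ (p + k)
  betti-suc τ k eq rewrite eq = refl

  bettiConvolution : S → ℕ → ℕ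
  bettiConvolution τ k = ∑₂ (parts τ) (λ τ₁ τ₂ → weight τ₁ τ₂ *
    ∑ᵃ k (λ i j → betti τ₁ i * betti τ₂ j))

  -- The Betti numbers of two parts joined by a bridge add up to that of the whole, which has m + 1
  -- edges; hence m + 2 in the hypothesis.
  convolution-betti : ∀ τ m k → m + 2 ≡ order τ + k → convolution τ m ≡ bettiConvolution τ k
  convolution-betti τ m k eq = ∑-cong (parts τ) by-part
    where
    by-part : ∀ {p} → p ∈ parts τ →
      uncurry (λ τ₁ τ₂ → weight τ₁ τ₂ * ∑ᵃ m (λ i j → canonical τ₁ i * canonical τ₂ j)) p ≡
      uncurry (λ τ₁ τ₂ → weight τ₁ τ₂ * ∑ᵃ k (λ i j → betti τ₁ i * betti τ₂ j)) p
    by-part {τ₁ , τ₂} p with order τ₁ in eq₁ | order τ₂ in eq₂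
    ... | zero  | _    = 0*-irrelevant (weight-0ˡ τ₁ τ₂ eq₁)
    ... | suc a | zero = 0*-irrelevant (weight-0ʳ τ₁ τ₂ eq₂)
    ... | suc a | suc b = cong (weight τ₁ τ₂ *_) (trans
      (cong (λ z → ∑ᵃ z (λ i j → canonical τ₁ i * canonical τ₂ j)) m≡)
      (trans (∑-antidiagonal-shift a b k (canonical τ₁) (canonical τ₂)
               (λ i i<a → too-few-edges τ₁ i (subst (suc i <_) (sym eq₁) (s<s i<a)))
               (λ j j<b → too-few-edges τ₂ j (subst (suc j <_) (sym eq₂) (s<s j<b))))
             refl))
      where
      m≡ : m ≡ a + (b + k)
      m≡ = +-cancelʳ-≡ 2 m (a + (b + k)) (trans eq (trans (cong (_+ k)
        (trans (sym (parts-order τ p)) (cong₂ _+_ eq₁ eq₂))) (regroup a b k)))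
        where
        regroup : ∀ a b k → (1 + a) + (1 + b) + k ≡ a + (b + k) + 2
        regroup = solve-∀

  bettiConvolution-small : ∀ τ k → order τ ≤ 1 → bettiConvolution τ k ≡ 0
  bettiConvolution-small τ k o≤1 = ∑-0 (parts τ) (λ {(τ₁ , τ₂)} p → trans (0*-irrelevant {c = 0} (w≡0 p)) (*-zeroʳ (weight τ₁ τ₂)))
    where
    w≡0 : ∀ {τ₁ τ₂} → (τ₁ , τ₂) ∈ parts τ → weight τ₁ τ₂ ≡ 0
    w≡0 {τ₁} {τ₂} p with order τ₁ in eq₁ | order τ₂ in eq₂
    ... | zero  | _     = weight-0ˡ τ₁ τ₂ eq₁
    ... | suc a | zero  = weight-0ʳ τ₁ τ₂ eq₂
    ... | suc a | suc b = contradiction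
      (subst (_≤ 1) (trans (sym (parts-order τ p)) (trans (cong₂ _+_ eq₁ eq₂) (cong suc (+-suc a b)))) o≤1)
      λ { (s≤s ()) }

  -- The recursion for m = order + j - 1 edges. Adding `2 * betti τ j` on both sides gives both
  -- counts on the left the coefficient order + j and turns `inner τ` into `inner τ + 2`.
  betti-step : ∀ τ j → 2 * ((order τ + j) * betti τ (suc j) + (order τ + j) * betti τ j) ≡
    (inner τ + 2) * betti τ j + bettiConvolution τ (suc j)
  betti-step τ j with order τ in eq
  ... | zero = sym (trans (cong₂ _+_ (*-zeroʳ (inner τ + 2)) (bettiConvolution-small τ (suc j) (≤-trans (≤-reflexive eq) z≤n)))
                          (sym (cong (2 *_) (cong₂ _+_ (*-zeroʳ j) (*-zeroʳ j)))))
  ... | suc p = begin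
    2 * (suc m * canonical τ (p + suc j) + suc m * x)
      ≡⟨ cong (λ z → 2 * (suc m * canonical τ z + suc m * x)) (+-suc p j) ⟩
    2 * (suc m * canonical τ (suc m) + suc m * x)
      ≡⟨ regroup m (canonical τ (suc m)) x ⟩
    2 * (suc m * canonical τ (suc m) + m * x) + 2 * x
      ≡⟨ cong (_+ 2 * x) (canonical-recursion τ .step m) ⟩
    inner τ * x + convolution τ m + 2 * x
      ≡⟨ cong (λ z → inner τ * x + z + 2 * x) (convolution-betti τ m (suc j) (trans (regroup′ p j) (cong (_+ suc j) (sym eq)))) ⟩
    inner τ * x + bettiConvolution τ (suc j) + 2 * x
      ≡⟨ regroup″ (inner τ) x (bettiConvolution τ (suc j)) ⟩
    (inner τ + 2) * x + bettiConvolution τ (suc j) ∎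
    where
    open ≡-Reasoning
    m = p + j
    x = canonical τ m
    regroup : ∀ m y x → 2 * ((1 + m) * y + (1 + m) * x) ≡ 2 * ((1 + m) * y + m * x) + 2 * x
    regroup = solve-∀
    regroup′ : ∀ p j → p + j + 2 ≡ (1 + p) + (1 + j)
    regroup′ = solve-∀
    regroup″ : ∀ i x c → i * x + c + 2 * x ≡ (i + 2) * x + c
    regroup″ = solve-∀

  -- The case j = -1 of `betti-step`: with one edge fewer than a tree nothing is connected, so apart
  -- from the added `2 * betti τ 0` only the convolution remains.
  betti-tree : ∀ τ → 2 * (order τ * betti τ 0) ≡ 2 * betti τ 0 + bettiConvolution τ 0
  betti-tree τ with order τ in eq
  ... | zero = sym (bettiConvolution-small τ 0 (≤-trans (≤-reflexive eq) z≤n))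
  ... | suc zero = trans (cong (2 *_) (*-identityˡ (canonical τ 0))) (sym (trans (cong (2 * canonical τ 0 +_)
      (bettiConvolution-small τ 0 (≤-reflexive eq))) (+-identityʳ _)))
  ... | suc (suc q) = begin
    2 * (suc (suc q) * canonical τ (suc q + 0))
      ≡⟨ cong (λ z → 2 * (suc (suc q) * canonical τ z)) (+-identityʳ (suc q)) ⟩
    2 * (suc (suc q) * y)
      ≡⟨ regroup q y ⟩
    2 * (suc q * y + q * 0) + 2 * y
      ≡⟨ cong (λ z → 2 * (suc q * y + q * z) + 2 * y) none ⟨
    2 * (suc q * y + q * canonical τ q) + 2 * y
      ≡⟨ cong (_+ 2 * y) (canonical-recursion τ .step q) ⟩
    inner τ * canonical τ q + convolution τ q + 2 * y
      ≡⟨ cong₂ (λ z w → inner τ * z + w + 2 * y) none (convolution-betti τ q 0 (trans (regroup′ q) (cong (_+ 0) (sym eq)))) ⟩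
    inner τ * 0 + bettiConvolution τ 0 + 2 * y
      ≡⟨ regroup″ (inner τ) y (bettiConvolution τ 0) ⟩
    2 * y + bettiConvolution τ 0
      ≡⟨ cong (λ z → 2 * canonical τ z + bettiConvolution τ 0) (+-identityʳ (suc q)) ⟨
    2 * canonical τ (suc q + 0) + bettiConvolution τ 0 ∎
    where
    open ≡-Reasoning
    y = canonical τ (suc q)
    none : canonical τ q ≡ 0
    none = too-few-edges τ q (subst (suc q <_) (sym eq) ≤-refl)
    regroup : ∀ q y → 2 * ((2 + q) * y) ≡ 2 * ((1 + q) * y + q * 0) + 2 * y
    regroup = solve-∀
    regroup′ : ∀ q → q + 2 ≡ 2 + q + 0
    regroup′ = solve-∀
    regroup″ : ∀ i y c → i * 0 + c + 2 * y ≡ 2 * y + c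
    regroup″ = solve-∀

-- Complete and complete bipartite graphs

-- The class sizes of the 2ⁿ maps from an n-element set to a 2-element set.
colourings : ℕ → List (ℕ × ℕ)
colourings zero    = (0 , 0) ∷ []
colourings (suc n) = map (λ (i , j) → suc i , j) (colourings n) ++ map (λ (i , j) → i , suc j) (colourings n)

∑ᶜ : ℕ → (ℕ → ℕ → ℕ) → ℕ
∑ᶜ n = ∑₂ (colourings n)

∑-colourings-suc : ∀ n (f : ℕ → ℕ → ℕ) → ∑ᶜ (suc n) f ≡
  ∑ᶜ n (λ i j → f (suc i) j) + ∑ᶜ n (λ i j → f i (suc j))
∑-colourings-suc n f = trans (∑-++ (map _ (colourings n)) _ (uncurry f))
  (cong₂ _+_ (∑-map _ (colourings n) (uncurry f)) (∑-map _ (colourings n) (uncurry f)))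

colourings-+ : ∀ n {i j} → (i , j) ∈ colourings n → i + j ≡ n
colourings-+ zero    (here refl) = refl
colourings-+ (suc n) p with ∈-++⁻ (map _ (colourings n)) p
... | inj₁ q with ∈-map⁻ _ q
...   | _ , r , refl = cong suc (colourings-+ n r)
colourings-+ (suc n) p | inj₂ q with ∈-map⁻ _ q
...   | (i , j) , r , refl = trans (+-suc i j) (cong suc (colourings-+ n r))

∑-splits-card : ∀ {n} (A : VertexSet n) (g : ℕ → ℕ → ℕ) →
  ∑₂ (splits A) (λ B C → g (card B) (card C)) ≡ ∑ᶜ (card A) g
∑-splits-card []          g = refl
∑-splits-card (false ∷ A) g = trans (∑-map _ (splits A) _)
  (trans (∑-cong′ (splits A) (λ (B , C) → cong₂ g (card-∷ false B) (card-∷ false C)))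
  (trans (∑-splits-card A g) (cong (λ c → ∑ᶜ c g) (sym (card-∷ false A)))))
∑-splits-card (true ∷ A) g = begin
  ∑₂ (splits (true ∷ A)) (λ B C → g (card B) (card C))
    ≡⟨ ∑-splits-∷ A _ ⟩
  ∑₂ (splits A) (λ B C → g (card (true ∷ B)) (card (false ∷ C))) + ∑₂ (splits A) (λ B C → g (card (false ∷ B)) (card (true ∷ C)))
    ≡⟨ cong₂ _+_ (∑-cong′ (splits A) (λ (B , C) → cong₂ g (card-∷ true B) (card-∷ false C)))
                 (∑-cong′ (splits A) (λ (B , C) → cong₂ g (card-∷ false B) (card-∷ true C))) ⟩
  ∑₂ (splits A) (λ B C → g (suc (card B)) (card C)) + ∑₂ (splits A) (λ B C → g (card B) (suc (card C)))
    ≡⟨ cong₂ _+_ (∑-splits-card A (λ i j → g (suc i) j)) (∑-splits-card A (λ i j → g i (suc j))) ⟩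
  ∑ᶜ (card A) (λ i j → g (suc i) j) + ∑ᶜ (card A) (λ i j → g i (suc j))
    ≡⟨ ∑-colourings-suc (card A) g ⟨
  ∑ᶜ (suc (card A)) g
    ≡⟨ cong (λ c → ∑ᶜ c g) (card-∷ true A) ⟨
  ∑ᶜ (card (true ∷ A)) g ∎
  where open ≡-Reasoning

⟨⟩-∧ : ∀ a b → ⟨ a ∧ b ⟩ ≡ ⟨ a ⟩ * ⟨ b ⟩
⟨⟩-∧ true  b = sym (+-identityʳ ⟨ b ⟩)
⟨⟩-∧ false b = refl

length-⟦⟧ : ∀ {n} (E : Edges n) A → length (E ⟦ A ⟧) ≡ crossings E A A
length-⟦⟧ E A = trans (length-filter-∑ (T? ∘ inside A) E)
  (∑-cong′ E (λ (u , v) → ⟨⟩-∧ (lookup A u) (lookup A v)))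

⟦full⟧ : ∀ {n} (E : Edges n) → E ⟦ full n ⟧ ≡ E
⟦full⟧ {n} []            = refl
⟦full⟧ {n} ((u , v) ∷ E) with lookup (full n) u | lookup-replicate u true | lookup (full n) v | lookup-replicate v true
... | _ | refl | _ | refl = cong ((u , v) ∷_) (⟦full⟧ E)

countConnected-0 : ∀ (E : Edges 0) k → countConnected E k ≡ 0
countConnected-0 E k = trans (length-filter-∑ (connectedWithBetti? k) (sublists E))
  (∑-0 (sublists E) (λ {F} _ → 𝟙-no (connectedWithBetti? k F) (λ ((ne , _) , _) → ¬nonZero ne)))
  where
  ¬nonZero : ¬ NonZero 0
  ¬nonZero ()

countConnected-suc : ∀ {p} (E : Edges (suc p)) k → countConnected E k ≡ count E (full (suc p)) (p + k)
countConnected-suc {p} E k = trans (length-filter-∑ (connectedWithBetti? k) (sublists E))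
  (trans (∑-cong′ (sublists E) (λ F → same F (length F ≟ℕ p + k))) (cong (λ X → ∑ (sublists X) _) (sym (⟦full⟧ E))))
  where
  same : ∀ F (d : Dec (length F ≡ p + k)) → 𝟙 (connectedWithBetti? k F) ≡ 𝟙 d * 𝟙 (connectedOn? (full (suc p)) F)
  same F (no ≢) = 𝟙-no (connectedWithBetti? k F) (λ (_ , eq) → ≢ (suc-injective (trans (+-comm 1 (length F)) eq)))
  same F (yes eq) = trans (𝟙-cong (connectedWithBetti? k F) (connectedOn? (full (suc p)) F)
      (λ ((_ , c) , _) → (zero , refl) , λ u v _ _ → c u v)
      (λ (_ , c) → (_ , λ u v → c u v (lookup-replicate u true) (lookup-replicate v true))
                 , trans (+-comm (length F) 1) (cong suc eq)))
    (sym (+-identityʳ _))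

∑-allFin-≟ : ∀ n (u : Fin n) (f : Fin n → ℕ) → ∑ (allFin n) (λ v → 𝟙 (u Fin.≟ v) * f v) ≡ f u
∑-allFin-≟ (suc n) zero    f = trans (∑-allFin-suc n (λ v → 𝟙 (zero Fin.≟ v) * f v))
  (trans (cong₂ _+_ (+-identityʳ (f zero)) (∑-0 (allFin n) (λ _ → refl))) (+-identityʳ (f zero)))
∑-allFin-≟ (suc n) (suc u) f = trans (∑-allFin-suc n (λ v → 𝟙 (suc u Fin.≟ v) * f v))
  (trans (∑-cong′ (allFin n) (λ v → cong (_* f (suc v))
           (𝟙-cong (suc u Fin.≟ suc v) (u Fin.≟ v) Fin.suc-injective (cong suc))))
         (∑-allFin-≟ n u (f ∘ suc)))

trichotomy : ∀ {n} (u v : Fin n) → 𝟙 (u Fin.<? v) + 𝟙 (v Fin.<? u) + 𝟙 (u Fin.≟ v) ≡ 1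
trichotomy u v with Fin.<-cmp u v
... | tri< p q r = cong₂ _+_ (cong₂ _+_ (𝟙-yes (u Fin.<? v) p) (𝟙-no (v Fin.<? u) r)) (𝟙-no (u Fin.≟ v) q)
... | tri≈ p q r = cong₂ _+_ (cong₂ _+_ (𝟙-no (u Fin.<? v) p) (𝟙-no (v Fin.<? u) r)) (𝟙-yes (u Fin.≟ v) q)
... | tri> p q r = cong₂ _+_ (cong₂ _+_ (𝟙-no (u Fin.<? v) p) (𝟙-yes (v Fin.<? u) r)) (𝟙-no (u Fin.≟ v) q)

crossings-complete : ∀ {n} (B C : VertexSet n) → crossings (complete n) B C ≡
  ∑ (allFin n) (λ u → ∑ (allFin n) (λ v → 𝟙 (u Fin.<? v) * crosses (u , v) B C))
crossings-complete {n} B C = trans (∑-filter (uncurry Fin._<?_) (cartesianProduct (allFin n) (allFin n)) _)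
  (∑-cartesianProduct (allFin n) (allFin n) _)

-- Every ordered pair (u , v) is stored, or stored in reverse, or diagonal. The diagonal is kept
-- because the edges inside a set are counted by taking `B` equal to `C`.
crossings-complete₂ : ∀ {n} (B C : VertexSet n) →
  crossings (complete n) B C + crossings (complete n) C B + ∑ (allFin n) (λ u → ⟨ lookup B u ⟩ * ⟨ lookup C u ⟩)
    ≡ card B * card C
crossings-complete₂ {n} B C = begin
  crossings (complete n) B C + crossings (complete n) C B + ∑ (allFin n) (λ u → crosses (u , u) B C)
    ≡⟨ cong₂ _+_ (cong₂ _+_ (crossings-complete B C) (trans (crossings-complete C B) flip))
                 (∑-cong′ (allFin n) (λ u → sym (∑-allFin-≟ n u (λ v → crosses (u , v) B C)))) ⟩
  ∑∑ (λ u v → 𝟙 (u Fin.<? v) * crosses (u , v) B C) + ∑∑ (λ u v → 𝟙 (v Fin.<? u) * crosses (u , v) B C)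
    + ∑∑ (λ u v → 𝟙 (u Fin.≟ v) * crosses (u , v) B C)
    ≡⟨ trans (cong (_+ ∑∑ (λ u v → 𝟙 (u Fin.≟ v) * crosses (u , v) B C)) (sym (∑∑-+ _ _))) (sym (∑∑-+ _ _)) ⟩
  ∑∑ (λ u v → 𝟙 (u Fin.<? v) * crosses (u , v) B C + 𝟙 (v Fin.<? u) * crosses (u , v) B C
              + 𝟙 (u Fin.≟ v) * crosses (u , v) B C)
    ≡⟨ ∑-cong′ (allFin n) (λ u → ∑-cong′ (allFin n) (λ v → one u v)) ⟩
  ∑∑ (λ u v → crosses (u , v) B C)
    ≡⟨ ∑-*-∑ (allFin n) (allFin n) (λ u → ⟨ lookup B u ⟩) (λ v → ⟨ lookup C v ⟩) ⟨
  card B * card C ∎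
  where
  open ≡-Reasoning
  ∑∑ : (Fin n → Fin n → ℕ) → ℕ
  ∑∑ f = ∑ (allFin n) (λ u → ∑ (allFin n) (f u))
  ∑∑-+ : ∀ f g → ∑∑ (λ u v → f u v + g u v) ≡ ∑∑ f + ∑∑ g
  ∑∑-+ f g = trans (∑-cong′ (allFin n) (λ u → ∑-+ (allFin n) (f u) (g u))) (∑-+ (allFin n) _ _)
  flip : ∑∑ (λ u v → 𝟙 (u Fin.<? v) * crosses (u , v) C B) ≡ ∑∑ (λ u v → 𝟙 (v Fin.<? u) * crosses (u , v) B C)
  flip = trans (∑-swap (allFin n) (allFin n) _) (∑-cong′ (allFin n) (λ v → ∑-cong′ (allFin n) (λ u →
    cong (𝟙 (u Fin.<? v) *_) (*-comm ⟨ lookup C u ⟩ ⟨ lookup B v ⟩))))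
  one : ∀ u v → 𝟙 (u Fin.<? v) * crosses (u , v) B C + 𝟙 (v Fin.<? u) * crosses (u , v) B C
    + 𝟙 (u Fin.≟ v) * crosses (u , v) B C ≡ crosses (u , v) B C
  one u v = trans (sym (distrib (𝟙 (u Fin.<? v)) (𝟙 (v Fin.<? u)) (𝟙 (u Fin.≟ v)) (crosses (u , v) B C)))
    (trans (cong (_* crosses (u , v) B C) (trichotomy u v)) (*-identityˡ _))
    where
    distrib : ∀ a b c x → (a + b + c) * x ≡ a * x + b * x + c * x
    distrib = solve-∀

complete-weight : ∀ {n} {A B C : VertexSet n} → IsSplit A B C →
  crossings (complete n) B C + crossings (complete n) C B ≡ card B * card C
complete-weight {n} {A} {B} {C} split = trans (sym (+-identityʳ _)) (trans
  (cong (crossings (complete n) B C + crossings (complete n) C B +_)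
    (sym (∑-0 (allFin n) (λ {u} _ → none u))))
  (crossings-complete₂ B C))
  where
  none : ∀ u → ⟨ lookup B u ⟩ * ⟨ lookup C u ⟩ ≡ 0
  none u with lookup B u in p | lookup C u in q
  ... | true  | true  = contradiction q (disjoint split p)
  ... | true  | false = refl
  ... | false | _     = refl

complete-inner : ∀ {n} (A : VertexSet n) → 2 * length (complete n ⟦ A ⟧) ≡ card A * card A ∸ card A
complete-inner {n} A = sym (trans (cong (_∸ card A) (trans (sym (crossings-complete₂ A A)) collect))
                                  (m+n∸n≡m (2 * length (complete n ⟦ A ⟧)) (card A)))
  where
  square : ∀ b → ⟨ b ⟩ * ⟨ b ⟩ ≡ ⟨ b ⟩
  square true  = refl
  square false = refl
  double : ∀ x → x + x ≡ 2 * x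
  double = solve-∀
  collect : crossings (complete n) A A + crossings (complete n) A A
      + ∑ (allFin n) (λ u → ⟨ lookup A u ⟩ * ⟨ lookup A u ⟩) ≡ 2 * length (complete n ⟦ A ⟧) + card A
  collect = cong₂ _+_ (trans (double (crossings (complete n) A A)) (cong (2 *_) (sym (length-⟦⟧ (complete n) A))))
                      (∑-cong′ (allFin n) (λ u → square (lookup A u)))

*-0ˡ : ∀ i j → i ≡ 0 → i * j ≡ 0
*-0ˡ i j refl = refl

*-0ʳ : ∀ i j → j ≡ 0 → i * j ≡ 0
*-0ʳ i j refl = *-zeroʳ i

module Complete = HostFamily {ℕ} id id complete (λ _ → card) colourings _*_ (λ n → n * n ∸ n)
  card-full (λ _ _ → refl) (λ _ → ∑-splits-card) (λ n → colourings-+ n) (λ _ → complete-weight)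
  *-0ˡ *-0ʳ (λ _ → complete-inner)

-- Complete bipartite hosts

cardˡ cardʳ : ∀ r s → VertexSet (r + s) → ℕ
cardˡ r s A = ∑ (allFin r) (λ i → ⟨ lookup A (i ↑ˡ s) ⟩)
cardʳ r s A = ∑ (allFin s) (λ j → ⟨ lookup A (r ↑ʳ j) ⟩)

cardˡ-∷ : ∀ r s b (A : VertexSet (r + s)) → cardˡ (suc r) s (b ∷ A) ≡ ⟨ b ⟩ + cardˡ r s A
cardˡ-∷ r s b A = ∑-allFin-suc r (λ i → ⟨ lookup (b ∷ A) (i ↑ˡ s) ⟩)

cardˡ-full : ∀ r s → cardˡ r s (full (r + s)) ≡ r
cardˡ-full zero    s = refl
cardˡ-full (suc r) s = trans (cardˡ-∷ r s true (full (r + s))) (cong suc (cardˡ-full r s))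

cardʳ-full : ∀ r s → cardʳ r s (full (r + s)) ≡ s
cardʳ-full zero    s = card-full s
cardʳ-full (suc r) s = cardʳ-full r s

cardˡ+cardʳ : ∀ r s (A : VertexSet (r + s)) → cardˡ r s A + cardʳ r s A ≡ card A
cardˡ+cardʳ zero    s A       = refl
cardˡ+cardʳ (suc r) s (b ∷ A) = begin
  cardˡ (suc r) s (b ∷ A) + cardʳ r s A ≡⟨ cong (_+ cardʳ r s A) (cardˡ-∷ r s b A) ⟩
  ⟨ b ⟩ + cardˡ r s A + cardʳ r s A     ≡⟨ +-assoc ⟨ b ⟩ _ _ ⟩
  ⟨ b ⟩ + (cardˡ r s A + cardʳ r s A)   ≡⟨ cong (⟨ b ⟩ +_) (cardˡ+cardʳ r s A) ⟩
  ⟨ b ⟩ + card A                        ≡⟨ card-∷ b A ⟨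
  card (b ∷ A)                          ∎
  where open ≡-Reasoning

∑-splits-card₂ : ∀ r s (A : VertexSet (r + s)) (g : ℕ → ℕ → ℕ → ℕ → ℕ) →
  ∑₂ (splits A) (λ B C → g (cardˡ r s B) (cardˡ r s C) (cardʳ r s B) (cardʳ r s C)) ≡
  ∑ᶜ (cardˡ r s A) (λ i i′ → ∑ᶜ (cardʳ r s A) (λ j j′ → g i i′ j j′))
∑-splits-card₂ zero    s A g = trans (∑-splits-card A (g 0 0)) (sym (+-identityʳ _))
∑-splits-card₂ (suc r) s (false ∷ A) g = trans (∑-map _ (splits A) _)
  (trans (∑-cong′ (splits A) (λ (B , C) → cong₂ (λ x y → g x y (cardʳ r s B) (cardʳ r s C)) (cardˡ-∷ r s false B) (cardˡ-∷ r s false C)))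
  (trans (∑-splits-card₂ r s A g) (cong (λ c → ∑ᶜ c (λ i i′ → ∑ᶜ (cardʳ r s A) (g i i′))) (sym (cardˡ-∷ r s false A)))))
∑-splits-card₂ (suc r) s (true ∷ A) g = begin
  _ ≡⟨ ∑-splits-∷ A _ ⟩
  _ ≡⟨ cong₂ _+_
         (∑-cong′ (splits A) (λ (B , C) → cong₂ (λ x y → g x y (cardʳ r s B) (cardʳ r s C)) (cardˡ-∷ r s true B) (cardˡ-∷ r s false C)))
         (∑-cong′ (splits A) (λ (B , C) → cong₂ (λ x y → g x y (cardʳ r s B) (cardʳ r s C)) (cardˡ-∷ r s false B) (cardˡ-∷ r s true C))) ⟩
  _ ≡⟨ cong₂ _+_ (∑-splits-card₂ r s A (λ i i′ → g (suc i) i′)) (∑-splits-card₂ r s A (λ i i′ → g i (suc i′))) ⟩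
  _ ≡⟨ ∑-colourings-suc (cardˡ r s A) (λ i i′ → ∑ᶜ (cardʳ r s A) (g i i′)) ⟨
  _ ≡⟨ cong (λ c → ∑ᶜ c (λ i i′ → ∑ᶜ (cardʳ r s A) (g i i′))) (cardˡ-∷ r s true A) ⟨
  _ ∎
  where open ≡-Reasoning

crossings-bipartite : ∀ r s (B C : VertexSet (r + s)) →
  crossings (completeBipartite r s) B C ≡ cardˡ r s B * cardʳ r s C
crossings-bipartite r s B C = trans (∑-cartesianProduct (map (_↑ˡ s) (allFin r)) (map (r ↑ʳ_) (allFin s)) _)
  (trans (∑-map (_↑ˡ s) (allFin r) _)
  (trans (∑-cong′ (allFin r) (λ i → ∑-map (r ↑ʳ_) (allFin s) _))
         (sym (∑-*-∑ (allFin r) (allFin s) (λ i → ⟨ lookup B (i ↑ˡ s) ⟩) (λ j → ⟨ lookup C (r ↑ʳ j) ⟩)))))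

bipartiteParts : ℕ × ℕ → List ((ℕ × ℕ) × (ℕ × ℕ))
bipartiteParts (r , s) = map (λ ((i , i′) , (j , j′)) → (i , j) , (i′ , j′)) (cartesianProduct (colourings r) (colourings s))

∑-bipartiteParts : ∀ r s (g : ℕ × ℕ → ℕ × ℕ → ℕ) → ∑₂ (bipartiteParts (r , s)) g ≡
  ∑ᶜ r (λ i i′ → ∑ᶜ s (λ j j′ → g (i , j) (i′ , j′)))
∑-bipartiteParts r s g = trans (∑-map _ (cartesianProduct (colourings r) (colourings s)) (uncurry g))
  (∑-cartesianProduct (colourings r) (colourings s) _)

bipartiteParts-+ : ∀ τ {τ₁ τ₂} → (τ₁ , τ₂) ∈ bipartiteParts τ → uncurry _+_ τ₁ + uncurry _+_ τ₂ ≡ uncurry _+_ τ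
bipartiteParts-+ (r , s) p with ∈-map⁻ _ p
... | ((i , i′) , (j , j′)) , q , refl with ∈-cartesianProduct⁻ (colourings r) (colourings s) q
...   | q₁ , q₂ = trans (+-interchange i j i′ j′) (cong₂ _+_ (colourings-+ r q₁) (colourings-+ s q₂))

bipartiteWeight : ℕ × ℕ → ℕ × ℕ → ℕ
bipartiteWeight (r₁ , s₁) (r₂ , s₂) = r₁ * s₂ + r₂ * s₁

bipartiteWeight-0ˡ : ∀ τ₁ τ₂ → uncurry _+_ τ₁ ≡ 0 → bipartiteWeight τ₁ τ₂ ≡ 0
bipartiteWeight-0ˡ (zero , zero) (r₂ , s₂) _ = *-zeroʳ r₂

bipartiteWeight-0ʳ : ∀ τ₁ τ₂ → uncurry _+_ τ₂ ≡ 0 → bipartiteWeight τ₁ τ₂ ≡ 0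
bipartiteWeight-0ʳ (r₁ , s₁) (zero , zero) _ = cong (_+ 0) (*-zeroʳ r₁)

module Bipartite = HostFamily {ℕ × ℕ} (uncurry _+_) (uncurry _+_) (λ (r , s) → completeBipartite r s)
  (λ (r , s) A → cardˡ r s A , cardʳ r s A) bipartiteParts bipartiteWeight (λ (r , s) → 2 * (r * s))
  (λ (r , s) → cong₂ _,_ (cardˡ-full r s) (cardʳ-full r s))
  (λ (r , s) → cardˡ+cardʳ r s)
  (λ (r , s) A g → trans (∑-splits-card₂ r s A (λ i i′ j j′ → g (i , j) (i′ , j′)))
                         (sym (∑-bipartiteParts (cardˡ r s A) (cardʳ r s A) g)))
  bipartiteParts-+
  (λ (r , s) {_} {B} {C} _ → cong₂ _+_ (crossings-bipartite r s B C) (crossings-bipartite r s C B))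
  bipartiteWeight-0ˡ bipartiteWeight-0ʳ
  (λ (r , s) A → cong (2 *_) (trans (length-⟦⟧ (completeBipartite r s) A) (crossings-bipartite r s A A)))

N-betti : ∀ n k → N n k ≡ Complete.betti n k
N-betti zero    k = countConnected-0 (complete 0) k
N-betti (suc p) k = countConnected-suc (complete (suc p)) k

Nbi₂-betti : ∀ r s k → Nbi₂ r s k ≡ Bipartite.betti (r , s) k
Nbi₂-betti zero    zero    k = countConnected-0 (completeBipartite 0 0) k
Nbi₂-betti zero    (suc s) k = countConnected-suc (completeBipartite 0 (suc s)) k
Nbi₂-betti (suc r) s       k = countConnected-suc (completeBipartite (suc r) s) k

-- Proper 2-colourings

infixl 7 _⋆_
-- The product of exponential generating functions; `θ` is then the operator x d/dx.
_⋆_ : (ℕ → ℕ) → (ℕ → ℕ) → ℕ → ℕ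
(f ⋆ g) n = ∑ᶜ n (λ i j → f i * g j)

θ : (ℕ → ℕ) → ℕ → ℕ
θ f n = n * f n

-- Both sides sum over the maps from an n-element set to a 4-element set.
∑-colourings-exchange : ∀ n (g : ℕ → ℕ → ℕ → ℕ → ℕ) →
  ∑ᶜ n (λ r s → ∑ᶜ r (λ i i′ → ∑ᶜ s (λ j j′ → g i j i′ j′))) ≡
  ∑ᶜ n (λ p q → ∑ᶜ p (λ i j → ∑ᶜ q (λ i′ j′ → g i j i′ j′)))
∑-colourings-exchange zero    g = refl
∑-colourings-exchange (suc n) g = begin
  ∑ᶜ (suc n) (λ r s → L g r s)
    ≡⟨ ∑-colourings-suc n (L g) ⟩
  ∑ᶜ n (λ r s → L g (suc r) s) + ∑ᶜ n (λ r s → L g r (suc s))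
    ≡⟨ cong₂ _+_
         (trans (∑-cong′ (colourings n) (λ (r , s) → ∑-colourings-suc r _)) (∑-+ (colourings n) _ _))
         (trans (∑-cong′ (colourings n) (λ (r , s) →
            trans (∑-cong′ (colourings r) (λ (i , i′) → ∑-colourings-suc s (λ j j′ → g i j i′ j′)))
                  (∑-+ (colourings r) _ _)))
           (∑-+ (colourings n) _ _)) ⟩
  (∑ᶜ n (L g₁) + ∑ᶜ n (L g₃)) + (∑ᶜ n (L g₂) + ∑ᶜ n (L g₄))
    ≡⟨ cong₂ _+_ (cong₂ _+_ (∑-colourings-exchange n g₁) (∑-colourings-exchange n g₃))
                 (cong₂ _+_ (∑-colourings-exchange n g₂) (∑-colourings-exchange n g₄)) ⟩
  (∑ᶜ n (R g₁) + ∑ᶜ n (R g₃)) + (∑ᶜ n (R g₂) + ∑ᶜ n (R g₄))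
    ≡⟨ +-interchange (∑ᶜ n (R g₁)) _ _ _ ⟩
  (∑ᶜ n (R g₁) + ∑ᶜ n (R g₂)) + (∑ᶜ n (R g₃) + ∑ᶜ n (R g₄))
    ≡⟨ cong₂ _+_
         (trans (∑-cong′ (colourings n) (λ (p , q) → ∑-colourings-suc p _)) (∑-+ (colourings n) _ _))
         (trans (∑-cong′ (colourings n) (λ (p , q) →
            trans (∑-cong′ (colourings p) (λ (i , j) → ∑-colourings-suc q (λ i′ j′ → g i j i′ j′)))
                  (∑-+ (colourings p) _ _)))
           (∑-+ (colourings n) _ _)) ⟨
  ∑ᶜ n (λ p q → R g (suc p) q) + ∑ᶜ n (λ p q → R g p (suc q))
    ≡⟨ ∑-colourings-suc n (R g) ⟨
  ∑ᶜ (suc n) (λ p q → R g p q) ∎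
  where
  open ≡-Reasoning
  L R : (ℕ → ℕ → ℕ → ℕ → ℕ) → ℕ → ℕ → ℕ
  L g r s = ∑ᶜ r (λ i i′ → ∑ᶜ s (λ j j′ → g i j i′ j′))
  R g p q = ∑ᶜ p (λ i j → ∑ᶜ q (λ i′ j′ → g i j i′ j′))
  g₁ g₂ g₃ g₄ : ℕ → ℕ → ℕ → ℕ → ℕ
  g₁ i j i′ j′ = g (suc i) j i′ j′
  g₂ i j i′ j′ = g i (suc j) i′ j′
  g₃ i j i′ j′ = g i j (suc i′) j′
  g₄ i j i′ j′ = g i j i′ (suc j′)

∑-colourings-swap : ∀ n (f : ℕ → ℕ → ℕ) → ∑ᶜ n f ≡ ∑ᶜ n (λ r s → f s r)
∑-colourings-swap zero    f = refl
∑-colourings-swap (suc n) f = trans (∑-colourings-suc n f) (trans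
  (cong₂ _+_ (∑-colourings-swap n (λ r s → f (suc r) s)) (∑-colourings-swap n (λ r s → f r (suc s))))
  (trans (+-comm (∑ᶜ n (λ s r → f (suc r) s)) _) (sym (∑-colourings-suc n (λ r s → f s r)))))

convolution-comm : ∀ m r s →
  (∀ r′ s′ → r′ + s′ < r + s → ∀ i → Bipartite.canonical (r′ , s′) i ≡ Bipartite.canonical (s′ , r′) i) →
  Bipartite.convolution (s , r) m ≡ Bipartite.convolution (r , s) m
convolution-comm m r s ih = begin
  ∑₂ (bipartiteParts (s , r)) (λ τ₁ τ₂ → weight τ₁ τ₂ * pairs τ₁ τ₂)
    ≡⟨ ∑-bipartiteParts s r _ ⟩
  ∑ᶜ s (λ j j′ → ∑ᶜ r (λ i i′ → weight (j , i) (j′ , i′) * pairs (j , i) (j′ , i′)))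
    ≡⟨ ∑-swap (colourings s) (colourings r) _ ⟩
  ∑ᶜ r (λ i i′ → ∑ᶜ s (λ j j′ → weight (j , i) (j′ , i′) * pairs (j , i) (j′ , i′)))
    ≡⟨ ∑-cong (colourings r) (λ {(i , i′)} p → ∑-cong (colourings s) (λ {(j , j′)} q → summand p q)) ⟩
  ∑ᶜ r (λ i i′ → ∑ᶜ s (λ j j′ → weight (i , j) (i′ , j′) * pairs (i , j) (i′ , j′)))
    ≡⟨ ∑-bipartiteParts r s _ ⟨
  ∑₂ (bipartiteParts (r , s)) (λ τ₁ τ₂ → weight τ₁ τ₂ * pairs τ₁ τ₂) ∎
  where
  open ≡-Reasoning
  weight : ℕ × ℕ → ℕ × ℕ → ℕ
  weight = bipartiteWeight
  pairs : ℕ × ℕ → ℕ × ℕ → ℕ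
  pairs τ₁ τ₂ = ∑ᵃ m (λ x y → Bipartite.canonical τ₁ x * Bipartite.canonical τ₂ y)
  weight-comm : ∀ i j i′ j′ → weight (j , i) (j′ , i′) ≡ weight (i , j) (i′ , j′)
  weight-comm i j i′ j′ = trans (+-comm (j * i′) (j′ * i)) (cong₂ _+_ (*-comm j′ i) (*-comm j i′))
  summand : ∀ {i i′ j j′} → (i , i′) ∈ colourings r → (j , j′) ∈ colourings s →
    weight (j , i) (j′ , i′) * pairs (j , i) (j′ , i′) ≡ weight (i , j) (i′ , j′) * pairs (i , j) (i′ , j′)
  summand {i} {i′} {j} {j′} p q =
    trans (cong (_* pairs (j , i) (j′ , i′)) (weight-comm i j i′ j′)) (by-order (i + j) (i′ + j′) refl refl)
    where
    total : (i + j) + (i′ + j′) ≡ r + s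
    total = trans (+-interchange i j i′ j′) (cong₂ _+_ (colourings-+ r p) (colourings-+ s q))
    by-order : ∀ x y → i + j ≡ x → i′ + j′ ≡ y →
      weight (i , j) (i′ , j′) * pairs (j , i) (j′ , i′) ≡ weight (i , j) (i′ , j′) * pairs (i , j) (i′ , j′)
    by-order zero    _       eq eq′ = 0*-irrelevant (bipartiteWeight-0ˡ (i , j) (i′ , j′) eq)
    by-order (suc _) zero    eq eq′ = 0*-irrelevant (bipartiteWeight-0ʳ (i , j) (i′ , j′) eq′)
    by-order (suc _) (suc _) eq eq′ = cong (weight (i , j) (i′ , j′) *_) (∑-cong′ (antidiagonal m) (λ (x , y) →
      cong₂ _*_ (sym (ih i j smaller₁ x)) (sym (ih i′ j′ smaller₂ y))))
      where
      smaller₁ : i + j < r + s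
      smaller₁ = subst (i + j <_) total (m<m+n (i + j) (subst (0 <_) (sym eq′) z<s))
      smaller₂ : i′ + j′ < r + s
      smaller₂ = subst (i′ + j′ <_) total (m<n+m (i′ + j′) (subst (0 <_) (sym eq) z<s))

-- The classes are not exchanged on the graphs: the counts for (s , r) satisfy the recursion for (r
-- , s), and that has only one solution.
canonical-comm : ∀ r s m → Bipartite.canonical (r , s) m ≡ Bipartite.canonical (s , r) m
canonical-comm r s = go (suc (r + s)) r s ≤-refl
  where
  go : ∀ b r s → r + s < b → ∀ m → Bipartite.canonical (r , s) m ≡ Bipartite.canonical (s , r) m
  go (suc b) r s (s≤s r+s≤b) = Bipartite.recursion-unique (Bipartite.canonical-recursion (r , s)) flipped
    where
    ih : ∀ r′ s′ → r′ + s′ < r + s → ∀ i → Bipartite.canonical (r′ , s′) i ≡ Bipartite.canonical (s′ , r′) i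
    ih r′ s′ lt = go b r′ s′ (≤-trans lt r+s≤b)
    flipped : Bipartite.Recursion (r , s) (Bipartite.canonical (s , r))
    flipped = record
      { initial = trans (Bipartite.canonical-recursion (s , r) .Bipartite.Recursion.initial)
                        (cong (λ z → 𝟙 (z ≟ℕ 1)) (+-comm s r))
      ; step = λ m → trans (Bipartite.canonical-recursion (s , r) .Bipartite.Recursion.step m)
                 (cong₂ _+_ (cong (λ z → 2 * z * Bipartite.canonical (s , r) m) (*-comm s r)) (convolution-comm m r s ih))
      }

-- The two counts and the facts about them that are used from here on

abstract
  -- N_bi(r,s,k)
  b : ℕ → ℕ → ℕ → ℕ
  b r s k = Bipartite.betti (r , s) k

  Nbi₂≡b : ∀ r s k → Nbi₂ r s k ≡ b r s k
  Nbi₂≡b = Nbi₂-betti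

  b-comm : ∀ r s k → b r s k ≡ b s r k
  b-comm r s k = by-order (r + s) refl
    where
    by-order : ∀ n → r + s ≡ n → b r s k ≡ b s r k
    by-order zero    eq = trans (Bipartite.betti-0 (r , s) k eq)
      (sym (Bipartite.betti-0 (s , r) k (trans (+-comm s r) eq)))
    by-order (suc p) eq = trans (Bipartite.betti-suc (r , s) k eq) (trans (canonical-comm r s (p + k))
      (sym (Bipartite.betti-suc (s , r) k (trans (+-comm s r) eq))))

  bConvolution : ℕ → ℕ → ℕ → ℕ
  bConvolution r s k = ∑ᶜ r (λ i i′ → ∑ᶜ s (λ j j′ →
    (i * j′ + i′ * j) * ∑ᵃ k (λ x y → b i j x * b i′ j′ y)))

  bConvolution-def : ∀ r s k → bConvolution r s k ≡ ∑ᶜ r (λ i i′ → ∑ᶜ s (λ j j′ →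
    (i * j′ + i′ * j) * ∑ᵃ k (λ x y → b i j x * b i′ j′ y)))
  bConvolution-def r s k = refl

  b-step : ∀ r s j → 2 * ((r + s + j) * b r s (suc j) + (r + s + j) * b r s j) ≡
    (2 * (r * s) + 2) * b r s j + bConvolution r s (suc j)
  b-step r s j = trans (Bipartite.betti-step (r , s) j)
    (cong ((2 * (r * s) + 2) * b r s j +_) (∑-bipartiteParts r s _))

  b-tree : ∀ r s → 2 * ((r + s) * b r s 0) ≡ 2 * b r s 0 + bConvolution r s 0
  b-tree r s = trans (Bipartite.betti-tree (r , s)) (cong (2 * b r s 0 +_) (∑-bipartiteParts r s _))

  -- N(n,k), with the arguments swapped so that a k is a sequence
  a : ℕ → ℕ → ℕ
  a k n = Complete.betti n k

  N≡a : ∀ n k → N n k ≡ a k n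
  N≡a = N-betti

  private
    a-convolution : ∀ k n → Complete.bettiConvolution n k ≡ ∑ᵃ k (λ x y → (θ (a x) ⋆ θ (a y)) n)
    a-convolution k n = trans
      (∑-cong′ (colourings n) (λ (i , j) → trans (sym (∑-*ˡ (antidiagonal k) (i * j) _))
        (∑-cong′ (antidiagonal k) (λ (x , y) → regroup i j (a x i) (a y j)))))
      (∑-swap (colourings n) (antidiagonal k) _)
      where
      regroup : ∀ i j u v → (i * j) * (u * v) ≡ (i * u) * (j * v)
      regroup = solve-∀

  a-step : ∀ j n → 2 * ((n + j) * a (suc j) n + (n + j) * a j n) ≡
    (n * n ∸ n + 2) * a j n + ∑ᵃ (suc j) (λ x y → (θ (a x) ⋆ θ (a y)) n)
  a-step j n = trans (Complete.betti-step n j) (cong ((n * n ∸ n + 2) * a j n +_) (a-convolution (suc j) n))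

  a-tree : ∀ n → 2 * (n * a 0 n) ≡ 2 * a 0 n + (θ (a 0) ⋆ θ (a 0)) n
  a-tree n = trans (Complete.betti-tree n)
    (cong (2 * a 0 n +_) (trans (a-convolution 0 n) (+-identityʳ _)))

  a-0 : ∀ k → a k 0 ≡ 0
  a-0 k = refl

  a-0-1 : a 0 1 ≡ 1
  a-0-1 = Complete.canonical-recursion 1 .Complete.Recursion.initial

  b-0 : ∀ k → b 0 0 k ≡ 0
  b-0 k = refl

  b-1 : b 1 0 0 ≡ 1
  b-1 = Bipartite.canonical-recursion (1 , 0) .Bipartite.Recursion.initial

-- Sums over the pairs of a graph and a proper 2-colouring of it, weighted by
-- a function of the class sizes.
moment : (ℕ → ℕ → ℕ) → ℕ → ℕ → ℕ
moment w k n = ∑ᶜ n (λ r s → w r s * b r s k)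

sqDiff : ℕ → ℕ → ℕ
sqDiff r s = ∣ r - s ∣ * ∣ r - s ∣

v Q S : ℕ → ℕ → ℕ
v = moment (λ _ _ → 1)
Q = moment _*_
S = moment sqDiff

convolutionMoment : (ℕ → ℕ → ℕ) → ℕ → ℕ → ℕ
convolutionMoment w k n = ∑ᶜ n (λ r s → w r s * bConvolution r s k)

-- Recolouring one of the two parts.
symmetrised : (ℕ → ℕ → ℕ) → ℕ → ℕ → ℕ → ℕ → ℕ
symmetrised w i j i′ j′ = w (i + i′) (j + j′) * (i * j′ + i′ * j) + w (j + i′) (i + j′) * (j * j′ + i′ * i)

symmetrisedSum : (ℕ → ℕ → ℕ) → ℕ → ℕ → ℕ → ℕ → ℕ
symmetrisedSum w x y p q = ∑ᶜ p (λ i j → ∑ᶜ q (λ i′ j′ → symmetrised w i j i′ j′ * (b i j x * b i′ j′ y)))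

-- The factor 2 stands for averaging over the two colourings of the first part. Its count does not
-- change under the swap, by `b-comm`, so only the weight and the number of admissible edges are
-- averaged.
convolutionMoment-symmetrised : ∀ w k n → 2 * convolutionMoment w k n ≡
  ∑ᵃ k (λ x y → ∑ᶜ n (symmetrisedSum w x y))
convolutionMoment-symmetrised w k n = begin
  2 * convolutionMoment w k n
    ≡⟨ cong (2 *_) (∑-cong (colourings n) (λ {(r , s)} _ → spread r s)) ⟩
  2 * ∑ᶜ n (λ r s → ∑ᶜ r (λ i i′ → ∑ᶜ s (λ j j′ → f i j i′ j′)))
    -- Instead of colouring all vertices and then distributing them over two parts, distribute first
    -- and then colour each part.
    ≡⟨ cong (2 *_) (∑-colourings-exchange n f) ⟩
  2 * ∑ᶜ n (λ p q → ∑ᶜ p (λ i j → ∑ᶜ q (λ i′ j′ → f i j i′ j′)))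
    ≡⟨ ∑-*ˡ (colourings n) 2 _ ⟨
  ∑ᶜ n (λ p q → 2 * ∑ᶜ p (λ i j → ∑ᶜ q (λ i′ j′ → f i j i′ j′)))
    ≡⟨ ∑-cong′ (colourings n) (λ (p , q) → symmetrise p q) ⟩
  ∑ᶜ n (λ p q → ∑ᵃ k (λ x y → symmetrisedSum w x y p q))
    ≡⟨ ∑-swap (colourings n) (antidiagonal k) _ ⟩
  ∑ᵃ k (λ x y → ∑ᶜ n (symmetrisedSum w x y)) ∎
  where
  open ≡-Reasoning
  f : ℕ → ℕ → ℕ → ℕ → ℕ
  f i j i′ j′ = w (i + i′) (j + j′) * ((i * j′ + i′ * j) * ∑ᵃ k (λ x y → b i j x * b i′ j′ y))

  spread : ∀ r s → w r s * bConvolution r s k ≡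
    ∑ᶜ r (λ i i′ → ∑ᶜ s (λ j j′ → f i j i′ j′))
  spread r s = begin
    w r s * bConvolution r s k
      ≡⟨ cong (w r s *_) (bConvolution-def r s k) ⟩
    w r s * ∑ᶜ r (λ i i′ → ∑ᶜ s (λ j j′ → g i j i′ j′))
      ≡⟨ ∑-*ˡ (colourings r) (w r s) _ ⟨
    ∑ᶜ r (λ i i′ → w r s * ∑ᶜ s (λ j j′ → g i j i′ j′))
      ≡⟨ ∑-cong′ (colourings r) (λ _ → sym (∑-*ˡ (colourings s) (w r s) _)) ⟩
    ∑ᶜ r (λ i i′ → ∑ᶜ s (λ j j′ → w r s * g i j i′ j′))
      ≡⟨ ∑-cong (colourings r) (λ {(i , i′)} p → ∑-cong (colourings s) (λ {(j , j′)} q →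
           cong₂ (λ x y → w x y * g i j i′ j′) (sym (colourings-+ r p)) (sym (colourings-+ s q)))) ⟩
    ∑ᶜ r (λ i i′ → ∑ᶜ s (λ j j′ → f i j i′ j′)) ∎
    where
    g : ℕ → ℕ → ℕ → ℕ → ℕ
    g i j i′ j′ = (i * j′ + i′ * j) * ∑ᵃ k (λ x y → b i j x * b i′ j′ y)

  collect : ∀ i j i′ j′ → f i j i′ j′ + f j i i′ j′ ≡
    ∑ᵃ k (λ x y → symmetrised w i j i′ j′ * (b i j x * b i′ j′ y))
  collect i j i′ j′ = trans
    (cong (λ z → f i j i′ j′ + w (j + i′) (i + j′) * ((j * j′ + i′ * i) * z))
      (∑-cong′ (antidiagonal k) (λ (x , y) → cong (_* b i′ j′ y) (b-comm j i x))))
    (trans (distrib (w (i + i′) (j + j′)) (i * j′ + i′ * j) (w (j + i′) (i + j′)) (j * j′ + i′ * i) _)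
           (sym (∑-*ˡ (antidiagonal k) (symmetrised w i j i′ j′) _)))
    where
    distrib : ∀ u c u′ c′ z → u * (c * z) + u′ * (c′ * z) ≡ (u * c + u′ * c′) * z
    distrib = solve-∀

  symmetrise : ∀ p q →
    2 * ∑ᶜ p (λ i j → ∑ᶜ q (λ i′ j′ → f i j i′ j′)) ≡
    ∑ᵃ k (λ x y → symmetrisedSum w x y p q)
  symmetrise p q = begin
    2 * F
      ≡⟨ cong (F +_) (+-identityʳ F) ⟩
    F + F
      ≡⟨ cong (F +_) (∑-colourings-swap p _) ⟩
    F + ∑ᶜ p (λ i j → ∑ᶜ q (λ i′ j′ → f j i i′ j′))
      ≡⟨ ∑-+ (colourings p) _ _ ⟨
    ∑ᶜ p (λ i j → ∑ᶜ q (λ i′ j′ → f i j i′ j′) + ∑ᶜ q (λ i′ j′ → f j i i′ j′))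
      ≡⟨ ∑-cong′ (colourings p) (λ (i , j) → trans (sym (∑-+ (colourings q) _ _))
           (∑-cong′ (colourings q) (λ (i′ , j′) → collect i j i′ j′))) ⟩
    ∑ᶜ p (λ i j → ∑ᶜ q (λ i′ j′ →
      ∑ᵃ k (λ x y → symmetrised w i j i′ j′ * (b i j x * b i′ j′ y))))
      ≡⟨ ∑-cong′ (colourings p) (λ _ → ∑-swap (colourings q) (antidiagonal k) _) ⟩
    ∑ᶜ p (λ i j → ∑ᵃ k (λ x y → ∑ᶜ q (λ i′ j′ →
      symmetrised w i j i′ j′ * (b i j x * b i′ j′ y))))
      ≡⟨ ∑-swap (colourings p) (antidiagonal k) _ ⟩
    ∑ᵃ k (λ x y → symmetrisedSum w x y p q) ∎
    where
    F = ∑ᶜ p (λ i j → ∑ᶜ q (λ i′ j′ → f i j i′ j′))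

-- Squared differences of the class sizes

sqDiff-+ : ∀ j x → sqDiff (j + x) j ≡ x * x
sqDiff-+ j x = cong (λ d → d * d) (trans (∣-∣-comm (j + x) j) (∣m-m+n∣≡n j x))

sqDiff-comm : ∀ i j → sqDiff i j ≡ sqDiff j i
sqDiff-comm i j = cong (λ d → d * d) (∣-∣-comm i j)

wlog-≤ : (P : ℕ → ℕ → Set) → (∀ i j → P i j → P j i) → (∀ j x → P (j + x) j) → ∀ i j → P i j
wlog-≤ P flip base i j with ≤-total i j
... | inj₁ i≤j = flip j i (subst (λ z → P z i) (m+[n∸m]≡n i≤j) (base i (j ∸ i)))
... | inj₂ j≤i = subst (λ z → P z j) (m+[n∸m]≡n j≤i) (base j (i ∸ j))

sqDiff-expand : ∀ i j → sqDiff i j + 2 * (i * j) ≡ i * i + j * j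
sqDiff-expand = wlog-≤ _
  (λ i j eq → trans (cong₂ _+_ (sqDiff-comm j i) (cong (2 *_) (*-comm j i)))
                    (trans eq (+-comm (i * i) (j * j))))
  (λ j x → trans (cong (_+ 2 * ((j + x) * j)) (sqDiff-+ j x)) (expand j x))
  where
  expand : ∀ j x → x * x + 2 * ((j + x) * j) ≡ (j + x) * (j + x) + j * j
  expand = solve-∀

sqDiff-4* : ∀ r s → 4 * (r * s) + sqDiff r s ≡ (r + s) * (r + s)
sqDiff-4* r s = trans (split (r * s) (sqDiff r s))
  (trans (cong (2 * (r * s) +_) (sqDiff-expand r s)) (collect r s))
  where
  split : ∀ p d → 4 * p + d ≡ 2 * p + (d + 2 * p)
  split = solve-∀
  collect : ∀ r s → 2 * (r * s) + (r * r + s * s) ≡ (r + s) * (r + s)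
  collect = solve-∀

-- The difference of the two sides is twice the product of the squared
-- differences.
symmetrised-sqDiff : ∀ i j i′ j′ → symmetrised sqDiff i j i′ j′ ≤
  ((i + j) * (i′ + j′)) * (sqDiff i j + sqDiff i′ j′)
symmetrised-sqDiff = wlog-≤ _ flip₁ (λ j x → wlog-≤ _ (flip₂ (j + x) j) (λ j′ y → base j x j′ y))
  where
  D = sqDiff
  flip₁ : ∀ i j → (∀ i′ j′ → symmetrised D i j i′ j′ ≤ ((i + j) * (i′ + j′)) * (D i j + D i′ j′)) →
                   ∀ i′ j′ → symmetrised D j i i′ j′ ≤ ((j + i) * (i′ + j′)) * (D j i + D i′ j′)
  flip₁ i j le i′ j′ = subst₂ _≤_
    (+-comm (D (i + i′) (j + j′) * (i * j′ + i′ * j)) (D (j + i′) (i + j′) * (j * j′ + i′ * i)))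
    (cong₂ (λ x y → (x * (i′ + j′)) * (y + D i′ j′)) (+-comm i j) (sqDiff-comm i j)) (le i′ j′)
  flip₂ : ∀ i j i′ j′ → symmetrised D i j i′ j′ ≤ ((i + j) * (i′ + j′)) * (D i j + D i′ j′) →
                        symmetrised D i j j′ i′ ≤ ((i + j) * (j′ + i′)) * (D i j + D j′ i′)
  flip₂ i j i′ j′ le = subst₂ _≤_
    (trans (+-comm (D (i + i′) (j + j′) * (i * j′ + i′ * j)) _) (cong₂ _+_
      (cong₂ _*_ (sqDiff-comm (j + i′) (i + j′)) (c₁ i j i′ j′))
      (cong₂ _*_ (sqDiff-comm (i + i′) (j + j′)) (c₂ i j i′ j′))))
    (cong₂ (λ x y → ((i + j) * x) * (D i j + y)) (+-comm i′ j′) (sqDiff-comm i′ j′)) le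
    where
    c₁ : ∀ i j i′ j′ → j * j′ + i′ * i ≡ i * i′ + j′ * j
    c₁ = solve-∀
    c₂ : ∀ i j i′ j′ → i * j′ + i′ * j ≡ j * i′ + j′ * i
    c₂ = solve-∀
  base : ∀ j x j′ y → symmetrised D (j + x) j (j′ + y) j′ ≤
    ((j + x + j) * (j′ + y + j′)) * (D (j + x) j + D (j′ + y) j′)
  -- The two colourings have squared differences (x + y)² and (y - x)². Adding `2 * (y * x) * d` on
  -- both sides turns the second into y² + x², so that a polynomial identity remains; its summand 2
  -- x² y² is the slack that is dropped.
  base j x j′ y = m+n≤o⇒m≤o _ (≤-reflexive (+-cancelʳ-≡ (2 * (y * x) * d) _ _ (begin
    symmetrised D (j + x) j (j′ + y) j′ + 2 * (x * x * (y * y)) + 2 * (y * x) * d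
      ≡⟨ cong₂ (λ p m → p * c + m * d + 2 * (x * x * (y * y)) + 2 * (y * x) * d) sum≡ diff≡ ⟩
    (x + y) * (x + y) * c + D y x * d + 2 * (x * x * (y * y)) + 2 * (y * x) * d
      ≡⟨ gather ((x + y) * (x + y) * c) (D y x) d (2 * (x * x * (y * y))) (2 * (y * x)) ⟩
    (x + y) * (x + y) * c + (D y x + 2 * (y * x)) * d + 2 * (x * x * (y * y))
      ≡⟨ cong (λ z → (x + y) * (x + y) * c + z * d + 2 * (x * x * (y * y))) (sqDiff-expand y x) ⟩
    (x + y) * (x + y) * c + (y * y + x * x) * d + 2 * (x * x * (y * y))
      ≡⟨ identity j x j′ y ⟩
    ((j + x + j) * (j′ + y + j′)) * (x * x + y * y) + 2 * (y * x) * d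
      ≡⟨ cong₂ (λ p q → ((j + x + j) * (j′ + y + j′)) * (p + q) + 2 * (y * x) * d)
           (sqDiff-+ j x) (sqDiff-+ j′ y) ⟨
    ((j + x + j) * (j′ + y + j′)) * (D (j + x) j + D (j′ + y) j′) + 2 * (y * x) * d ∎)))
    where
    open ≡-Reasoning
    c = (j + x) * j′ + (j′ + y) * j
    d = j * j′ + (j′ + y) * (j + x)
    sum≡ : D ((j + x) + (j′ + y)) (j + j′) ≡ (x + y) * (x + y)
    sum≡ = trans (cong (λ z → D z (j + j′)) (regroup j x j′ y)) (sqDiff-+ (j + j′) (x + y))
      where
      regroup : ∀ j x j′ y → (j + x) + (j′ + y) ≡ (j + j′) + (x + y)
      regroup = solve-∀
    diff≡ : D (j + (j′ + y)) ((j + x) + j′) ≡ D y x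
    diff≡ = cong (λ d → d * d) (trans (cong₂ ∣_-_∣ (sym (+-assoc j j′ y)) (regroup j x j′))
                                      (∣m+n-m+o∣≡∣n-o∣ (j + j′) y x))
      where
      regroup : ∀ j x j′ → j + x + j′ ≡ j + j′ + x
      regroup = solve-∀
    gather : ∀ p m d r t → p + m * d + r + t * d ≡ p + (m + t) * d + r
    gather = solve-∀
    identity : ∀ j x j′ y →
      (x + y) * (x + y) * ((j + x) * j′ + (j′ + y) * j) + (y * y + x * x) * (j * j′ + (j′ + y) * (j + x))
        + 2 * (x * x * (y * y))
      ≡ ((j + x + j) * (j′ + y + j′)) * (x * x + y * y) + 2 * (y * x) * (j * j′ + (j′ + y) * (j + x))
    identity = solve-∀

-- Recursions for the moments

double-double : ∀ x y → 4 * x + 4 * y ≡ 2 * (2 * (x + y))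
double-double = solve-∀

moment-step : ∀ w j n → 2 * ((n + j) * moment w (suc j) n + (n + j) * moment w j n) ≡
  ∑ᶜ n (λ r s → w r s * ((2 * (r * s) + 2) * b r s j)) + convolutionMoment w (suc j) n
moment-step w j n = begin
  2 * ((n + j) * moment w (suc j) n + (n + j) * moment w j n)
    ≡⟨ cong (2 *_) (cong₂ _+_ (∑-*ˡ (colourings n) (n + j) _) (∑-*ˡ (colourings n) (n + j) _)) ⟨
  2 * (∑ᶜ n (λ r s → (n + j) * (w r s * b r s (suc j))) + ∑ᶜ n (λ r s → (n + j) * (w r s * b r s j)))
    ≡⟨ cong (2 *_) (∑-+ (colourings n) _ _) ⟨
  2 * ∑ᶜ n (λ r s → (n + j) * (w r s * b r s (suc j)) + (n + j) * (w r s * b r s j))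
    ≡⟨ ∑-*ˡ (colourings n) 2 _ ⟨
  ∑ᶜ n (λ r s → 2 * ((n + j) * (w r s * b r s (suc j)) + (n + j) * (w r s * b r s j)))
    ≡⟨ ∑-cong (colourings n) (λ {(r , s)} p → pointwise r s (colourings-+ n p)) ⟩
  ∑ᶜ n (λ r s → w r s * ((2 * (r * s) + 2) * b r s j) + w r s * bConvolution r s (suc j))
    ≡⟨ ∑-+ (colourings n) _ _ ⟩
  ∑ᶜ n (λ r s → w r s * ((2 * (r * s) + 2) * b r s j)) + convolutionMoment w (suc j) n ∎
  where
  open ≡-Reasoning
  pointwise : ∀ r s → r + s ≡ n → 2 * ((n + j) * (w r s * b r s (suc j)) + (n + j) * (w r s * b r s j)) ≡
    w r s * ((2 * (r * s) + 2) * b r s j) + w r s * bConvolution r s (suc j)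
  pointwise r s refl = trans (factor (r + s + j) (w r s) (b r s (suc j)) (b r s j))
    (trans (cong (w r s *_) (b-step r s j)) (*-distribˡ-+ (w r s) _ _))
    where
    factor : ∀ m w x y → 2 * (m * (w * x) + m * (w * y)) ≡ w * (2 * (m * x + m * y))
    factor = solve-∀

moment-tree : ∀ w n → 2 * (n * moment w 0 n) ≡ 2 * moment w 0 n + convolutionMoment w 0 n
moment-tree w n = begin
  2 * (n * moment w 0 n)
    ≡⟨ cong (2 *_) (∑-*ˡ (colourings n) n _) ⟨
  2 * ∑ᶜ n (λ r s → n * (w r s * b r s 0))
    ≡⟨ ∑-*ˡ (colourings n) 2 _ ⟨
  ∑ᶜ n (λ r s → 2 * (n * (w r s * b r s 0)))
    ≡⟨ ∑-cong (colourings n) (λ {(r , s)} p → pointwise r s (colourings-+ n p)) ⟩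
  ∑ᶜ n (λ r s → 2 * (w r s * b r s 0) + w r s * bConvolution r s 0)
    ≡⟨ trans (∑-+ (colourings n) _ _) (cong (_+ convolutionMoment w 0 n) (∑-*ˡ (colourings n) 2 _)) ⟩
  2 * moment w 0 n + convolutionMoment w 0 n ∎
  where
  open ≡-Reasoning
  pointwise : ∀ r s → r + s ≡ n → 2 * (n * (w r s * b r s 0)) ≡ 2 * (w r s * b r s 0) + w r s * bConvolution r s 0
  pointwise r s refl = trans (factor (r + s) (w r s) (b r s 0)) (trans (cong (w r s *_) (b-tree r s))
    (distrib (w r s) (b r s 0) (bConvolution r s 0)))
    where
    factor : ∀ m w x → 2 * (m * (w * x)) ≡ w * (2 * (m * x))
    factor = solve-∀
    distrib : ∀ w x c → w * (2 * x + c) ≡ 2 * (w * x) + w * c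
    distrib = solve-∀

∑-product : ∀ p q (f g : ℕ → ℕ → ℕ) →
  ∑ᶜ p (λ i j → ∑ᶜ q (λ i′ j′ → f i j * g i′ j′)) ≡ ∑ᶜ p f * ∑ᶜ q g
∑-product p q f g = sym (∑-*-∑ (colourings p) (colourings q) (uncurry f) (uncurry g))

-- For constant weight the admissible edges before and after recolouring add up to (i + j)(i′ + j′),
-- a function of the part sizes only, so the sums over the colourings of the two parts separate.
v-convolution : ∀ k n → 2 * convolutionMoment (λ _ _ → 1) k n ≡
  ∑ᵃ k (λ x y → (θ (v x) ⋆ θ (v y)) n)
v-convolution k n = trans (convolutionMoment-symmetrised (λ _ _ → 1) k n)
  (∑-cong′ (antidiagonal k) (λ (x , y) → ∑-cong′ (colourings n) (λ (p , q) → trans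
    (∑-cong (colourings p) (λ {(i , j)} r → ∑-cong (colourings q) (λ {(i′ , j′)} s →
      pointwise x y (colourings-+ p r) (colourings-+ q s))))
    (trans (∑-product p q (λ i j → p * (1 * b i j x)) (λ i′ j′ → q * (1 * b i′ j′ y)))
           (cong₂ _*_ (∑-*ˡ (colourings p) p _) (∑-*ˡ (colourings q) q _))))))
  where
  pointwise : ∀ x y {p q i j i′ j′} → i + j ≡ p → i′ + j′ ≡ q →
    symmetrised (λ _ _ → 1) i j i′ j′ * (b i j x * b i′ j′ y) ≡ (p * (1 * b i j x)) * (q * (1 * b i′ j′ y))
  pointwise x y {i = i} {j} {i′} {j′} refl refl = lemma i j i′ j′ (b i j x) (b i′ j′ y)
    where
    lemma : ∀ i j i′ j′ X Y → (1 * (i * j′ + i′ * j) + 1 * (j * j′ + i′ * i)) * (X * Y)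
            ≡ ((i + j) * (1 * X)) * ((i′ + j′) * (1 * Y))
    lemma = solve-∀

-- By `symmetrised-sqDiff` the squared differences of the parts simply add, and the two resulting
-- sums are equal by symmetry.
S-convolution : ∀ k n → 2 * convolutionMoment sqDiff k n ≤
  2 * ∑ᵃ k (λ x y → (θ (S x) ⋆ θ (v y)) n)
S-convolution k n = begin
  2 * convolutionMoment sqDiff k n
    ≡⟨ convolutionMoment-symmetrised sqDiff k n ⟩
  ∑ᵃ k (λ x y → ∑ᶜ n (symmetrisedSum D x y))
    ≤⟨ ∑-mono (antidiagonal k) (λ {(x , y)} _ → ∑-mono (colourings n) (λ {(p , q)} _ →
         ∑-mono (colourings p) (λ {(i , j)} r → ∑-mono (colourings q) (λ {(i′ , j′)} s →
           pointwise x y (colourings-+ p r) (colourings-+ q s))))) ⟩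
  ∑ᵃ k (λ x y → ∑ᶜ n (λ p q →
    ∑ᶜ p (λ i j → ∑ᶜ q (split x y p q i j))))
    ≡⟨ ∑-cong′ (antidiagonal k) (λ (x , y) → ∑-cong′ (colourings n) (λ (p , q) → separate x y p q)) ⟩
  ∑ᵃ k (λ x y → ∑ᶜ n (λ p q →
    θ (S x) p * θ (v y) q + θ (v x) p * θ (S y) q))
    ≡⟨ trans (∑-cong′ (antidiagonal k) (λ (x , y) → ∑-+ (colourings n) _ _)) (∑-+ (antidiagonal k) _ _) ⟩
  X + ∑ᵃ k (λ x y → (θ (v x) ⋆ θ (S y)) n)
    ≡⟨ cong (X +_) (trans (∑-antidiagonal-swap k _) (∑-cong′ (antidiagonal k) (λ (x , y) →
         trans (∑-colourings-swap n _) (∑-cong′ (colourings n) (λ (p , q) → *-comm (θ (v y) q) (θ (S x) p)))))) ⟩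
  X + X
    ≡⟨ cong (X +_) (+-identityʳ X) ⟨
  2 * X ∎
  where
  open ≤-Reasoning
  D = sqDiff
  split : ℕ → ℕ → ℕ → ℕ → ℕ → ℕ → ℕ → ℕ → ℕ
  split x y p q i j i′ j′ =
    (p * (D i j * b i j x)) * (q * (1 * b i′ j′ y)) + (p * (1 * b i j x)) * (q * (D i′ j′ * b i′ j′ y))
  X = ∑ᵃ k (λ x y → (θ (S x) ⋆ θ (v y)) n)
  pointwise : ∀ x y {p q i j i′ j′} → i + j ≡ p → i′ + j′ ≡ q →
    symmetrised D i j i′ j′ * (b i j x * b i′ j′ y) ≤ split x y p q i j i′ j′
  pointwise x y {p} {q} {i} {j} {i′} {j′} refl refl = ≤-trans
    (*-monoˡ-≤ (b i j x * b i′ j′ y) (symmetrised-sqDiff i j i′ j′))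
    (≤-reflexive (lemma p q (D i j) (D i′ j′) (b i j x) (b i′ j′ y)))
    where
    lemma : ∀ p q d d′ X Y → p * q * (d + d′) * (X * Y) ≡ (p * (d * X)) * (q * (1 * Y)) + (p * (1 * X)) * (q * (d′ * Y))
    lemma = solve-∀
  separate : ∀ x y p q → ∑ᶜ p (λ i j → ∑ᶜ q (split x y p q i j))
    ≡ θ (S x) p * θ (v y) q + θ (v x) p * θ (S y) q
  separate x y p q = trans
    (trans (∑-cong′ (colourings p) (λ _ → ∑-+ (colourings q) _ _)) (∑-+ (colourings p) _ _))
    (cong₂ _+_
      (trans (∑-product p q (λ i j → p * (D i j * b i j x)) (λ i′ j′ → q * (1 * b i′ j′ y)))
             (cong₂ _*_ (∑-*ˡ (colourings p) p _) (∑-*ˡ (colourings q) q _)))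
      (trans (∑-product p q (λ i j → p * (1 * b i j x)) (λ i′ j′ → q * (D i′ j′ * b i′ j′ y)))
             (cong₂ _*_ (∑-*ˡ (colourings p) p _) (∑-*ˡ (colourings q) q _))))

-- From 4 r s + (r - s)² = (r + s)². This is what replaces r s by n²/4 at the cost of `S`.
4Q+S : ∀ k n → 4 * Q k n + S k n ≡ n * n * v k n
4Q+S k n = begin
  4 * Q k n + S k n
    ≡⟨ cong (_+ S k n) (∑-*ˡ (colourings n) 4 _) ⟨
  ∑ᶜ n (λ r s → 4 * (r * s * b r s k)) + S k n
    ≡⟨ ∑-+ (colourings n) _ _ ⟨
  ∑ᶜ n (λ r s → 4 * (r * s * b r s k) + sqDiff r s * b r s k)
    ≡⟨ ∑-cong (colourings n) (λ {(r , s)} p → pointwise r s (colourings-+ n p)) ⟩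
  ∑ᶜ n (λ r s → n * n * (1 * b r s k))
    ≡⟨ ∑-*ˡ (colourings n) (n * n) _ ⟩
  n * n * v k n ∎
  where
  open ≡-Reasoning
  pointwise : ∀ r s → r + s ≡ n → 4 * (r * s * b r s k) + sqDiff r s * b r s k ≡ n * n * (1 * b r s k)
  pointwise r s refl = trans (factor (r * s) (sqDiff r s) (b r s k))
    (cong₂ _*_ (sqDiff-4* r s) (sym (*-identityˡ (b r s k))))
    where
    factor : ∀ p d x → 4 * (p * x) + d * x ≡ (4 * p + d) * x
    factor = solve-∀

v-step : ∀ j n → 4 * ((n + j) * v (suc j) n) + 4 * ((n + j) * v j n) ≡
  4 * Q j n + 4 * v j n + ∑ᵃ (suc j) (λ x y → (θ (v x) ⋆ θ (v y)) n)
v-step j n = begin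
  4 * ((n + j) * v (suc j) n) + 4 * ((n + j) * v j n)
    ≡⟨ double-double ((n + j) * v (suc j) n) ((n + j) * v j n) ⟩
  2 * (2 * ((n + j) * v (suc j) n + (n + j) * v j n))
    ≡⟨ cong (2 *_) (moment-step (λ _ _ → 1) j n) ⟩
  2 * (∑ᶜ n (λ r s → 1 * ((2 * (r * s) + 2) * b r s j)) + convolutionMoment (λ _ _ → 1) (suc j) n)
    ≡⟨ *-distribˡ-+ 2 (∑ᶜ n (λ r s → 1 * ((2 * (r * s) + 2) * b r s j))) (convolutionMoment (λ _ _ → 1) (suc j) n) ⟩
  2 * ∑ᶜ n (λ r s → 1 * ((2 * (r * s) + 2) * b r s j)) + 2 * convolutionMoment (λ _ _ → 1) (suc j) n
    ≡⟨ cong₂ _+_ (trans (sym (∑-*ˡ (colourings n) 2 _)) (trans (∑-cong′ (colourings n) (λ (r , s) → expand r s (b r s j)))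
         (trans (∑-+ (colourings n) _ _) (cong₂ _+_ (∑-*ˡ (colourings n) 4 _) (∑-*ˡ (colourings n) 4 _)))))
         (v-convolution (suc j) n) ⟩
  4 * Q j n + 4 * v j n + ∑ᵃ (suc j) (λ x y → (θ (v x) ⋆ θ (v y)) n) ∎
  where
  open ≡-Reasoning
  expand : ∀ r s x → 2 * (1 * ((2 * (r * s) + 2) * x)) ≡ 4 * (r * s * x) + 4 * (1 * x)
  expand = solve-∀

v-tree : ∀ n → 4 * (n * v 0 n) ≡ 4 * v 0 n + (θ (v 0) ⋆ θ (v 0)) n
v-tree n = begin
  4 * (n * v 0 n)
    ≡⟨ *-assoc 2 2 (n * v 0 n) ⟩
  2 * (2 * (n * v 0 n))
    ≡⟨ cong (2 *_) (moment-tree (λ _ _ → 1) n) ⟩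
  2 * (2 * v 0 n + convolutionMoment (λ _ _ → 1) 0 n)
    ≡⟨ *-distribˡ-+ 2 (2 * v 0 n) _ ⟩
  2 * (2 * v 0 n) + 2 * convolutionMoment (λ _ _ → 1) 0 n
    ≡⟨ cong₂ _+_ (sym (*-assoc 2 2 (v 0 n))) (trans (v-convolution 0 n) (+-identityʳ _)) ⟩
  4 * v 0 n + (θ (v 0) ⋆ θ (v 0)) n ∎
  where open ≡-Reasoning

S≤ : ∀ k n → S k n ≤ n * n * v k n
S≤ k n = ≤-trans (m≤n+m (S k n) (4 * Q k n)) (≤-reflexive (4Q+S k n))

-- Here 4 r s is bounded by n², and the leftover 4 S_j is covered by the 4 (n + j) S_j which the
-- exact recursion has on its left side.
S-step : ∀ j n → 1 ≤ n → 4 * ((n + j) * S (suc j) n) ≤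
  n * n * S j n + 2 * ∑ᵃ (suc j) (λ x y → (θ (S x) ⋆ θ (v y)) n)
S-step j n 1≤n = +-cancelʳ-≤ (4 * ((n + j) * S j n)) _ _ (begin
  4 * ((n + j) * S (suc j) n) + 4 * ((n + j) * S j n)
    ≡⟨ double-double ((n + j) * S (suc j) n) ((n + j) * S j n) ⟩
  2 * (2 * ((n + j) * S (suc j) n + (n + j) * S j n))
    ≡⟨ cong (2 *_) (moment-step D j n) ⟩
  2 * (∑ᶜ n (λ r s → D r s * ((2 * (r * s) + 2) * b r s j)) + convolutionMoment D (suc j) n)
    ≡⟨ *-distribˡ-+ 2 (∑ᶜ n (λ r s → D r s * ((2 * (r * s) + 2) * b r s j))) (convolutionMoment D (suc j) n) ⟩
  2 * ∑ᶜ n (λ r s → D r s * ((2 * (r * s) + 2) * b r s j)) + 2 * convolutionMoment D (suc j) n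
    ≤⟨ +-mono-≤ main (S-convolution (suc j) n) ⟩
  (n * n * S j n + 4 * ((n + j) * S j n)) + 2 * X
    ≡⟨ +-right-comm (n * n * S j n) (4 * ((n + j) * S j n)) (2 * X) ⟩
  n * n * S j n + 2 * X + 4 * ((n + j) * S j n) ∎)
  where
  open ≤-Reasoning
  D = sqDiff
  X = ∑ᵃ (suc j) (λ x y → (θ (S x) ⋆ θ (v y)) n)
  regroup : ∀ p d x → 2 * (d * ((2 * p + 2) * x)) ≡ 4 * p * (d * x) + 4 * (d * x)
  regroup = solve-∀
  pointwise : ∀ r s → r + s ≡ n → 2 * (D r s * ((2 * (r * s) + 2) * b r s j)) ≤
    n * n * (D r s * b r s j) + 4 * ((n + j) * (D r s * b r s j))
  pointwise r s refl = ≤-trans (≤-reflexive (regroup (r * s) (D r s) (b r s j))) (+-mono-≤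
    (*-monoˡ-≤ (D r s * b r s j) (≤-trans (m≤m+n (4 * (r * s)) (D r s)) (≤-reflexive (sqDiff-4* r s))))
    (*-monoʳ-≤ 4 (≤-trans (≤-reflexive (sym (*-identityˡ _)))
      (*-monoˡ-≤ (D r s * b r s j) (≤-trans 1≤n (m≤m+n n j))))))
  main : 2 * ∑ᶜ n (λ r s → D r s * ((2 * (r * s) + 2) * b r s j)) ≤
    n * n * S j n + 4 * ((n + j) * S j n)
  main = begin
    2 * ∑ᶜ n (λ r s → D r s * ((2 * (r * s) + 2) * b r s j))
      ≡⟨ ∑-*ˡ (colourings n) 2 _ ⟨
    ∑ᶜ n (λ r s → 2 * (D r s * ((2 * (r * s) + 2) * b r s j)))
      ≤⟨ ∑-mono (colourings n) (λ {(r , s)} p → pointwise r s (colourings-+ n p)) ⟩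
    ∑ᶜ n (λ r s → n * n * (D r s * b r s j) + 4 * ((n + j) * (D r s * b r s j)))
      ≡⟨ ∑-+ (colourings n) _ _ ⟩
    ∑ᶜ n (λ r s → n * n * (D r s * b r s j)) + ∑ᶜ n (λ r s → 4 * ((n + j) * (D r s * b r s j)))
      ≡⟨ cong₂ _+_ (∑-*ˡ (colourings n) (n * n) _)
           (trans (∑-*ˡ (colourings n) 4 _) (cong (4 *_) (∑-*ˡ (colourings n) (n + j) _))) ⟩
    n * n * S j n + 4 * ((n + j) * S j n) ∎

S-tree : ∀ n → 4 * (n * S 0 n) ≤ 4 * S 0 n + 2 * (θ (S 0) ⋆ θ (v 0)) n
S-tree n = begin
  4 * (n * S 0 n)
    ≡⟨ *-assoc 2 2 (n * S 0 n) ⟩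
  2 * (2 * (n * S 0 n))
    ≡⟨ cong (2 *_) (moment-tree sqDiff n) ⟩
  2 * (2 * S 0 n + convolutionMoment sqDiff 0 n)
    ≡⟨ *-distribˡ-+ 2 (2 * S 0 n) _ ⟩
  2 * (2 * S 0 n) + 2 * convolutionMoment sqDiff 0 n
    ≤⟨ +-mono-≤ (≤-reflexive (sym (*-assoc 2 2 (S 0 n)))) (S-convolution 0 n) ⟩
  4 * S 0 n + 2 * ((θ (S 0) ⋆ θ (v 0)) n + 0)
    ≡⟨ cong (λ z → 4 * S 0 n + 2 * z) (+-identityʳ ((θ (S 0) ⋆ θ (v 0)) n)) ⟩
  4 * S 0 n + 2 * (θ (S 0) ⋆ θ (v 0)) n ∎
  where open ≤-Reasoning

-- Binomial convolution

infixl 7 _⊛_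
-- Two structures on complementary vertex sets together with a vertex chosen in each, that is, with
-- an edge joining them.
_⊛_ : (ℕ → ℕ) → (ℕ → ℕ) → ℕ → ℕ
f ⊛ g = θ f ⋆ θ g

-- `θ` vanishes at 0, so only pairs of positive indices contribute, and both indices are below n.
-- This is what allows inductions on n through `⊛`.
⊛-mono : ∀ n {f f′ g g′ : ℕ → ℕ} → (∀ m → m < n → f m ≤ f′ m) → (∀ m → m < n → g m ≤ g′ m) →
         (f ⊛ g) n ≤ (f′ ⊛ g′) n
⊛-mono n {f} {f′} {g} {g′} f≤ g≤ = ∑-mono (colourings n) (λ {(i , j)} p → pointwise i j (colourings-+ n p))
  where
  pointwise : ∀ i j → i + j ≡ n → θ f i * θ g j ≤ θ f′ i * θ g′ j
  pointwise zero    j       eq = z≤n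
  pointwise (suc i) zero    eq = ≤-trans (≤-reflexive (*-zeroʳ (θ f (suc i)))) z≤n
  pointwise (suc i) (suc j) refl = *-mono-≤
    (*-monoʳ-≤ (suc i) (f≤ (suc i) (m<m+n (suc i) z<s)))
    (*-monoʳ-≤ (suc j) (g≤ (suc j) (m<n+m (suc j) z<s)))

⊛-mono′ : ∀ n {f f′ g g′ : ℕ → ℕ} → (∀ m → f m ≤ f′ m) → (∀ m → g m ≤ g′ m) → (f ⊛ g) n ≤ (f′ ⊛ g′) n
⊛-mono′ n f≤ g≤ = ⊛-mono n (λ m _ → f≤ m) (λ m _ → g≤ m)

⊛-cong : ∀ n {f f′ g g′ : ℕ → ℕ} → (∀ m → m < n → f m ≡ f′ m) → (∀ m → m < n → g m ≡ g′ m) →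
         (f ⊛ g) n ≡ (f′ ⊛ g′) n
⊛-cong n f≡ g≡ = ≤-antisym (⊛-mono n (λ m l → ≤-reflexive (f≡ m l)) (λ m l → ≤-reflexive (g≡ m l)))
                           (⊛-mono n (λ m l → ≤-reflexive (sym (f≡ m l))) (λ m l → ≤-reflexive (sym (g≡ m l))))

⊛-comm : ∀ f g n → (f ⊛ g) n ≡ (g ⊛ f) n
⊛-comm f g n = trans (∑-colourings-swap n _) (∑-cong′ (colourings n) (λ (i , j) → *-comm (θ f j) (θ g i)))

⊛-+ʳ : ∀ f g h n → (f ⊛ (λ m → g m + h m)) n ≡ (f ⊛ g) n + (f ⊛ h) n
⊛-+ʳ f g h n = trans (∑-cong′ (colourings n) (λ (i , j) → distrib (θ f i) j (g j) (h j))) (∑-+ (colourings n) _ _)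
  where
  distrib : ∀ x j y z → x * (j * (y + z)) ≡ x * (j * y) + x * (j * z)
  distrib = solve-∀

⊛-+ˡ : ∀ f g h n → ((λ m → f m + g m) ⊛ h) n ≡ (f ⊛ h) n + (g ⊛ h) n
⊛-+ˡ f g h n = trans (⊛-comm (λ m → f m + g m) h n)
  (trans (⊛-+ʳ h f g n) (cong₂ _+_ (⊛-comm h f n) (⊛-comm h g n)))

⊛-*ʳ : ∀ f c g n → (f ⊛ (λ m → c * g m)) n ≡ c * (f ⊛ g) n
⊛-*ʳ f c g n = trans (∑-cong′ (colourings n) (λ (i , j) → factor (θ f i) j c (g j))) (∑-*ˡ (colourings n) c _)
  where
  factor : ∀ x j c y → x * (j * (c * y)) ≡ c * (x * (j * y))
  factor = solve-∀

⊛-*ˡ : ∀ c f g n → ((λ m → c * f m) ⊛ g) n ≡ c * (f ⊛ g) n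
⊛-*ˡ c f g n = trans (⊛-comm (λ m → c * f m) g n) (trans (⊛-*ʳ g c f n) (cong (c *_) (⊛-comm g f n)))

-- The Leibniz rule for x d/dx.
⊛-θ : ∀ f g n → n * (f ⊛ g) n ≡ (θ f ⊛ g) n + (f ⊛ θ g) n
⊛-θ f g n = trans (sym (∑-*ˡ (colourings n) n _)) (trans
  (∑-cong (colourings n) (λ {(i , j)} p → trans (cong (_* (θ f i * θ g j)) (sym (colourings-+ n p)))
    (leibniz i j (f i) (g j)))) (∑-+ (colourings n) _ _))
  where
  leibniz : ∀ i j x y → (i + j) * ((i * x) * (j * y)) ≡ (i * (i * x)) * (j * y) + (i * x) * (j * (j * y))
  leibniz = solve-∀

∑⊛ : (ℕ → ℕ → ℕ) → (ℕ → ℕ → ℕ) → ℕ → ℕ → ℕ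
∑⊛ f g k n = ∑ᵃ k (λ x y → (f x ⊛ g y) n)

∑⊛-θ : ∀ f k n → n * ∑⊛ f f k n ≡ 2 * ∑⊛ (λ x → θ (f x)) f k n
∑⊛-θ f k n = begin
  n * ∑⊛ f f k n
    ≡⟨ ∑-*ˡ (antidiagonal k) n _ ⟨
  ∑ᵃ k (λ x y → n * (f x ⊛ f y) n)
    ≡⟨ ∑-cong′ (antidiagonal k) (λ (x , y) → ⊛-θ (f x) (f y) n) ⟩
  ∑ᵃ k (λ x y → (θ (f x) ⊛ f y) n + (f x ⊛ θ (f y)) n)
    ≡⟨ ∑-+ (antidiagonal k) _ _ ⟩
  X + ∑ᵃ k (λ x y → (f x ⊛ θ (f y)) n)
    ≡⟨ cong (X +_) (trans (∑-antidiagonal-swap k _) (∑-cong′ (antidiagonal k) (λ (x , y) → ⊛-comm (f y) (θ (f x)) n))) ⟩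
  X + X
    ≡⟨ cong (X +_) (+-identityʳ X) ⟨
  2 * X ∎
  where
  open ≡-Reasoning
  X = ∑⊛ (λ x → θ (f x)) f k n

∈⇒≤∑ : {A : Set} {xs : List A} {x : A} (f : A → ℕ) → x ∈ xs → f x ≤ ∑ xs f
∈⇒≤∑ f (here refl)          = m≤m+n (f _) _
∈⇒≤∑ f (there {x = y} x∈xs) = m≤n⇒m≤o+n (f y) (∈⇒≤∑ f x∈xs)

strong-induction : (P : ℕ → Set) → (∀ n → (∀ m → m < n → P m) → P n) → ∀ n → P n
strong-induction P step n = go (suc n) n ≤-refl
  where
  go : ∀ b n → n < b → P n
  go (suc b) n (s≤s n≤b) = step n (λ m m<n → go b m (≤-trans m<n n≤b))

1≤⇒≤* : ∀ {c} x → 1 ≤ c → x ≤ c * x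
1≤⇒≤* x 1≤c = ≤-trans (≤-reflexive (sym (*-identityˡ x))) (*-monoˡ-≤ x 1≤c)

n+j≤ : ∀ j {n} → 1 ≤ n → n + j ≤ suc j * n
n+j≤ j {n} 1≤n = +-monoʳ-≤ n (≤-trans (≤-reflexive (sym (*-identityʳ j))) (*-monoʳ-≤ j 1≤n))

-- Trees and the imbalance of the classes

v-0 : ∀ k → v k 0 ≡ 0
v-0 k rewrite b-0 k = refl

v-0-1 : v 0 1 ≡ 2
v-0-1 = trans (cong₂ (λ x y → 1 * x + (1 * y + 0)) b-1 (trans (b-comm 0 1 0) b-1)) refl

-- A tree has exactly two proper 2-colourings; here this follows because `2 * a 0` solves the
-- recursion of `v 0`, in which n - 1 can be cancelled for n ≥ 2.
v-trees : ∀ n → v 0 n ≡ 2 * a 0 n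
v-trees = strong-induction _ step
  where
  step : ∀ n → (∀ m → m < n → v 0 m ≡ 2 * a 0 m) → v 0 n ≡ 2 * a 0 n
  step zero          ih = trans (v-0 0) (cong (2 *_) (sym (a-0 0)))
  step (suc zero)    ih = trans v-0-1 (cong (2 *_) (sym a-0-1))
  step n@(suc (suc q)) ih = *-cancelˡ-≡ _ _ (4 * suc q) (+-cancelˡ-≡ (4 * v 0 n) _ _ (begin
    4 * v 0 n + 4 * suc q * v 0 n
      ≡⟨ collect q (v 0 n) ⟩
    4 * (n * v 0 n)
      ≡⟨ v-tree n ⟩
    4 * v 0 n + (v 0 ⊛ v 0) n
      ≡⟨ cong (4 * v 0 n +_) (trans (⊛-cong n ih ih)
           (trans (⊛-*ˡ 2 (a 0) (λ m → 2 * a 0 m) n) (cong (2 *_) (⊛-*ʳ (a 0) 2 (a 0) n)))) ⟩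
    4 * v 0 n + 2 * (2 * (a 0 ⊛ a 0) n)
      ≡⟨ cong (λ z → 4 * v 0 n + 2 * (2 * z)) (+-cancelˡ-≡ (2 * a 0 n) _ _ (trans (sym (a-tree n)) (expand q (a 0 n)))) ⟩
    4 * v 0 n + 2 * (2 * (2 * (suc q * a 0 n)))
      ≡⟨ cong (4 * v 0 n +_) (regroup (suc q) (a 0 n)) ⟩
    4 * v 0 n + 4 * suc q * (2 * a 0 n) ∎))
    where
    open ≡-Reasoning
    collect : ∀ q x → 4 * x + 4 * (1 + q) * x ≡ 4 * ((2 + q) * x)
    collect = solve-∀
    expand : ∀ q x → 2 * ((2 + q) * x) ≡ 2 * x + 2 * ((1 + q) * x)
    expand = solve-∀
    regroup : ∀ p x → 2 * (2 * (2 * (p * x))) ≡ 4 * p * (2 * x)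
    regroup = solve-∀

-- By the Leibniz rule, multiplying the recursion of `v 0` by n makes `θ (v 0)` a supersolution of
-- the recursion of `S 0`. For n ≤ 1 the trivial bound n² v is already good enough.
S-tree-bound : ∀ n → S 0 n ≤ n * v 0 n
S-tree-bound = strong-induction _ step
  where
  step : ∀ n → (∀ m → m < n → S 0 m ≤ m * v 0 m) → S 0 n ≤ n * v 0 n
  step zero          ih = S≤ 0 0
  step (suc zero)    ih = S≤ 0 1
  step n@(suc (suc q)) ih = *-cancelˡ-≤ (4 * suc q) (+-cancelˡ-≤ (4 * S 0 n + 4 * (n * v 0 n)) _ _ (begin
    4 * S 0 n + 4 * (n * v 0 n) + 4 * suc q * S 0 n
      ≡⟨ collect q (S 0 n) (4 * (n * v 0 n)) ⟩
    4 * (n * S 0 n) + 4 * (n * v 0 n)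
      ≤⟨ +-monoˡ-≤ _ (S-tree n) ⟩
    4 * S 0 n + 2 * (S 0 ⊛ v 0) n + 4 * (n * v 0 n)
      ≤⟨ +-monoˡ-≤ _ (+-monoʳ-≤ (4 * S 0 n) (*-monoʳ-≤ 2 (⊛-mono n ih (λ _ _ → ≤-refl)))) ⟩
    4 * S 0 n + 2 * (θ (v 0) ⊛ v 0) n + 4 * (n * v 0 n)
      ≡⟨ cong (λ z → 4 * S 0 n + z + 4 * (n * v 0 n)) leibniz ⟩
    4 * S 0 n + n * (v 0 ⊛ v 0) n + 4 * (n * v 0 n)
      ≡⟨ regroup n (4 * S 0 n) ((v 0 ⊛ v 0) n) (v 0 n) ⟩
    4 * S 0 n + n * (4 * v 0 n + (v 0 ⊛ v 0) n)
      ≡⟨ cong (λ z → 4 * S 0 n + n * z) (v-tree n) ⟨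
    4 * S 0 n + n * (4 * (n * v 0 n))
      ≡⟨ finish q (4 * S 0 n) (v 0 n) ⟩
    4 * S 0 n + 4 * (n * v 0 n) + 4 * suc q * (n * v 0 n) ∎))
    where
    open ≤-Reasoning
    leibniz : 2 * (θ (v 0) ⊛ v 0) n ≡ n * (v 0 ⊛ v 0) n
    leibniz = trans (cong ((θ (v 0) ⊛ v 0) n +_) (trans (+-identityʳ _) (⊛-comm (θ (v 0)) (v 0) n)))
                    (sym (⊛-θ (v 0) (v 0) n))
    collect : ∀ q x y → 4 * x + y + 4 * (1 + q) * x ≡ 4 * ((2 + q) * x) + y
    collect = solve-∀
    regroup : ∀ n s c x → s + n * c + 4 * (n * x) ≡ s + n * (4 * x + c)
    regroup = solve-∀
    finish : ∀ q s x → s + (2 + q) * (4 * ((2 + q) * x)) ≡ s + 4 * ((2 + q) * x) + 4 * (1 + q) * ((2 + q) * x)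
    finish = solve-∀

-- Replacing 4 Q by n² v costs S, and n + j is at most (j + 1) n; both losses are of order n v_j.
v-step-lower : ∀ {C j n} → 1 ≤ n → S j n ≤ C * (n * v j n) →
  n * n * v j n + ∑⊛ v v (suc j) n ≤ 4 * ((n + j) * v (suc j) n) + (4 * suc j + C) * (n * v j n)
v-step-lower {C} {j} {n} 1≤n S≤C = +-cancelˡ-≤ (4 * v j n) _ _ (begin
  4 * v j n + (n * n * v j n + ∑⊛ v v (suc j) n)
    ≡⟨ cong (λ z → 4 * v j n + (z + ∑⊛ v v (suc j) n)) (4Q+S j n) ⟨
  4 * v j n + (4 * Q j n + S j n + ∑⊛ v v (suc j) n)
    ≡⟨ regroup (4 * v j n) (4 * Q j n) (S j n) (∑⊛ v v (suc j) n) ⟩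
  4 * Q j n + 4 * v j n + ∑⊛ v v (suc j) n + S j n
    ≡⟨ cong (_+ S j n) (v-step j n) ⟨
  4 * ((n + j) * v (suc j) n) + 4 * ((n + j) * v j n) + S j n
    ≤⟨ +-mono-≤ (+-monoʳ-≤ (4 * ((n + j) * v (suc j) n)) (*-monoʳ-≤ 4 (*-monoˡ-≤ (v j n) (n+j≤ j 1≤n)))) S≤C ⟩
  4 * ((n + j) * v (suc j) n) + 4 * (suc j * n * v j n) + C * (n * v j n)
    ≡⟨ collect (4 * ((n + j) * v (suc j) n)) (suc j) n (v j n) C ⟩
  4 * ((n + j) * v (suc j) n) + (4 * suc j + C) * (n * v j n)
    ≤⟨ m≤n+m _ (4 * v j n) ⟩
  4 * v j n + (4 * ((n + j) * v (suc j) n) + (4 * suc j + C) * (n * v j n)) ∎)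
  where
  open ≤-Reasoning
  regroup : ∀ a b c d → a + (b + c + d) ≡ b + a + d + c
  regroup = solve-∀
  collect : ∀ a i n x C → a + 4 * (i * n * x) + C * (n * x) ≡ a + (4 * i + C) * (n * x)
  collect = solve-∀

-- The classes of a random proper 2-colouring differ by O(√n) on average.
-- For large n the sequence C n v_{j+1}(n) is a supersolution of the recursion
-- for S_{j+1}; for small n the trivial bound S ≤ n² v suffices.
S-bound : ∀ k → ∃ λ C → ∀ i → i ≤ k → ∀ n → S i n ≤ C * (n * v i n)
S-bound zero = 1 , λ { zero z≤n n → ≤-trans (S-tree-bound n) (≤-reflexive (sym (*-identityˡ _))) }
S-bound (suc j) with S-bound j
... | C′ , bound = C , all
  where
  C″ C : ℕ
  C″ = 4 * suc j + C′
  -- For n > C, both C′ n and C C″ are then at most C n / 2, since 2 C′ ≤ C and 2 C″ ≤ C < n.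
  C  = 2 * C′ + 2 * C″
  -- One constant has to serve all Betti numbers up to j + 1, since they occur together in the
  -- convolution.
  old : ∀ i → i ≤ j → ∀ n → S i n ≤ C * (n * v i n)
  old i i≤j n = ≤-trans (bound i i≤j n) (*-monoˡ-≤ (n * v i n) (≤-trans (m≤n*m C′ 2) (m≤m+n (2 * C′) (2 * C″))))
  step : ∀ n → (∀ m → m < n → S (suc j) m ≤ C * (m * v (suc j) m)) → S (suc j) n ≤ C * (n * v (suc j) n)
  step n ih with n ≤? C
  ... | yes n≤C = ≤-trans (S≤ (suc j) n) (≤-trans (≤-reflexive (*-assoc n n _)) (*-monoˡ-≤ (n * v (suc j) n) n≤C))
  ... | no n≰C = *-cancelˡ-≤ (4 * (n + j)) {{≢-nonZero (λ eq → <⇒≢ (≤-trans 1≤n (≤-trans (m≤m+n n j) (m≤n*m (n + j) 4))) (sym eq))}}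
    (+-cancelʳ-≤ (2 * (C * W)) _ _ (begin
    4 * (n + j) * S (suc j) n + 2 * (C * W)
      ≡⟨ double (n + j) (S (suc j) n) (C * W) ⟩
    4 * ((n + j) * S (suc j) n) + C * W + C * W
      ≤⟨ +-monoˡ-≤ _ (+-monoˡ-≤ _ (S-step j n 1≤n)) ⟩
    n * n * S j n + 2 * ∑⊛ S v (suc j) n + C * W + C * W
      ≤⟨ +-monoˡ-≤ _ (+-monoˡ-≤ _ (+-mono-≤ (*-monoʳ-≤ (n * n) (bound j ≤-refl n)) (*-monoʳ-≤ 2 convolution))) ⟩
    n * n * (C′ * (n * v j n)) + 2 * (C * Θ) + C * W + C * W
      ≡⟨ regroup₁ n C′ C (v j n) (Θ) ⟩
    C′ * W + C * (2 * Θ + W) + C * W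
      -- With S bounded by C θ v, the doubled convolution is C n times the one in the recursion for
      -- v. One copy of C W completes it to the left side of `v-step-lower`.
      ≡⟨ cong (λ z → C′ * W + C * (z + W) + C * W) (∑⊛-θ v (suc j) n) ⟨
    C′ * W + C * (n * ∑⊛ v v (suc j) n + W) + C * W
      ≡⟨ regroup₂ n C′ C (n * n * v j n) (∑⊛ v v (suc j) n) ⟩
    (C′ * n + C * n) * (n * n * v j n) + C * (n * (n * n * v j n + ∑⊛ v v (suc j) n))
      ≤⟨ +-monoʳ-≤ ((C′ * n + C * n) * (n * n * v j n)) (*-monoʳ-≤ C (*-monoʳ-≤ n (v-step-lower 1≤n (bound j ≤-refl n)))) ⟩
    (C′ * n + C * n) * (n * n * v j n) + C * (n * (4 * ((n + j) * v (suc j) n) + C″ * (n * v j n)))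
      ≡⟨ regroup₃ n C′ C C″ (n + j) (v j n) (v (suc j) n) ⟩
    4 * (n + j) * (C * (n * v (suc j) n)) + (C′ * n + C * n + C * C″) * (n * n * v j n)
      ≤⟨ +-monoʳ-≤ (4 * (n + j) * (C * (n * v (suc j) n))) (*-monoˡ-≤ (n * n * v j n) constants) ⟩
    4 * (n + j) * (C * (n * v (suc j) n)) + 2 * (C * n) * (n * n * v j n)
      ≡⟨ cong (4 * (n + j) * (C * (n * v (suc j) n)) +_) (regroup₄ C n (n * n * v j n)) ⟩
    4 * (n + j) * (C * (n * v (suc j) n)) + 2 * (C * W) ∎))
    where
    open ≤-Reasoning
    W Θ : ℕ
    W = n * (n * n * v j n)
    Θ = ∑⊛ (λ x → θ (v x)) v (suc j) n
    C<n : C < n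
    C<n = ≰⇒> n≰C
    1≤n : 1 ≤ n
    1≤n = ≤-trans (s≤s z≤n) C<n
    convolution : ∑⊛ S v (suc j) n ≤ C * Θ
    convolution = ≤-trans (∑-mono (antidiagonal (suc j)) (λ {(x , y)} p → ≤-trans
        (⊛-mono n (each x (m+n≤o⇒m≤o x (≤-reflexive (antidiagonal-+ (suc j) p)))) (λ _ _ → ≤-refl))
        (≤-reflexive (⊛-*ˡ C (θ (v x)) (v y) n))))
      (≤-reflexive (∑-*ˡ (antidiagonal (suc j)) C _))
      where
      each : ∀ x → x ≤ suc j → ∀ m → m < n → S x m ≤ C * (m * v x m)
      each x x≤ m m<n with x ≤? j
      ... | yes x≤j = old x x≤j m
      ... | no x≰j rewrite ≤-antisym x≤ (≰⇒> x≰j) = ih m m<n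
    constants : C′ * n + C * n + C * C″ ≤ 2 * (C * n)
    constants = *-cancelˡ-≤ 2 (begin
      2 * (C′ * n + C * n + C * C″)             ≡⟨ expand C′ C C″ n ⟩
      2 * C′ * n + C * (2 * C″) + 2 * (C * n)   ≤⟨ +-monoˡ-≤ (2 * (C * n)) (+-mono-≤
                                                     (*-monoˡ-≤ n (m≤m+n (2 * C′) (2 * C″)))
                                                     (*-monoʳ-≤ C (≤-trans (m≤n+m (2 * C″) (2 * C′)) (<⇒≤ C<n)))) ⟩
      C * n + C * n + 2 * (C * n)               ≡⟨ collect (C * n) ⟩
      2 * (2 * (C * n))                         ∎)
      where
      expand : ∀ C′ C C″ n → 2 * (C′ * n + C * n + C * C″) ≡ 2 * C′ * n + C * (2 * C″) + 2 * (C * n)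
      expand = solve-∀
      collect : ∀ x → x + x + 2 * x ≡ 2 * (2 * x)
      collect = solve-∀
    double : ∀ m s x → 4 * m * s + 2 * x ≡ 4 * (m * s) + x + x
    double = solve-∀
    regroup₁ : ∀ n C′ C x y → n * n * (C′ * (n * x)) + 2 * (C * y) + C * (n * (n * n * x)) + C * (n * (n * n * x))
      ≡ C′ * (n * (n * n * x)) + C * (2 * y + n * (n * n * x)) + C * (n * (n * n * x))
    regroup₁ = solve-∀
    regroup₂ : ∀ n C′ C x y → C′ * (n * x) + C * (n * y + n * x) + C * (n * x)
      ≡ (C′ * n + C * n) * x + C * (n * (x + y))
    regroup₂ = solve-∀
    regroup₃ : ∀ n C′ C C″ m x y → (C′ * n + C * n) * (n * n * x) + C * (n * (4 * (m * y) + C″ * (n * x)))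
      ≡ 4 * m * (C * (n * y)) + (C′ * n + C * n + C * C″) * (n * n * x)
    regroup₃ = solve-∀
    regroup₄ : ∀ C n x → 2 * (C * n) * x ≡ 2 * (C * (n * x))
    regroup₄ = solve-∀
  all : ∀ i → i ≤ suc j → ∀ n → S i n ≤ C * (n * v i n)
  all i i≤ with i ≤? j
  ... | yes i≤j = old i i≤j
  ... | no i≰j rewrite ≤-antisym i≤ (≰⇒> i≰j) = strong-induction _ step

-- Asymptotic comparison

Eventually : (ℕ → Set) → Set
Eventually P = ∃ λ M → ∀ n → M ≤ n → P n

_⊓ᵉ_ : ∀ {P R} → Eventually P → Eventually R → Eventually (λ n → P n × R n)
(M , p) ⊓ᵉ (M′ , r) = M + M′ , λ n le → p n (≤-trans (m≤m+n M M′) le) , r n (≤-trans (m≤n+m M′ M) le)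

mapᵉ : ∀ {P R : ℕ → Set} → (∀ n → P n → R n) → Eventually P → Eventually R
mapᵉ f (M , p) = M , λ n le → f n (p n le)

infix 4 _≲_
-- For eventually positive g this says limsup f/g ≤ 1, stated without division.
_≲_ : (ℕ → ℕ) → (ℕ → ℕ) → Set
f ≲ g = ∀ q → Eventually (λ n → q * f n ≤ suc q * g n)

-- The number of rooted trees.
t : ℕ → ℕ
t = θ (a 0)

-- The tree recursion differentiated by `θ`. It shows that convolution with `a 0` multiplies `t` by
-- n - 1.
t-equation : ∀ n → n * t n ≡ t n + (a 0 ⊛ t) n
t-equation n = *-cancelˡ-≡ _ _ 2 (begin
  2 * (n * t n)                       ≡⟨ *-left-comm 2 n (t n) ⟩
  n * (2 * t n)                       ≡⟨ cong (n *_) (a-tree n) ⟩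
  n * (2 * a 0 n + (a 0 ⊛ a 0) n)     ≡⟨ *-distribˡ-+ n (2 * a 0 n) _ ⟩
  n * (2 * a 0 n) + n * (a 0 ⊛ a 0) n ≡⟨ cong₂ _+_ (*-left-comm n 2 (a 0 n)) (trans (⊛-θ (a 0) (a 0) n)
                                           (cong (_+ (a 0 ⊛ t) n) (⊛-comm t (a 0) n))) ⟩
  2 * t n + ((a 0 ⊛ t) n + (a 0 ⊛ t) n) ≡⟨ collect (t n) ((a 0 ⊛ t) n) ⟩
  2 * (t n + (a 0 ⊛ t) n)             ∎)
  where
  open ≡-Reasoning
  collect : ∀ x y → 2 * x + (y + y) ≡ 2 * (x + y)
  collect = solve-∀

0-n∈colourings : ∀ n → (0 , n) ∈ colourings n
0-n∈colourings zero    = here refl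
0-n∈colourings (suc n) = ∈-++⁺ʳ (map _ (colourings n)) (∈-map⁺ _ (0-n∈colourings n))

1-n∈colourings : ∀ n → (1 , n) ∈ colourings (suc n)
1-n∈colourings n = ∈-++⁺ˡ (∈-map⁺ _ (0-n∈colourings n))

-- If the value at n were 0, `a-tree` would make the whole convolution vanish, but its term for the
-- split (1 , n - 1) is positive.
a-0-positive : ∀ n → 1 ≤ a 0 (suc n)
a-0-positive zero    = ≤-reflexive (sym a-0-1)
a-0-positive (suc q) = n≢0⇒n>0 (λ ≡0 → <⇒≱ positive (≤-reflexive (convolution≡0 ≡0)))
  where
  n = suc (suc q)
  positive : 0 < (a 0 ⊛ a 0) n
  positive = ≤-trans (*-mono-≤ (*-mono-≤ (≤-refl {1}) (≤-reflexive (sym a-0-1)))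
                               (*-mono-≤ (s≤s (z≤n {q})) (a-0-positive q)))
                     (∈⇒≤∑ (λ (i , j) → θ (a 0) i * θ (a 0) j) (1-n∈colourings (suc q)))
  convolution≡0 : a 0 n ≡ 0 → (a 0 ⊛ a 0) n ≡ 0
  convolution≡0 ≡0 = +-cancelˡ-≡ (2 * a 0 n) _ _ (trans (sym (a-tree n))
    (trans (cong (λ z → 2 * (n * z)) ≡0) (trans (cong (2 *_) (*-zeroʳ n)) (sym (cong (λ z → 2 * z + 0) ≡0)))))

a-0>0 : ∀ {n} → 1 ≤ n → 1 ≤ a 0 n
a-0>0 {suc n} _ = a-0-positive n

t>0 : ∀ {n} → 1 ≤ n → 1 ≤ t n
t>0 1≤n = *-mono-≤ 1≤n (a-0>0 1≤n)

initial-bound : ∀ (f : ℕ → ℕ) M → ∃ λ K → ∀ n → n < M → f n ≤ K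
initial-bound f zero    = 0 , λ _ ()
initial-bound f (suc M) with initial-bound f M
... | K , bound = K + f M , λ n n<1+M → case m≤n⇒m<n∨m≡n (s≤s⁻¹ n<1+M) of λ
  { (inj₁ n<M)  → ≤-trans (bound n n<M) (m≤m+n K (f M))
  ; (inj₂ refl) → m≤n+m (f M) K }

-- f and g satisfy nearly the same linear recursion.  The finitely many n
-- for which the forcing terms are not comparable contribute O(t), since t is
-- itself a supersolution.
compare : ∀ j (f g F G E : ℕ → ℕ) → f 0 ≡ 0 →
  (∀ n → 1 ≤ n → 4 * ((n + j) * f n) ≤ 4 * (a 0 ⊛ f) n + F n) →
  (∀ n → 1 ≤ n → 4 * (a 0 ⊛ g) n + G n ≤ 4 * ((n + j) * g n) + E n) →
  ∀ q → Eventually (λ n → q * F n + suc q * E n ≤ suc q * G n) →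
  ∃ λ K → ∀ n → q * f n ≤ suc q * g n + K * t n
compare j f g F G E f0 upper lower q (M , forcing) with initial-bound (λ n → q * f n) M
... | K , initial = K , strong-induction _ step
  where
  h : ℕ → ℕ
  h n = suc q * g n + K * t n
  step : ∀ n → (∀ m → m < n → q * f m ≤ h m) → q * f n ≤ h n
  step zero    ih = ≤-trans (≤-reflexive (trans (cong (q *_) f0) (*-zeroʳ q))) z≤n
  step n@(suc _) ih with n <? M
  ... | yes n<M = ≤-trans (initial n n<M) (≤-trans
          (≤-trans (≤-reflexive (sym (*-identityʳ K))) (*-monoʳ-≤ K (t>0 (s≤s z≤n)))) (m≤n+m (K * t n) (suc q * g n)))
  -- `suc q * E n` is carried on both sides because `lower` bounds the convolution and `G` only up
  -- to `E`.
  ... | no n≮M = *-cancelˡ-≤ (4 * (n + j)) (+-cancelʳ-≤ (suc q * E n) _ _ (begin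
    4 * (n + j) * (q * f n) + suc q * E n
      ≡⟨ cong (_+ suc q * E n) (regroup₁ (n + j) q (f n)) ⟩
    q * (4 * ((n + j) * f n)) + suc q * E n
      ≤⟨ +-monoˡ-≤ (suc q * E n) (*-monoʳ-≤ q (upper n (s≤s z≤n))) ⟩
    q * (4 * (a 0 ⊛ f) n + F n) + suc q * E n
      ≡⟨ regroup₂ q ((a 0 ⊛ f) n) (F n) (suc q * E n) ⟩
    4 * (q * (a 0 ⊛ f) n) + (q * F n + suc q * E n)
      ≤⟨ +-mono-≤ (*-monoʳ-≤ 4 convolution) (forcing n (≮⇒≥ n≮M)) ⟩
    4 * (suc q * (a 0 ⊛ g) n + K * (a 0 ⊛ t) n) + suc q * G n
      ≡⟨ regroup₃ (suc q) ((a 0 ⊛ g) n) (G n) (K * (a 0 ⊛ t) n) ⟩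
    suc q * (4 * (a 0 ⊛ g) n + G n) + 4 * (K * (a 0 ⊛ t) n)
      ≤⟨ +-mono-≤ (*-monoʳ-≤ (suc q) (lower n (s≤s z≤n))) (*-monoʳ-≤ 4 (*-monoʳ-≤ K supersolution)) ⟩
    suc q * (4 * ((n + j) * g n) + E n) + 4 * (K * ((n + j) * t n))
      ≡⟨ regroup₄ (suc q) (n + j) (g n) (E n) K (t n) ⟩
    4 * (n + j) * h n + suc q * E n ∎))
    where
    open ≤-Reasoning
    convolution : q * (a 0 ⊛ f) n ≤ suc q * (a 0 ⊛ g) n + K * (a 0 ⊛ t) n
    convolution = begin
      q * (a 0 ⊛ f) n              ≡⟨ ⊛-*ʳ (a 0) q f n ⟨
      (a 0 ⊛ (λ m → q * f m)) n    ≤⟨ ⊛-mono n (λ _ _ → ≤-refl) ih ⟩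
      (a 0 ⊛ h) n                  ≡⟨ ⊛-+ʳ (a 0) _ _ n ⟩
      (a 0 ⊛ (λ m → suc q * g m)) n + (a 0 ⊛ (λ m → K * t m)) n
                                   ≡⟨ cong₂ _+_ (⊛-*ʳ (a 0) (suc q) g n) (⊛-*ʳ (a 0) K t n) ⟩
      suc q * (a 0 ⊛ g) n + K * (a 0 ⊛ t) n ∎
    -- The convolution is (n - 1) t by `t-equation`, hence below (n + j) t.
    supersolution : (a 0 ⊛ t) n ≤ (n + j) * t n
    supersolution = ≤-trans (m≤n+m _ (t n)) (≤-trans (≤-reflexive (sym (t-equation n))) (*-monoˡ-≤ (t n) (m≤m+n n j)))
    regroup₁ : ∀ m q x → 4 * m * (q * x) ≡ q * (4 * (m * x))
    regroup₁ = solve-∀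
    regroup₂ : ∀ q x y z → q * (4 * x + y) + z ≡ 4 * (q * x) + (q * y + z)
    regroup₂ = solve-∀
    regroup₃ : ∀ p x y z → 4 * (p * x + z) + p * y ≡ p * (4 * x + y) + 4 * z
    regroup₃ = solve-∀
    regroup₄ : ∀ p m x e K y → p * (4 * (m * x) + e) + 4 * (K * (m * y)) ≡ 4 * m * (p * x + K * y) + p * e
    regroup₄ = solve-∀

-- The recursion satisfied, up to lower order terms, by both 2 N(n,k) and
-- 2ᵏ N_bi(n,k).
record Family (γ : ℕ → ℕ → ℕ) : Set where
  field
    trees  : ∀ n → γ 0 n ≡ 2 * a 0 n
    at-0   : ∀ k → γ k 0 ≡ 0
    upper  : ∀ j n → 1 ≤ n → 4 * ((n + j) * γ (suc j) n) ≤ 2 * (n * n * γ j n) + ∑⊛ γ γ (suc j) n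
    error  : ℕ → ℕ
    lower  : ∀ j n → 1 ≤ n → 2 * (n * n * γ j n) + ∑⊛ γ γ (suc j) n ≤
                             4 * ((n + j) * γ (suc j) n) + error j * (n * γ j n)

-- The part of the convolution for Betti number j + 1 in which both indices are positive, so that
-- both are at most j.
middle : (ℕ → ℕ → ℕ) → ℕ → ℕ → ℕ
middle γ zero    n = 0
middle γ (suc j) n = ∑ᵃ j (λ x y → (γ (suc x) ⊛ γ (suc y)) n)

module FamilyProperties {γ : ℕ → ℕ → ℕ} (fam : Family γ) where
  open Family fam

  trees-⊛ : ∀ f n → (γ 0 ⊛ f) n ≡ 2 * (a 0 ⊛ f) n
  trees-⊛ f n = trans (⊛-cong n (λ m _ → trees m) (λ _ _ → refl)) (⊛-*ˡ 2 (a 0) f n)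

  ∑⊛-ends : ∀ j n → ∑⊛ γ γ (suc j) n ≡ 4 * (a 0 ⊛ γ (suc j)) n + middle γ j n
  ∑⊛-ends zero n = trans (cong₂ _+_ (trees-⊛ (γ 1) n)
      (cong (_+ 0) (trans (⊛-comm (γ 1) (γ 0) n) (trees-⊛ (γ 1) n)))) (collect ((a 0 ⊛ γ 1) n))
    where
    collect : ∀ x → 2 * x + (2 * x + 0) ≡ 4 * x + 0
    collect = solve-∀
  ∑⊛-ends (suc j) n = trans (∑-antidiagonal-suc (suc j) (λ x y → (γ x ⊛ γ y) n))
    (trans (cong₂ _+_ (trees-⊛ (γ (suc (suc j))) n) (trans (∑-antidiagonal-last j _)
      (cong (middle γ (suc j) n +_) (trans (⊛-comm (γ (suc (suc j))) (γ 0) n) (trees-⊛ (γ (suc (suc j))) n)))))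
      (collect ((a 0 ⊛ γ (suc (suc j))) n) (middle γ (suc j) n)))
    where
    collect : ∀ x y → 2 * x + (y + 2 * x) ≡ 4 * x + y
    collect = solve-∀

  increasing : ∀ j → Eventually (λ n → γ j n ≤ γ (suc j) n)
  increasing j = M , λ n M≤n → grow n M≤n
    where
    open ≤-Reasoning
    -- Beyond `M` the error term takes at most one of the two copies of n² γ_j, while j ≤ n and 8 ≤
    -- n bound 4 (n + j) by n².
    M = suc (error j + j + 8)
    grow : ∀ n → M ≤ n → γ j n ≤ γ (suc j) n
    grow n M≤n = *-cancelˡ-≤ (n * n) {{m*n≢0 n n {{n≢0}} {{n≢0}}}} (+-cancelʳ-≤ (n * n * γ j n) _ _ (begin
      n * n * γ j n + n * n * γ j n
        ≡⟨ cong (n * n * γ j n +_) (+-identityʳ _) ⟨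
      2 * (n * n * γ j n)
        ≤⟨ m≤m+n _ _ ⟩
      2 * (n * n * γ j n) + ∑⊛ γ γ (suc j) n
        ≤⟨ lower j n 1≤n ⟩
      4 * ((n + j) * γ (suc j) n) + error j * (n * γ j n)
        ≤⟨ +-mono-≤ (*-monoʳ-≤ 4 (*-monoˡ-≤ (γ (suc j) n) (+-monoʳ-≤ n j≤n))) (*-monoˡ-≤ (n * γ j n) e≤n) ⟩
      4 * ((n + n) * γ (suc j) n) + n * (n * γ j n)
        ≡⟨ cong₂ _+_ (eight n (γ (suc j) n)) (sym (*-assoc n n (γ j n))) ⟩
      8 * (n * γ (suc j) n) + n * n * γ j n
        ≤⟨ +-monoˡ-≤ (n * n * γ j n) (*-monoˡ-≤ (n * γ (suc j) n) 8≤n) ⟩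
      n * (n * γ (suc j) n) + n * n * γ j n
        ≡⟨ cong (_+ n * n * γ j n) (*-assoc n n (γ (suc j) n)) ⟨
      n * n * γ (suc j) n + n * n * γ j n ∎))
      where
      1≤n : 1 ≤ n
      1≤n = ≤-trans (s≤s z≤n) M≤n
      n≢0 : NonZero n
      n≢0 = ≢-nonZero (λ eq → <⇒≢ 1≤n (sym eq))
      M-1≤n : error j + j + 8 ≤ n
      M-1≤n = ≤-trans (n≤1+n _) M≤n
      8≤n : 8 ≤ n
      8≤n = ≤-trans (m≤n+m 8 (error j + j)) M-1≤n
      j≤n : j ≤ n
      j≤n = ≤-trans (m≤n+m j (error j)) (≤-trans (m≤m+n (error j + j) 8) M-1≤n)
      e≤n : error j ≤ n
      e≤n = ≤-trans (m≤m+n (error j) j) (≤-trans (m≤m+n (error j + j) 8) M-1≤n)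
      eight : ∀ n x → 4 * ((n + n) * x) ≡ 8 * (n * x)
      eight = solve-∀

  increasing-+ : ∀ i d → Eventually (λ n → γ i n ≤ γ (d + i) n)
  increasing-+ i zero    = 0 , λ _ _ → ≤-refl
  increasing-+ i (suc d) = mapᵉ (λ n (p , r) → ≤-trans p r) (increasing-+ i d ⊓ᵉ increasing (d + i))

  -- Each application of a 0 ⊛_ costs only O(t), so J t ≤ γ₁ + O(a₀) improves
  -- to (J + 1) t ≤ γ₁ + O(a₀).
  growth : ∀ J → ∃ λ K → ∀ n → J * t n ≤ γ 1 n + K * a 0 n
  growth zero    = 0 , λ _ → z≤n
  growth (suc J) with growth J
  ... | K , bound = K′ , step
    where
    -- `error 0` pays for the error of `lower`, J for the t lost in a_0 ⊛ t = n t - t, and 2 K for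
    -- a_0 ⊛ a_0 ≤ 2 t.
    K′ = error 0 + J + 2 * K
    step : ∀ n → suc J * t n ≤ γ 1 n + K′ * a 0 n
    step zero    = ≤-trans (≤-reflexive (*-zeroʳ (suc J))) z≤n
    step n@(suc _) = *-cancelˡ-≤ (4 * n) (begin
      4 * n * (suc J * t n)
        ≡⟨ regroup₁ n J (t n) ⟩
      4 * (n * t n) + 4 * (J * (n * t n))
        ≡⟨ cong (λ z → 4 * (n * t n) + 4 * (J * z)) (t-equation n) ⟩
      4 * (n * t n) + 4 * (J * (t n + (a 0 ⊛ t) n))
        ≡⟨ regroup₂ (4 * (n * t n)) J (t n) ((a 0 ⊛ t) n) ⟩
      4 * (n * t n) + 4 * (J * t n) + 4 * (J * (a 0 ⊛ t) n)
        ≤⟨ +-monoʳ-≤ (4 * (n * t n) + 4 * (J * t n)) (*-monoʳ-≤ 4 convolution) ⟩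
      4 * (n * t n) + 4 * (J * t n) + 4 * ((a 0 ⊛ γ 1) n + K * (a 0 ⊛ a 0) n)
        ≡⟨ regroup₃ (4 * (n * t n)) (4 * (J * t n)) ((a 0 ⊛ γ 1) n) (K * (a 0 ⊛ a 0) n) ⟩
      4 * (n * t n) + 4 * (a 0 ⊛ γ 1) n + (4 * (J * t n) + 4 * (K * (a 0 ⊛ a 0) n))
        ≤⟨ +-mono-≤ lower₀ (+-monoʳ-≤ (4 * (J * t n)) (*-monoʳ-≤ 4 (*-monoʳ-≤ K convolution-trees))) ⟩
      4 * (n * γ 1 n) + error 0 * (2 * t n) + (4 * (J * t n) + 4 * (K * (2 * t n)))
        ≤⟨ +-monoˡ-≤ _ (+-monoʳ-≤ (4 * (n * γ 1 n)) (*-monoʳ-≤ (error 0) (*-monoˡ-≤ (t n) (m≤m+n 2 2)))) ⟩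
      4 * (n * γ 1 n) + error 0 * (4 * t n) + (4 * (J * t n) + 4 * (K * (2 * t n)))
        ≡⟨ regroup₄ n (γ 1 n) (error 0) J K (a 0 n) ⟩
      4 * n * (γ 1 n + K′ * a 0 n) ∎)
      where
      open ≤-Reasoning
      convolution-trees : (a 0 ⊛ a 0) n ≤ 2 * t n
      convolution-trees = ≤-trans (m≤n+m _ (2 * a 0 n)) (≤-reflexive (sym (a-tree n)))
      convolution : J * (a 0 ⊛ t) n ≤ (a 0 ⊛ γ 1) n + K * (a 0 ⊛ a 0) n
      convolution = begin
        J * (a 0 ⊛ t) n                            ≡⟨ ⊛-*ʳ (a 0) J t n ⟨
        (a 0 ⊛ (λ m → J * t m)) n                  ≤⟨ ⊛-mono′ n (λ _ → ≤-refl) bound ⟩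
        (a 0 ⊛ (λ m → γ 1 m + K * a 0 m)) n        ≡⟨ ⊛-+ʳ (a 0) (γ 1) (λ m → K * a 0 m) n ⟩
        (a 0 ⊛ γ 1) n + (a 0 ⊛ (λ m → K * a 0 m)) n ≡⟨ cong ((a 0 ⊛ γ 1) n +_) (⊛-*ʳ (a 0) K (a 0) n) ⟩
        (a 0 ⊛ γ 1) n + K * (a 0 ⊛ a 0) n          ∎
      lower₀ : 4 * (n * t n) + 4 * (a 0 ⊛ γ 1) n ≤ 4 * (n * γ 1 n) + error 0 * (2 * t n)
      lower₀ = begin
        4 * (n * t n) + 4 * (a 0 ⊛ γ 1) n
          ≡⟨ cong₂ _+_ (four n (a 0 n)) (sym (+-identityʳ _)) ⟩
        2 * (n * n * (2 * a 0 n)) + (4 * (a 0 ⊛ γ 1) n + 0)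
          ≡⟨ cong₂ (λ x y → 2 * (n * n * x) + y) (sym (trees n)) (sym (∑⊛-ends 0 n)) ⟩
        2 * (n * n * γ 0 n) + ∑⊛ γ γ 1 n
          ≤⟨ lower 0 n (s≤s z≤n) ⟩
        4 * ((n + 0) * γ 1 n) + error 0 * (n * γ 0 n)
          ≡⟨ cong₂ (λ x y → 4 * (x * γ 1 n) + error 0 * y) (+-identityʳ n)
               (trans (cong (n *_) (trees n)) (*-left-comm n 2 (a 0 n))) ⟩
        4 * (n * γ 1 n) + error 0 * (2 * t n) ∎
        where
        four : ∀ n x → 4 * (n * (n * x)) ≡ 2 * (n * n * (2 * x))
        four = solve-∀
      regroup₁ : ∀ n J x → 4 * n * ((1 + J) * x) ≡ 4 * (n * x) + 4 * (J * (n * x))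
      regroup₁ = solve-∀
      regroup₂ : ∀ s J x y → s + 4 * (J * (x + y)) ≡ s + 4 * (J * x) + 4 * (J * y)
      regroup₂ = solve-∀
      regroup₃ : ∀ s r x y → s + r + 4 * (x + y) ≡ s + 4 * x + (r + 4 * y)
      regroup₃ = solve-∀
      regroup₄ : ∀ n g e J K x → 4 * (n * g) + e * (4 * (n * x)) + (4 * (J * (n * x)) + 4 * (K * (2 * (n * x))))
        ≡ 4 * n * (g + (e + J + 2 * K) * x)
      regroup₄ = solve-∀

  -- In `growth` for K + 1 the spare copy of `t` absorbs `K′ * a 0 n` once n ≥ K′; larger Betti
  -- numbers follow from `increasing-+`.
  dominates : ∀ j K → Eventually (λ n → K * t n ≤ γ (suc j) n)
  dominates j K with growth (suc K)
  ... | K′ , bound = mapᵉ (λ n (p , r) → ≤-trans p r) ((K′ , first) ⊓ᵉ to-j)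
    where
    open ≤-Reasoning
    first : ∀ n → K′ ≤ n → K * t n ≤ γ 1 n
    first n K′≤n = +-cancelʳ-≤ (t n) _ _ (begin
      K * t n + t n       ≡⟨ +-comm (K * t n) (t n) ⟩
      suc K * t n         ≤⟨ bound n ⟩
      γ 1 n + K′ * a 0 n  ≤⟨ +-monoʳ-≤ (γ 1 n) (*-monoˡ-≤ (a 0 n) K′≤n) ⟩
      γ 1 n + t n         ∎)
    to-j : Eventually (λ n → γ 1 n ≤ γ (suc j) n)
    to-j = subst (λ i → Eventually (λ n → γ 1 n ≤ γ i n)) (+-comm j 1) (increasing-+ 1 j)

  -- The convolution is itself a term of the recursion for γ (i + 1), so that recursion, read
  -- backwards, bounds it. Its order n is below the n² of the leading terms.
  ⊛-trees : ∀ i → ∃ λ K → Eventually (λ n → (a 0 ⊛ γ (suc i)) n ≤ K * (n * γ (suc i) n))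
  ⊛-trees i = K , mapᵉ (λ n (le , r) → bound n le r) ((suc i , λ _ le → le) ⊓ᵉ increasing i)
    where
    open ≤-Reasoning
    K = 8 + error i
    bound : ∀ n → suc i ≤ n → γ i n ≤ γ (suc i) n → (a 0 ⊛ γ (suc i)) n ≤ K * (n * γ (suc i) n)
    bound n i<n mono = begin
      (a 0 ⊛ γ (suc i)) n                               ≤⟨ m≤n*m _ 4 ⟩
      4 * (a 0 ⊛ γ (suc i)) n                           ≤⟨ m≤m+n _ (middle γ i n) ⟩
      4 * (a 0 ⊛ γ (suc i)) n + middle γ i n            ≡⟨ ∑⊛-ends i n ⟨
      ∑⊛ γ γ (suc i) n                                  ≤⟨ m≤n+m _ (2 * (n * n * γ i n)) ⟩
      2 * (n * n * γ i n) + ∑⊛ γ γ (suc i) n            ≤⟨ lower i n (≤-trans (s≤s z≤n) i<n) ⟩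
      4 * ((n + i) * γ (suc i) n) + error i * (n * γ i n)
        ≤⟨ +-mono-≤ (*-monoʳ-≤ 4 (*-monoˡ-≤ (γ (suc i) n) (+-monoʳ-≤ n (<⇒≤ i<n)))) (*-monoʳ-≤ (error i) (*-monoʳ-≤ n mono)) ⟩
      4 * ((n + n) * γ (suc i) n) + error i * (n * γ (suc i) n) ≡⟨ collect n (γ (suc i) n) (error i) ⟩
      K * (n * γ (suc i) n) ∎
      where
      collect : ∀ n x e → 4 * ((n + n) * x) + e * (n * x) ≡ (8 + e) * (n * x)
      collect = solve-∀

-- A convolution at n sees all smaller indices, so an eventual bound is not enough. The finitely
-- many exceptions are charged to `a 0`, which is positive for n ≥ 1 and whose convolutions are of
-- lower order.
≲-global : ∀ {f g} → f 0 ≡ 0 → f ≲ g → ∀ p → ∃ λ K → ∀ n → p * f n ≤ suc p * g n + K * a 0 n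
≲-global {f} {g} f0 f≲g p with f≲g p
... | M , eventually with initial-bound (λ n → p * f n) M
...   | K , initial = K , bound
  where
  bound : ∀ n → p * f n ≤ suc p * g n + K * a 0 n
  bound zero = ≤-trans (≤-reflexive (trans (cong (p *_) f0) (*-zeroʳ p))) z≤n
  bound n@(suc _) with n <? M
  ... | yes n<M = ≤-trans (initial n n<M) (≤-trans
        (≤-trans (≤-reflexive (sym (*-identityʳ K))) (*-monoʳ-≤ K (a-0>0 (s≤s z≤n)))) (m≤n+m (K * a 0 n) (suc p * g n)))
  ... | no n≮M = ≤-trans (eventually n (≮⇒≥ n≮M)) (m≤m+n _ _)

∑-eventually : {A : Set} (xs : List A) (f g : A → ℕ → ℕ) (h : ℕ → ℕ) →
  (∀ {x} → x ∈ xs → ∃ λ K → Eventually (λ n → f x n ≤ g x n + K * h n)) →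
  ∃ λ K → Eventually (λ n → ∑ xs (λ x → f x n) ≤ ∑ xs (λ x → g x n) + K * h n)
∑-eventually []       f g h each = 0 , 0 , λ _ _ → z≤n
∑-eventually (x ∷ xs) f g h each with each (here refl) | ∑-eventually xs f g h (each ∘ there)
... | K , first | K′ , rest = K + K′ , mapᵉ (λ n (p , q) →
        ≤-trans (+-mono-≤ p q) (≤-reflexive (regroup (g x n) (∑ xs (λ x → g x n)) K K′ (h n)))) (first ⊓ᵉ rest)
  where
  regroup : ∀ a b K K′ h → (a + K * h) + (b + K′ * h) ≡ (a + b) + (K + K′) * h
  regroup = solve-∀

-- Comparison of two families

module Comparison {γ δ : ℕ → ℕ → ℕ} (Γ : Family γ) (Δ : Family δ) where

  private
    module γ-fam = Family Γ
    module δ-fam = Family Δ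
    module γ-props = FamilyProperties Γ
    module δ-props = FamilyProperties Δ

  -- The product of the two global bounds has one main term and three terms with a factor `a 0`,
  -- which are small by `⊛-trees` and `dominates`. The index x + y + 1 of the error is one less than
  -- the Betti number x + y + 2 of the convolution.
  ⊛-comparison : ∀ x y → γ (suc x) ≲ δ (suc x) → γ (suc y) ≲ δ (suc y) → ∀ p →
    ∃ λ K → Eventually (λ n → p * p * (γ (suc x) ⊛ γ (suc y)) n ≤
      suc p * suc p * (δ (suc x) ⊛ δ (suc y)) n + K * (n * δ (suc (x + y)) n))
  ⊛-comparison x y γ≲δ γ≲δ′ p =
    R , mapᵉ (λ n ((((tx , ty) , mx) , my) , t≤) → main n tx ty mx my t≤)
      ((((proj₂ (δ-props.⊛-trees x) ⊓ᵉ proj₂ (δ-props.⊛-trees y)) ⊓ᵉ δ-x≤δ-j) ⊓ᵉ δ-y≤δ-j) ⊓ᵉ (δ-props.dominates (x + y) 1 ⊓ᵉ (1 , λ _ 1≤n → 1≤n)))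
    where
    open ≤-Reasoning
    global = ≲-global (γ-fam.at-0 (suc x)) γ≲δ p
    global′ = ≲-global (γ-fam.at-0 (suc y)) γ≲δ′ p
    K K′ L L′ : ℕ
    K  = proj₁ global
    K′ = proj₁ global′
    L  = proj₁ (δ-props.⊛-trees x)
    L′ = proj₁ (δ-props.⊛-trees y)
    P = suc p
    δx = δ (suc x)
    δy = δ (suc y)
    δj = δ (suc (x + y))
    R = P * (K′ * L) + K * (P * L′) + K * (K′ * 2)
    δ-x≤δ-j : Eventually (λ n → δx n ≤ δj n)
    δ-x≤δ-j = subst (λ i → Eventually (λ n → δx n ≤ δ i n)) (trans (+-suc y x) (cong suc (+-comm y x))) (δ-props.increasing-+ (suc x) y)
    δ-y≤δ-j : Eventually (λ n → δy n ≤ δj n)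
    δ-y≤δ-j = subst (λ i → Eventually (λ n → δy n ≤ δ i n)) (+-suc x y) (δ-props.increasing-+ (suc y) x)
    main : ∀ n → (a 0 ⊛ δx) n ≤ L * (n * δx n) → (a 0 ⊛ δy) n ≤ L′ * (n * δy n) → δx n ≤ δj n → δy n ≤ δj n →
           1 * t n ≤ δj n × 1 ≤ n →
           p * p * (γ (suc x) ⊛ γ (suc y)) n ≤ P * P * (δx ⊛ δy) n + R * (n * δj n)
    main n tx ty mx my (t≤ , 1≤n) = begin
      p * p * (γ (suc x) ⊛ γ (suc y)) n
        ≡⟨ *-assoc p p _ ⟩
      p * (p * (γ (suc x) ⊛ γ (suc y)) n)
        ≡⟨ trans (⊛-*ˡ p (γ (suc x)) (λ m → p * γ (suc y) m) n) (cong (p *_) (⊛-*ʳ (γ (suc x)) p (γ (suc y)) n)) ⟨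
      ((λ m → p * γ (suc x) m) ⊛ (λ m → p * γ (suc y) m)) n
        ≤⟨ ⊛-mono′ n (proj₂ global) (proj₂ global′) ⟩
      ((λ m → P * δx m + K * a 0 m) ⊛ (λ m → P * δy m + K′ * a 0 m)) n
        ≡⟨ trans (⊛-+ˡ (λ m → P * δx m) (λ m → K * a 0 m) _ n) (cong₂ _+_
             (trans (⊛-*ˡ P δx _ n) (cong (P *_) (trans (⊛-+ʳ δx (λ m → P * δy m) (λ m → K′ * a 0 m) n)
               (cong₂ _+_ (⊛-*ʳ δx P δy n) (trans (⊛-*ʳ δx K′ (a 0) n) (cong (K′ *_) (⊛-comm δx (a 0) n)))))))
             (trans (⊛-*ˡ K (a 0) _ n) (cong (K *_) (trans (⊛-+ʳ (a 0) (λ m → P * δy m) (λ m → K′ * a 0 m) n)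
               (cong₂ _+_ (⊛-*ʳ (a 0) P δy n) (⊛-*ʳ (a 0) K′ (a 0) n)))))) ⟩
      P * (P * (δx ⊛ δy) n + K′ * (a 0 ⊛ δx) n) + K * (P * (a 0 ⊛ δy) n + K′ * (a 0 ⊛ a 0) n)
        ≤⟨ +-mono-≤ (*-monoʳ-≤ P (+-monoʳ-≤ (P * (δx ⊛ δy) n) (*-monoʳ-≤ K′ tx′)))
                    (*-monoʳ-≤ K (+-mono-≤ (*-monoʳ-≤ P ty′) (*-monoʳ-≤ K′ tt))) ⟩
      P * (P * (δx ⊛ δy) n + K′ * (L * (n * δj n))) + K * (P * (L′ * (n * δj n)) + K′ * (2 * (n * δj n)))
        ≡⟨ collect P ((δx ⊛ δy) n) K K′ L L′ (n * δj n) ⟩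
      P * P * (δx ⊛ δy) n + R * (n * δj n) ∎
      where
      tx′ : (a 0 ⊛ δx) n ≤ L * (n * δj n)
      tx′ = ≤-trans tx (*-monoʳ-≤ L (*-monoʳ-≤ n mx))
      ty′ : (a 0 ⊛ δy) n ≤ L′ * (n * δj n)
      ty′ = ≤-trans ty (*-monoʳ-≤ L′ (*-monoʳ-≤ n my))
      tt : (a 0 ⊛ a 0) n ≤ 2 * (n * δj n)
      tt = ≤-trans (≤-trans (m≤n+m _ (2 * a 0 n)) (≤-reflexive (sym (a-tree n))))
        (*-monoʳ-≤ 2 (≤-trans (≤-reflexive (sym (*-identityˡ (t n)))) (≤-trans t≤ (1≤⇒≤* (δj n) 1≤n))))
      collect : ∀ P X K K′ L L′ h → P * (P * X + K′ * (L * h)) + K * (P * (L′ * h) + K′ * (2 * h))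
        ≡ P * P * X + (P * (K′ * L) + K * (P * L′) + K * (K′ * 2)) * h
      collect = solve-∀

  module Step (j : ℕ) (hyp : ∀ i → i ≤ j → γ i ≲ δ i) where

    middle-comparison : ∀ p → ∃ λ K → Eventually (λ n →
      p * p * middle γ j n ≤ suc p * suc p * middle δ j n + K * (n * δ j n))
    middle-comparison p = by-j j hyp
      where
      by-j : ∀ j → (∀ i → i ≤ j → γ i ≲ δ i) → ∃ λ K → Eventually (λ n →
        p * p * middle γ j n ≤ suc p * suc p * middle δ j n + K * (n * δ j n))
      by-j zero     hyp = 0 , 0 , λ n _ → ≤-trans (≤-reflexive (*-zeroʳ (p * p))) z≤n
      by-j (suc j′) hyp = from-sum (∑-eventually (antidiagonal j′)
             (λ (x , y) n → p * p * (γ (suc x) ⊛ γ (suc y)) n)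
             (λ (x , y) n → suc p * suc p * (δ (suc x) ⊛ δ (suc y)) n)
             (λ n → n * δ (suc j′) n) each)
        where
        from-sum : (∃ λ K → Eventually (λ n →
            ∑ᵃ j′ (λ x y → p * p * (γ (suc x) ⊛ γ (suc y)) n) ≤
            ∑ᵃ j′ (λ x y → suc p * suc p * (δ (suc x) ⊛ δ (suc y)) n) + K * (n * δ (suc j′) n))) →
          ∃ λ K → Eventually (λ n → p * p * middle γ (suc j′) n ≤ suc p * suc p * middle δ (suc j′) n + K * (n * δ (suc j′) n))
        from-sum (K , ev) = K , mapᵉ (λ n le → subst₂ _≤_ (∑-*ˡ (antidiagonal j′) (p * p) _)
              (cong (_+ K * (n * δ (suc j′) n)) (∑-*ˡ (antidiagonal j′) (suc p * suc p) _)) le) ev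
        each : ∀ {xy} → xy ∈ antidiagonal j′ → ∃ λ K → Eventually (λ n →
          uncurry (λ x y → p * p * (γ (suc x) ⊛ γ (suc y)) n) xy ≤
          uncurry (λ x y → suc p * suc p * (δ (suc x) ⊛ δ (suc y)) n) xy + K * (n * δ (suc j′) n))
        each {x , y} q = subst (λ i → ∃ λ K → Eventually (λ n → p * p * (γ (suc x) ⊛ γ (suc y)) n ≤
              suc p * suc p * (δ (suc x) ⊛ δ (suc y)) n + K * (n * δ (suc i) n))) x+y≡j′
            (⊛-comparison x y (hyp (suc x) (s≤s (m+n≤o⇒m≤o x (≤-reflexive x+y≡j′))))
                              (hyp (suc y) (s≤s (m+n≤o⇒n≤o x (≤-reflexive x+y≡j′)))) p)
          where
          x+y≡j′ : x + y ≡ j′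
          x+y≡j′ = antidiagonal-+ j′ q

    F G E : ℕ → ℕ
    F n = 2 * (n * n * γ j n) + middle γ j n
    G n = 2 * (n * n * δ j n) + middle δ j n
    E n = δ-fam.error j * (n * δ j n)

    forcing-from : ∀ q p K → 1 ≤ p → 2 * q * (suc p * suc p) ≤ suc (2 * q) * (p * p) →
      Eventually (λ n → p * p * middle γ j n ≤ suc p * suc p * middle δ j n + K * (n * δ j n)) →
      Eventually (λ n → q * F n + suc q * E n ≤ suc q * G n)
    forcing-from q p K 1≤p constants ev =
      mapᵉ (λ n ((m , h) , R≤n) → main n m h R≤n) ((ev ⊓ᵉ hyp j ≤-refl p) ⊓ᵉ (R , λ _ le → le))
      where
      open ≤-Reasoning
      -- All the coefficients of n δ_j; for n ≥ R they cost at most n² δ_j, hence at most p² G.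
      R = 2 * q * K + 2 * (p * p) * (suc q * δ-fam.error j)
      main : ∀ n → p * p * middle γ j n ≤ suc p * suc p * middle δ j n + K * (n * δ j n) →
             p * γ j n ≤ suc p * δ j n → R ≤ n → q * F n + suc q * E n ≤ suc q * G n
      main n m h R≤n = *-cancelˡ-≤ (2 * (p * p)) {{≢-nonZero nz}} (begin
        2 * (p * p) * (q * F n + suc q * E n)
          ≡⟨ regroup₁ p q (F n) (δ-fam.error j) (n * δ j n) ⟩
        2 * q * (p * p * F n) + 2 * (p * p) * (suc q * δ-fam.error j) * (n * δ j n)
          ≤⟨ +-monoˡ-≤ _ (*-monoʳ-≤ (2 * q) F≤G) ⟩
        2 * q * (suc p * suc p * G n + K * (n * δ j n)) + 2 * (p * p) * (suc q * δ-fam.error j) * (n * δ j n)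
          ≡⟨ regroup₂ q (suc p * suc p) (G n) K (2 * (p * p) * (suc q * δ-fam.error j)) (n * δ j n) ⟩
        2 * q * (suc p * suc p) * G n + R * (n * δ j n)
          ≤⟨ +-mono-≤ (*-monoˡ-≤ (G n) constants) absorbed ⟩
        suc (2 * q) * (p * p) * G n + p * p * G n
          ≡⟨ regroup₃ q (p * p) (G n) ⟩
        2 * (p * p) * (suc q * G n) ∎)
        where
        nz : 2 * (p * p) ≢ 0
        nz eq = <⇒≢ (*-mono-≤ (s≤s (z≤n {1})) (*-mono-≤ 1≤p 1≤p)) (sym eq)
        absorbed : R * (n * δ j n) ≤ p * p * G n
        absorbed = begin
          R * (n * δ j n)            ≤⟨ *-monoˡ-≤ (n * δ j n) R≤n ⟩
          n * (n * δ j n)            ≡⟨ *-assoc n n (δ j n) ⟨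
          n * n * δ j n              ≤⟨ m≤n*m (n * n * δ j n) 2 ⟩
          2 * (n * n * δ j n)        ≤⟨ m≤m+n _ (middle δ j n) ⟩
          G n                        ≤⟨ 1≤⇒≤* (G n) (*-mono-≤ 1≤p 1≤p) ⟩
          p * p * G n                ∎
        regroup₁ : ∀ p q F e d → 2 * (p * p) * (q * F + (1 + q) * (e * d))
          ≡ 2 * q * (p * p * F) + 2 * (p * p) * ((1 + q) * e) * d
        regroup₁ = solve-∀
        regroup₂ : ∀ q P G K R d → 2 * q * (P * G + K * d) + R * d ≡ 2 * q * P * G + (2 * q * K + R) * d
        regroup₂ = solve-∀
        regroup₃ : ∀ q P G → (1 + 2 * q) * P * G + P * G ≡ 2 * P * ((1 + q) * G)
        regroup₃ = solve-∀
        regroup₄ : ∀ p s x m → p * p * (2 * (s * x) + m) ≡ 2 * s * (p * (p * x)) + p * p * m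
        regroup₄ = solve-∀
        regroup₅ : ∀ p s x m k → 2 * s * (p * (p * x)) + (p * p * m + k) ≡ p * p * (2 * (s * x) + m) + k
        regroup₅ = solve-∀
        F≤G : p * p * F n ≤ suc p * suc p * G n + K * (n * δ j n)
        F≤G = begin
          p * p * F n
            ≡⟨ regroup₄ p (n * n) (γ j n) (middle γ j n) ⟩
          2 * (n * n) * (p * (p * γ j n)) + p * p * middle γ j n
            -- Only one factor p comes from the hypothesis on γ_j; the other is raised to p + 1 to
            -- match the squared constant of the convolutions.
            ≤⟨ +-mono-≤ (*-monoʳ-≤ (2 * (n * n)) (*-mono-≤ (n≤1+n p) h)) m ⟩
          2 * (n * n) * (suc p * (suc p * δ j n)) + (suc p * suc p * middle δ j n + K * (n * δ j n))
            ≡⟨ regroup₅ (suc p) (n * n) (δ j n) (middle δ j n) (K * (n * δ j n)) ⟩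
          suc p * suc p * G n + K * (n * δ j n) ∎

    -- With p = 4q + 2 we have 2 q (p + 1)² ≤ (2q + 1) p², and the remaining
    -- share of G absorbs all terms of order n δ j n.
    forcing : ∀ q → Eventually (λ n → q * F n + suc q * E n ≤ suc q * G n)
    forcing q = forcing-from q (4 * q + 2) (proj₁ (middle-comparison (4 * q + 2)))
      (≤-trans (s≤s z≤n) (m≤n+m 2 (4 * q))) (m+n≤o⇒m≤o _ (≤-reflexive (expand q)))
      (proj₂ (middle-comparison (4 * q + 2)))
      where
      expand : ∀ q → 2 * q * ((1 + (4 * q + 2)) * (1 + (4 * q + 2))) + (6 * q + 4)
        ≡ (1 + 2 * q) * ((4 * q + 2) * (4 * q + 2))
      expand = solve-∀

    conclusion : γ (suc j) ≲ δ (suc j)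
    -- Taking 2 q leaves one copy of δ to spare in 2 (q + 1) δ, and this absorbs K t.
    conclusion q = from-bound (compare j (γ (suc j)) (δ (suc j)) F G E (γ-fam.at-0 (suc j)) upper lower (2 * q) (forcing (2 * q)))
      where
      upper : ∀ n → 1 ≤ n → 4 * ((n + j) * γ (suc j) n) ≤ 4 * (a 0 ⊛ γ (suc j)) n + F n
      upper n 1≤n = ≤-trans (γ-fam.upper j n 1≤n) (≤-reflexive
        (trans (cong (2 * (n * n * γ j n) +_) (γ-props.∑⊛-ends j n)) (+-left-comm (2 * (n * n * γ j n)) (4 * (a 0 ⊛ γ (suc j)) n) (middle γ j n))))
      lower : ∀ n → 1 ≤ n → 4 * (a 0 ⊛ δ (suc j)) n + G n ≤ 4 * ((n + j) * δ (suc j) n) + E n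
      lower n 1≤n = ≤-trans (≤-reflexive
        (trans (+-left-comm (4 * (a 0 ⊛ δ (suc j)) n) (2 * (n * n * δ j n)) (middle δ j n)) (cong (2 * (n * n * δ j n) +_) (sym (δ-props.∑⊛-ends j n)))))
        (δ-fam.lower j n 1≤n)
      collect : ∀ q x → (1 + 2 * q) * x + x ≡ 2 * ((1 + q) * x)
      collect = solve-∀
      from-bound : (∃ λ K → ∀ n → 2 * q * γ (suc j) n ≤ suc (2 * q) * δ (suc j) n + K * t n) →
        Eventually (λ n → q * γ (suc j) n ≤ suc q * δ (suc j) n)
      from-bound (K , bound) = mapᵉ main (δ-props.dominates j K)
        where
        open ≤-Reasoning
        main : ∀ n → K * t n ≤ δ (suc j) n → q * γ (suc j) n ≤ suc q * δ (suc j) n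
        main n K*t≤ = *-cancelˡ-≤ 2 (begin
          2 * (q * γ (suc j) n)                     ≡⟨ *-assoc 2 q _ ⟨
          2 * q * γ (suc j) n                       ≤⟨ bound n ⟩
          suc (2 * q) * δ (suc j) n + K * t n       ≤⟨ +-monoʳ-≤ (suc (2 * q) * δ (suc j) n) K*t≤ ⟩
          suc (2 * q) * δ (suc j) n + δ (suc j) n   ≡⟨ collect q (δ (suc j) n) ⟩
          2 * (suc q * δ (suc j) n)                 ∎)

  comparison : ∀ k → γ k ≲ δ k
  comparison = strong-induction _ step
    where
    step : ∀ k → (∀ i → i < k → γ i ≲ δ i) → γ k ≲ δ k
    step zero    ih q = 0 , λ n _ → ≤-trans
      (≤-reflexive (cong (q *_) (trans (γ-fam.trees n) (sym (δ-fam.trees n))))) (*-monoˡ-≤ (δ 0 n) (n≤1+n q))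
    step (suc j) ih = Step.conclusion j (λ i i≤j → ih i (s≤s i≤j))

-- The factor 2 makes the trees agree. The factor 2^k is multiplicative along convolutions and turns
-- the n² of the recursion for `v` into the 2 n² of the one for `α`.
α β : ℕ → ℕ → ℕ
α k n = 2 * a k n
β k n = 2 ^ k * v k n

α-family : Family α
α-family = record
  { trees = λ _ → refl
  ; at-0  = λ k → cong (2 *_) (a-0 k)
  ; upper = upper
  -- Half of 8 (j + 1) + 4, since `α` is twice `a`: the first summand from n + j ≤ (j + 1) n, the
  -- second from n² - n.
  ; error = λ j → 6 + 4 * j
  ; lower = lower
  }
  where
  open ≤-Reasoning
  ∑⊛-α : ∀ k n → ∑⊛ α α k n ≡ 4 * ∑⊛ a a k n
  ∑⊛-α k n = trans (∑-cong′ (antidiagonal k) (λ (x , y) →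
    trans (⊛-*ˡ 2 (a x) (α y) n) (trans (cong (2 *_) (⊛-*ʳ (a x) 2 (a y) n)) (sym (*-assoc 2 2 ((a x ⊛ a y) n))))))
    (∑-*ˡ (antidiagonal k) 4 _)
  recursion : ∀ j n → 4 * ((n + j) * α (suc j) n) + 8 * ((n + j) * a j n)
    ≡ 4 * (n * n ∸ n) * a j n + 8 * a j n + ∑⊛ α α (suc j) n
  recursion j n = trans (four (n + j) (a (suc j) n) (a j n)) (trans (cong (4 *_) (a-step j n))
    (trans (distrib (n * n ∸ n) (a j n) (∑⊛ a a (suc j) n))
           (cong (4 * (n * n ∸ n) * a j n + 8 * a j n +_) (sym (∑⊛-α (suc j) n)))))
    where
    four : ∀ m x y → 4 * (m * (2 * x)) + 8 * (m * y) ≡ 4 * (2 * (m * x + m * y))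
    four = solve-∀
    distrib : ∀ d y s → 4 * ((d + 2) * y + s) ≡ 4 * d * y + 8 * y + 4 * s
    distrib = solve-∀
  upper : ∀ j n → 1 ≤ n → 4 * ((n + j) * α (suc j) n) ≤ 2 * (n * n * α j n) + ∑⊛ α α (suc j) n
  upper j n 1≤n = +-cancelʳ-≤ (8 * ((n + j) * a j n)) _ _ (begin
    4 * ((n + j) * α (suc j) n) + 8 * ((n + j) * a j n)
      ≡⟨ recursion j n ⟩
    4 * (n * n ∸ n) * a j n + 8 * a j n + ∑⊛ α α (suc j) n
      ≤⟨ +-monoˡ-≤ _ (+-mono-≤ (*-monoˡ-≤ (a j n) (*-monoʳ-≤ 4 (m∸n≤m (n * n) n)))
                               (*-monoʳ-≤ 8 (1≤⇒≤* (a j n) (≤-trans 1≤n (m≤m+n n j))))) ⟩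
    4 * (n * n) * a j n + 8 * ((n + j) * a j n) + ∑⊛ α α (suc j) n
      ≡⟨ regroup (n * n) (a j n) (8 * ((n + j) * a j n)) (∑⊛ α α (suc j) n) ⟩
    2 * (n * n * α j n) + ∑⊛ α α (suc j) n + 8 * ((n + j) * a j n) ∎)
    where
    regroup : ∀ s y e c → 4 * s * y + e + c ≡ 2 * (s * (2 * y)) + c + e
    regroup = solve-∀
  lower : ∀ j n → 1 ≤ n → 2 * (n * n * α j n) + ∑⊛ α α (suc j) n ≤
    4 * ((n + j) * α (suc j) n) + (6 + 4 * j) * (n * α j n)
  lower j n 1≤n = begin
    2 * (n * n * α j n) + ∑⊛ α α (suc j) n
      ≡⟨ cong (λ z → 2 * (z * α j n) + ∑⊛ α α (suc j) n) (sym (m∸n+n≡m (m≤m*n n n {{≢-nonZero (λ eq → <⇒≢ 1≤n (sym eq))}}))) ⟩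
    2 * ((n * n ∸ n + n) * α j n) + ∑⊛ α α (suc j) n
      ≤⟨ m≤m+n _ (8 * a j n) ⟩
    2 * ((n * n ∸ n + n) * α j n) + ∑⊛ α α (suc j) n + 8 * a j n
      ≡⟨ regroup (n * n ∸ n) n (a j n) (∑⊛ α α (suc j) n) ⟩
    4 * (n * n ∸ n) * a j n + 8 * a j n + ∑⊛ α α (suc j) n + 4 * (n * a j n)
      ≡⟨ cong (_+ 4 * (n * a j n)) (recursion j n) ⟨
    4 * ((n + j) * α (suc j) n) + 8 * ((n + j) * a j n) + 4 * (n * a j n)
      ≤⟨ +-monoˡ-≤ _ (+-monoʳ-≤ (4 * ((n + j) * α (suc j) n)) (*-monoʳ-≤ 8 (*-monoˡ-≤ (a j n) (n+j≤ j 1≤n)))) ⟩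
    4 * ((n + j) * α (suc j) n) + 8 * (suc j * n * a j n) + 4 * (n * a j n)
      ≡⟨ collect (4 * ((n + j) * α (suc j) n)) j n (a j n) ⟩
    4 * ((n + j) * α (suc j) n) + (6 + 4 * j) * (n * α j n) ∎
    where
    regroup : ∀ d n y c → 2 * ((d + n) * (2 * y)) + c + 8 * y ≡ 4 * d * y + 8 * y + c + 4 * (n * y)
    regroup = solve-∀
    collect : ∀ z j n y → z + 8 * ((1 + j) * n * y) + 4 * (n * y) ≡ z + (6 + 4 * j) * (n * (2 * y))
    collect = solve-∀

β-family : Family β
β-family = record
  { trees = λ n → trans (*-identityˡ (v 0 n)) (v-trees n)
  ; at-0  = λ k → trans (cong (2 ^ k *_) (v-0 k)) (*-zeroʳ (2 ^ k))
  ; upper = upper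
  -- The constant of `v-step-lower`, doubled because that inequality is multiplied by 2^(j+1) while
  -- β_j contains only 2^j.
  ; error = λ j → 2 * (4 * suc j + proj₁ (S-bound j))
  ; lower = lower
  }
  where
  open ≤-Reasoning
  ∑⊛-β : ∀ k n → ∑⊛ β β k n ≡ 2 ^ k * ∑⊛ v v k n
  ∑⊛-β k n = trans (∑-cong (antidiagonal k) (λ {(x , y)} p →
    trans (⊛-*ˡ (2 ^ x) (v x) (β y) n) (trans (cong (2 ^ x *_) (⊛-*ʳ (v x) (2 ^ y) (v y) n))
      (trans (sym (*-assoc (2 ^ x) (2 ^ y) _)) (cong (_* (v x ⊛ v y) n)
        (trans (sym (^-distribˡ-+-* 2 x y)) (cong (2 ^_) (antidiagonal-+ k p))))))))
    (∑-*ˡ (antidiagonal k) (2 ^ k) _)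
  v-upper : ∀ j n → 1 ≤ n → 4 * ((n + j) * v (suc j) n) ≤ n * n * v j n + ∑⊛ v v (suc j) n
  v-upper j n 1≤n = +-cancelʳ-≤ (4 * ((n + j) * v j n)) _ _ (begin
    4 * ((n + j) * v (suc j) n) + 4 * ((n + j) * v j n)
      ≡⟨ v-step j n ⟩
    4 * Q j n + 4 * v j n + ∑⊛ v v (suc j) n
      ≤⟨ +-monoˡ-≤ (∑⊛ v v (suc j) n) (+-mono-≤ (≤-trans (m≤m+n (4 * Q j n) (S j n)) (≤-reflexive (4Q+S j n)))
           (*-monoʳ-≤ 4 (1≤⇒≤* (v j n) (≤-trans 1≤n (m≤m+n n j))))) ⟩
    n * n * v j n + 4 * ((n + j) * v j n) + ∑⊛ v v (suc j) n
      ≡⟨ +-right-comm (n * n * v j n) (4 * ((n + j) * v j n)) (∑⊛ v v (suc j) n) ⟩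
    n * n * v j n + ∑⊛ v v (suc j) n + 4 * ((n + j) * v j n) ∎)
  factor₁ : ∀ P m x → 4 * (m * (2 * P * x)) ≡ 2 * P * (4 * (m * x))
  factor₁ = solve-∀
  factor₂ : ∀ P s x c → 2 * P * (s * x + c) ≡ 2 * (s * (P * x)) + 2 * P * c
  factor₂ = solve-∀
  factor₃ : ∀ P z e n x → 2 * P * (z + e * (n * x)) ≡ 2 * P * z + 2 * e * (n * (P * x))
  factor₃ = solve-∀
  upper : ∀ j n → 1 ≤ n → 4 * ((n + j) * β (suc j) n) ≤ 2 * (n * n * β j n) + ∑⊛ β β (suc j) n
  upper j n 1≤n = begin
    4 * ((n + j) * β (suc j) n)                          ≡⟨ factor₁ (2 ^ j) (n + j) (v (suc j) n) ⟩
    2 ^ suc j * (4 * ((n + j) * v (suc j) n))            ≤⟨ *-monoʳ-≤ (2 ^ suc j) (v-upper j n 1≤n) ⟩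
    2 ^ suc j * (n * n * v j n + ∑⊛ v v (suc j) n)       ≡⟨ factor₂ (2 ^ j) (n * n) (v j n) (∑⊛ v v (suc j) n) ⟩
    2 * (n * n * β j n) + 2 ^ suc j * ∑⊛ v v (suc j) n   ≡⟨ cong (2 * (n * n * β j n) +_) (∑⊛-β (suc j) n) ⟨
    2 * (n * n * β j n) + ∑⊛ β β (suc j) n               ∎
  lower : ∀ j n → 1 ≤ n → 2 * (n * n * β j n) + ∑⊛ β β (suc j) n ≤
    4 * ((n + j) * β (suc j) n) + 2 * (4 * suc j + proj₁ (S-bound j)) * (n * β j n)
  lower j n 1≤n = begin
    2 * (n * n * β j n) + ∑⊛ β β (suc j) n
      ≡⟨ cong (2 * (n * n * β j n) +_) (∑⊛-β (suc j) n) ⟩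
    2 * (n * n * β j n) + 2 ^ suc j * ∑⊛ v v (suc j) n
      ≡⟨ factor₂ (2 ^ j) (n * n) (v j n) (∑⊛ v v (suc j) n) ⟨
    2 ^ suc j * (n * n * v j n + ∑⊛ v v (suc j) n)
      ≤⟨ *-monoʳ-≤ (2 ^ suc j) (v-step-lower 1≤n (proj₂ (S-bound j) j ≤-refl n)) ⟩
    2 ^ suc j * (4 * ((n + j) * v (suc j) n) + e * (n * v j n))
      ≡⟨ factor₃ (2 ^ j) (4 * ((n + j) * v (suc j) n)) e n (v j n) ⟩
    2 ^ suc j * (4 * ((n + j) * v (suc j) n)) + 2 * e * (n * β j n)
      ≡⟨ cong (_+ 2 * e * (n * β j n)) (factor₁ (2 ^ j) (n + j) (v (suc j) n)) ⟨
    4 * ((n + j) * β (suc j) n) + 2 * e * (n * β j n) ∎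
    where
    e = 4 * suc j + proj₁ (S-bound j)

β≲α : ∀ k → β k ≲ α k
β≲α = Comparison.comparison β-family α-family

α≲β : ∀ k → α k ≲ β k
α≲β = Comparison.comparison α-family β-family

α-positive : ∀ k → Eventually (λ n → 1 ≤ α k n)
α-positive zero    = 1 , λ n 1≤n → ≤-trans (a-0>0 1≤n) (m≤n*m (a 0 n) 2)
α-positive (suc j) = mapᵉ (λ n (le , 1≤n) → ≤-trans (t>0 1≤n) (≤-trans (≤-reflexive (sym (*-identityˡ (t n)))) le))
  (FamilyProperties.dominates α-family j 1 ⊓ᵉ (1 , λ _ 1≤n → 1≤n))

-- Rational numbers

open import Data.Nat.Combinatorics using (_C_; nCk+nC[k+1]≡[n+1]C[k+1]; k>n⇒nCk≡0)
import Data.Integer as ℤ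
import Data.Integer.Properties as ℤ
open import Data.Rational as ℚ using (ℚ; mkℚ; 0ℚ; 1ℚ; _÷_; 1/_)
import Data.Rational.Properties as ℚ
open import Algebra.Properties.Group (ℚ.+-0-group) using (⁻¹-involutive)
open import Data.Rational.Unnormalised as ℚᵘ using (mkℚᵘ; *≡*; *<*; *≤*)
import Data.Rational.Unnormalised.Properties as ℚᵘ

-- The binomial sum as a sum over colourings

∑-upTo-suc : ∀ m (f : ℕ → ℕ) → ∑ (upTo (suc m)) f ≡ f 0 + ∑ (upTo m) (f ∘ suc)
∑-upTo-suc m f = cong (f 0 +_) (trans (cong (λ xs → ∑ xs f) (sym (map-applyUpTo id suc m))) (∑-map suc (upTo m) f))

∑-upTo-last : ∀ m (f : ℕ → ℕ) → ∑ (upTo (suc m)) f ≡ ∑ (upTo m) f + f m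
∑-upTo-last zero    f = +-identityʳ (f 0)
∑-upTo-last (suc m) f = begin
  ∑ (upTo (suc (suc m))) f                        ≡⟨ ∑-upTo-suc (suc m) f ⟩
  f 0 + ∑ (upTo (suc m)) (f ∘ suc)                ≡⟨ cong (f 0 +_) (∑-upTo-last m (f ∘ suc)) ⟩
  f 0 + (∑ (upTo m) (f ∘ suc) + f (suc m))        ≡⟨ +-assoc (f 0) _ _ ⟨
  f 0 + ∑ (upTo m) (f ∘ suc) + f (suc m)          ≡⟨ cong (_+ f (suc m)) (∑-upTo-suc m f) ⟨
  ∑ (upTo (suc m)) f + f (suc m)                  ∎
  where open ≡-Reasoning

∑-upTo-cong : ∀ m {f g : ℕ → ℕ} → (∀ r → r < m → f r ≡ g r) → ∑ (upTo m) f ≡ ∑ (upTo m) g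
∑-upTo-cong zero    eq = refl
∑-upTo-cong (suc m) {f} {g} eq = trans (∑-upTo-suc m f) (trans
  (cong₂ _+_ (eq 0 z<s) (∑-upTo-cong m (λ r r<m → eq (suc r) (s<s r<m)))) (sym (∑-upTo-suc m g)))

-- Pascal's rule matches the choice of a class for one more element.
∑-colourings : ∀ n (f : ℕ → ℕ → ℕ) →
  ∑ (upTo (suc n)) (λ r → (n C r) * f r (n ∸ r)) ≡ ∑ᶜ n f
∑-colourings zero    f = cong (_+ 0) (+-identityʳ (f 0 0))
∑-colourings (suc n) f = begin
  ∑ (upTo (suc (suc n))) (λ r → (suc n C r) * f r (suc n ∸ r))
    ≡⟨ ∑-upTo-suc (suc n) (λ r → (suc n C r) * f r (suc n ∸ r)) ⟩
  1 * f 0 (suc n) + ∑ (upTo (suc n)) (λ r → (suc n C suc r) * f (suc r) (n ∸ r))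
    ≡⟨ cong (1 * f 0 (suc n) +_) (trans (∑-cong′ (upTo (suc n)) pascal)
         (∑-+ (upTo (suc n)) (λ r → (n C r) * f (suc r) (n ∸ r)) (λ r → (n C suc r) * f (suc r) (n ∸ r)))) ⟩
  1 * f 0 (suc n) + (X + ∑ (upTo (suc n)) (λ r → (n C suc r) * f (suc r) (n ∸ r)))
    ≡⟨ +-left-comm (1 * f 0 (suc n)) X _ ⟩
  X + (1 * f 0 (suc n) + ∑ (upTo (suc n)) (λ r → (n C suc r) * f (suc r) (n ∸ r)))
    ≡⟨ cong (X +_) (trans (sym (∑-upTo-suc (suc n) (λ r → (n C r) * f r (suc n ∸ r)))) (∑-upTo-last (suc n) (λ r → (n C r) * f r (suc n ∸ r)))) ⟩
  X + (∑ (upTo (suc n)) (λ r → (n C r) * f r (suc n ∸ r)) + (n C suc n) * f (suc n) (n ∸ n))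
    ≡⟨ cong (λ z → X + (∑ (upTo (suc n)) (λ r → (n C r) * f r (suc n ∸ r)) + z * f (suc n) (n ∸ n))) (k>n⇒nCk≡0 (n<1+n n)) ⟩
  X + (∑ (upTo (suc n)) (λ r → (n C r) * f r (suc n ∸ r)) + 0)
    ≡⟨ cong (X +_) (trans (+-identityʳ _) (∑-upTo-cong (suc n) (λ r r<1+n →
         cong (λ s → (n C r) * f r s) (+-∸-assoc 1 (s≤s⁻¹ r<1+n))))) ⟩
  X + ∑ (upTo (suc n)) (λ r → (n C r) * f r (suc (n ∸ r)))
    ≡⟨ cong₂ _+_ (∑-colourings n (λ r s → f (suc r) s)) (∑-colourings n (λ r s → f r (suc s))) ⟩
  ∑ᶜ n (λ r s → f (suc r) s) + ∑ᶜ n (λ r s → f r (suc s))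
    ≡⟨ ∑-colourings-suc n f ⟨
  ∑ᶜ (suc n) f ∎
  where
  open ≡-Reasoning
  X = ∑ (upTo (suc n)) (λ r → (n C r) * f (suc r) (n ∸ r))
  pascal : ∀ r → (suc n C suc r) * f (suc r) (n ∸ r) ≡ (n C r) * f (suc r) (n ∸ r) + (n C suc r) * f (suc r) (n ∸ r)
  pascal r = trans (cong (_* f (suc r) (n ∸ r)) (sym (nCk+nC[k+1]≡[n+1]C[k+1] n r))) (*-distribʳ-+ (f (suc r) (n ∸ r)) (n C r) (n C suc r))

Nbi≡v : ∀ n k → Nbi n k ≡ v k n
Nbi≡v n k = trans (∑-cong′ (upTo (suc n)) (λ r → cong ((n C r) *_) (trans (Nbi₂≡b r (n ∸ r) k) (sym (*-identityˡ _)))))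
  (∑-colourings n (λ r s → 1 * b r s k))

-- From natural to rational numbers

toℚᵘ-/ : ∀ m d → ℚ.toℚᵘ (ℤ.+ m ℚ./ suc d) ℚᵘ.≃ mkℚᵘ (ℤ.+ m) d
toℚᵘ-/ m d = ℚ.toℚᵘ-fromℚᵘ (mkℚᵘ (ℤ.+ m) d)

fromℕ-* : ∀ m n → fromℕ (m * n) ≡ fromℕ m ℚ.* fromℕ n
fromℕ-* m n = ℚ.toℚᵘ-injective (ℚᵘ.≃-trans (toℚᵘ-/ (m * n) 0) (ℚᵘ.≃-sym (ℚᵘ.≃-trans (ℚ.toℚᵘ-homo-* (fromℕ m) (fromℕ n))
  (ℚᵘ.≃-trans (ℚᵘ.*-cong (toℚᵘ-/ m 0) (toℚᵘ-/ n 0)) (*≡* (cong (ℤ._* ℤ.1ℤ) (sym (ℤ.pos-* m n))))))))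

fromℕ-+ : ∀ m n → fromℕ (m + n) ≡ fromℕ m ℚ.+ fromℕ n
fromℕ-+ m n = ℚ.toℚᵘ-injective (ℚᵘ.≃-trans (toℚᵘ-/ (m + n) 0) (ℚᵘ.≃-sym (ℚᵘ.≃-trans (ℚ.toℚᵘ-homo-+ (fromℕ m) (fromℕ n))
  (ℚᵘ.≃-trans (ℚᵘ.+-cong (toℚᵘ-/ m 0) (toℚᵘ-/ n 0)) (*≡* (cong (ℤ._* ℤ.1ℤ) (cong₂ ℤ._+_ (ℤ.*-identityʳ (ℤ.+ m)) (ℤ.*-identityʳ (ℤ.+ n)))))))))

fromℕ-mono-< : ∀ {m n} → m < n → fromℕ m ℚ.< fromℕ n
fromℕ-mono-< {m} {n} m<n = ℚ.toℚᵘ-cancel-< (ℚᵘ.<-respˡ-≃ (ℚᵘ.≃-sym (toℚᵘ-/ m 0)) (ℚᵘ.<-respʳ-≃ (ℚᵘ.≃-sym (toℚᵘ-/ n 0))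
  (*<* (ℤ.*-monoʳ-<-pos (ℤ.+ 1) (ℤ.+<+ m<n)))))

fromℕ-nonNeg : ∀ m → 0ℚ ℚ.≤ fromℕ m
fromℕ-nonNeg zero    = ℚ.≤-refl
fromℕ-nonNeg (suc m) = ℚ.<⇒≤ (fromℕ-mono-< (z<s {m}))

/-*-cancel : ∀ m d .{{_ : NonZero d}} → (ℤ.+ m ℚ./ d) ℚ.* fromℕ d ≡ fromℕ m
/-*-cancel m (suc d) = ℚ.toℚᵘ-injective (ℚᵘ.≃-trans (ℚ.toℚᵘ-homo-* (ℤ.+ m ℚ./ suc d) (fromℕ (suc d)))
  (ℚᵘ.≃-trans (ℚᵘ.*-cong (toℚᵘ-/ m d) (toℚᵘ-/ (suc d) 0)) (ℚᵘ.≃-trans cancel (ℚᵘ.≃-sym (toℚᵘ-/ m 0)))))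
  where
  cancel : mkℚᵘ (ℤ.+ m) d ℚᵘ.* mkℚᵘ (ℤ.+ suc d) 0 ℚᵘ.≃ mkℚᵘ (ℤ.+ m) 0
  cancel = *≡* (trans (ℤ.*-identityʳ _) (cong (λ z → ℤ.+ m ℤ.* ℤ.+ suc z) (sym (*-identityʳ d))))

∣fromℕ-fromℕ∣ : ∀ m n → ℚ.∣ fromℕ m ℚ.- fromℕ n ∣ ≡ fromℕ ∣ m - n ∣
∣fromℕ-fromℕ∣ = wlog-≤ _
  (λ m n eq → trans (trans (sym (ℚ.∣-p∣≡∣p∣ (fromℕ n ℚ.- fromℕ m))) (cong ℚ.∣_∣ (negate (fromℕ n) (fromℕ m))))
                    (trans eq (cong fromℕ (∣-∣-comm m n))))
  (λ n d → trans (cong ℚ.∣_∣ (trans (cong (ℚ._- fromℕ n) (fromℕ-+ n d)) (cancel (fromℕ n) (fromℕ d))))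
    (trans (ℚ.0≤p⇒∣p∣≡p (fromℕ-nonNeg d)) (cong fromℕ (sym (trans (∣-∣-comm (n + d) n) (∣m-m+n∣≡n n d))))))
  where
  negate : ∀ x y → ℚ.- (x ℚ.- y) ≡ y ℚ.- x
  negate x y = trans (ℚ.neg-distrib-+ x (ℚ.- y)) (trans (cong (ℚ.- x ℚ.+_) (⁻¹-involutive y)) (ℚ.+-comm (ℚ.- x) y))
  cancel : ∀ x y → (x ℚ.+ y) ℚ.- x ≡ y
  cancel x y = trans (cong (ℚ._- x) (ℚ.+-comm x y)) (trans (ℚ.+-assoc y x (ℚ.- x))
    (trans (cong (y ℚ.+_) (ℚ.+-inverseʳ x)) (ℚ.+-identityʳ y)))

*-drop-< : ∀ d D {Y} → 1 ≤ Y → suc d * D ≤ Y → d * D < Y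
*-drop-< d zero    1≤Y _ = ≤-trans (s≤s (≤-reflexive (*-zeroʳ d))) 1≤Y
*-drop-< d (suc D) _ le  = ≤-trans (s≤s (m≤n+m (d * suc D) D)) le

-- The larger of X and Y exceeds the other by at most the part 1/(d + 1) of Y. One unit of d + 1 is
-- given up for the strict inequality, which needs Y ≥ 1.
∣-∣-small : ∀ d {X Y} → 1 ≤ Y → suc d * X ≤ suc (suc d) * Y → suc d * Y ≤ suc (suc d) * X → d * ∣ X - Y ∣ < Y
∣-∣-small d {X} {Y} 1≤Y X≲Y Y≲X with ≤-total X Y
... | inj₁ X≤Y = *-drop-< d ∣ X - Y ∣ 1≤Y (+-cancelʳ-≤ (suc d * X) _ _ (begin
      suc d * ∣ X - Y ∣ + suc d * X ≡⟨ *-distribˡ-+ (suc d) ∣ X - Y ∣ X ⟨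
      suc d * (∣ X - Y ∣ + X)       ≡⟨ cong (suc d *_) (trans (cong (_+ X) (m≤n⇒∣m-n∣≡n∸m X≤Y)) (m∸n+n≡m X≤Y)) ⟩
      suc d * Y                     ≤⟨ Y≲X ⟩
      X + suc d * X                 ≤⟨ +-monoˡ-≤ (suc d * X) X≤Y ⟩
      Y + suc d * X                 ∎))
  where open ≤-Reasoning
... | inj₂ Y≤X = *-drop-< d ∣ X - Y ∣ 1≤Y (+-cancelʳ-≤ (suc d * Y) _ _ (begin
      suc d * ∣ X - Y ∣ + suc d * Y ≡⟨ *-distribˡ-+ (suc d) ∣ X - Y ∣ Y ⟨
      suc d * (∣ X - Y ∣ + Y)       ≡⟨ cong (suc d *_) (trans (cong (_+ Y) (m≤n⇒∣n-m∣≡n∸m Y≤X)) (m∸n+n≡m Y≤X)) ⟩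
      suc d * X                     ≤⟨ X≲Y ⟩
      Y + suc d * Y                 ∎))
  where open ≤-Reasoning

-- With P = 2^k both P x and P y are natural numbers, so the relative error reduces to a distance in
-- ℕ.
relative-error : ∀ x y P .{{_ : ℚ.NonZero y}} → 0ℚ ℚ.≤ P ℚ.* y →
  ℚ.∣ (x ÷ y) ℚ.- 1ℚ ∣ ℚ.* (P ℚ.* y) ≡ ℚ.∣ P ℚ.* x ℚ.- P ℚ.* y ∣
relative-error x y P 0≤Py = begin
  ℚ.∣ e ∣ ℚ.* (P ℚ.* y)           ≡⟨ cong (ℚ.∣ e ∣ ℚ.*_) (ℚ.0≤p⇒∣p∣≡p 0≤Py) ⟨
  ℚ.∣ e ∣ ℚ.* ℚ.∣ P ℚ.* y ∣       ≡⟨ ℚ.∣p*q∣≡∣p∣*∣q∣ e (P ℚ.* y) ⟨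
  ℚ.∣ e ℚ.* (P ℚ.* y) ∣           ≡⟨ cong ℚ.∣_∣ expand ⟩
  ℚ.∣ P ℚ.* x ℚ.- P ℚ.* y ∣       ∎
  where
  open ≡-Reasoning
  e = (x ÷ y) ℚ.- 1ℚ
  quotient : (x ÷ y) ℚ.* (P ℚ.* y) ≡ P ℚ.* x
  quotient = begin
    (x ℚ.* 1/ y) ℚ.* (P ℚ.* y)  ≡⟨ cong ((x ℚ.* 1/ y) ℚ.*_) (ℚ.*-comm P y) ⟩
    (x ℚ.* 1/ y) ℚ.* (y ℚ.* P)  ≡⟨ ℚ.*-assoc x (1/ y) (y ℚ.* P) ⟩
    x ℚ.* (1/ y ℚ.* (y ℚ.* P))  ≡⟨ cong (x ℚ.*_) (ℚ.*-assoc (1/ y) y P) ⟨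
    x ℚ.* (1/ y ℚ.* y ℚ.* P)    ≡⟨ cong (λ z → x ℚ.* (z ℚ.* P)) (ℚ.*-inverseˡ y) ⟩
    x ℚ.* (1ℚ ℚ.* P)            ≡⟨ cong (x ℚ.*_) (ℚ.*-identityˡ P) ⟩
    x ℚ.* P                     ≡⟨ ℚ.*-comm x P ⟩
    P ℚ.* x                     ∎
  expand : e ℚ.* (P ℚ.* y) ≡ P ℚ.* x ℚ.- P ℚ.* y
  expand = trans (ℚ.*-distribʳ-+ (P ℚ.* y) (x ÷ y) (ℚ.- 1ℚ))
    (cong₂ ℚ._+_ quotient (trans (sym (ℚ.neg-distribˡ-* 1ℚ (P ℚ.* y))) (cong ℚ.-_ (ℚ.*-identityˡ (P ℚ.* y)))))

*-denominator : ∀ δ → 0ℚ ℚ.< δ → ∃ λ c → ∃ λ d → 1 ≤ c × δ ℚ.* fromℕ (suc d) ≡ fromℕ c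
*-denominator δ@(mkℚ (ℤ.+ zero)      d _)  0<δ = contradiction 0<δ (ℚ.<-irrefl (sym (ℚ.↥p≡0⇒p≡0 δ refl)))
*-denominator δ@(mkℚ (ℤ.+ (suc c))   d _) 0<δ = suc c , d , s≤s z≤n ,
  trans (cong (ℚ._* fromℕ (suc d)) (sym (ℚ.↥p/↧p≡p δ))) (/-*-cancel (suc c) (suc d))
*-denominator (mkℚ (ℤ.-[1+ _ ]) d _)  (ℚ.*<* ())

theorem1p5 : (k : ℕ) →
    (λ n → fromℕ (Nbi n k)) ∼ (λ n → 1/2^[ k -1] ℚ.* fromℕ (N n k))
theorem1p5 k δ 0<δ = from-≲ (*-denominator δ 0<δ)
  where
  P = fromℕ (2 ^ k)
  x y : ℕ → ℚ
  x n = fromℕ (Nbi n k)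
  y n = 1/2^[ k -1] ℚ.* fromℕ (N n k)
  Px : ∀ n → P ℚ.* x n ≡ fromℕ (β k n)
  Px n = trans (sym (fromℕ-* (2 ^ k) (Nbi n k))) (cong (λ z → fromℕ (2 ^ k * z)) (Nbi≡v n k))
  Py : ∀ n → P ℚ.* y n ≡ fromℕ (α k n)
  Py n = trans (sym (ℚ.*-assoc P 1/2^[ k -1] (fromℕ (N n k))))
    (trans (cong (ℚ._* fromℕ (N n k)) (trans (ℚ.*-comm P 1/2^[ k -1]) (/-*-cancel 2 (2 ^ k) {{m^n≢0 2 k}})))
    (trans (sym (fromℕ-* 2 (N n k))) (cong (λ z → fromℕ (2 * z)) (N≡a n k))))
  y≢0 : ∀ n → 1 ≤ α k n → ℚ.NonZero (y n)
  y≢0 n 1≤α = ℚ.≢-nonZero λ y≡0 → ℚ.<-irrefl (sym (trans (sym (Py n)) (trans (cong (P ℚ.*_) y≡0) (ℚ.*-zeroʳ P)))) (fromℕ-mono-< 1≤α)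
  close : ∀ c d n → 1 ≤ c → δ ℚ.* fromℕ (suc d) ≡ fromℕ c → suc (suc d) * β k n ≤ suc (suc (suc d)) * α k n → suc (suc d) * α k n ≤ suc (suc (suc d)) * β k n →
    (1≤α : 1 ≤ α k n) → ℚ.∣ (x n ÷ y n) {{y≢0 n 1≤α}} ℚ.- 1ℚ ∣ ℚ.< δ
  close c d n 1≤c δd≡c β≤ α≤ 1≤α = ℚ.*-cancelʳ-<-nonNeg (fromℕ (α k n)) {{ℚ.nonNegative (fromℕ-nonNeg (α k n))}}
    (subst (ℚ._< δ ℚ.* fromℕ (α k n)) (sym error)
      (ℚ.*-cancelʳ-<-nonNeg (fromℕ (suc d)) {{ℚ.nonNegative (fromℕ-nonNeg (suc d))}}
        (subst₂ ℚ._<_ (fromℕ-* D (suc d)) product (fromℕ-mono-< small))))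
    where
    D = ∣ β k n - α k n ∣
    error : ℚ.∣ (x n ÷ y n) {{y≢0 n 1≤α}} ℚ.- 1ℚ ∣ ℚ.* fromℕ (α k n) ≡ fromℕ D
    error = trans (cong (ℚ.∣ (x n ÷ y n) {{y≢0 n 1≤α}} ℚ.- 1ℚ ∣ ℚ.*_) (sym (Py n)))
      (trans (relative-error (x n) (y n) P {{y≢0 n 1≤α}} (subst (0ℚ ℚ.≤_) (sym (Py n)) (fromℕ-nonNeg (α k n))))
      (trans (cong₂ (λ u w → ℚ.∣ u ℚ.- w ∣) (Px n) (Py n)) (∣fromℕ-fromℕ∣ (β k n) (α k n))))
    product : fromℕ (c * α k n) ≡ δ ℚ.* fromℕ (α k n) ℚ.* fromℕ (suc d)
    product = trans (fromℕ-* c (α k n)) (trans (cong (ℚ._* fromℕ (α k n)) (sym δd≡c))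
      (trans (ℚ.*-assoc δ (fromℕ (suc d)) (fromℕ (α k n))) (trans (cong (δ ℚ.*_) (ℚ.*-comm (fromℕ (suc d)) (fromℕ (α k n))))
        (sym (ℚ.*-assoc δ (fromℕ (α k n)) (fromℕ (suc d)))))))
    small : D * suc d < c * α k n
    -- Since c ≥ 1, it suffices to bring the relative error below 1/(d + 1), which is at most δ =
    -- c/(d + 1).
    small = ≤-trans (s≤s (≤-reflexive (*-comm D (suc d)))) (≤-trans (∣-∣-small (suc d) {β k n} 1≤α β≤ α≤) (1≤⇒≤* (α k n) 1≤c))
  from-≲ : (∃ λ c → ∃ λ d → 1 ≤ c × δ ℚ.* fromℕ (suc d) ≡ fromℕ c) →
    ∃ λ M → ∀ n → M ≤ n → Σ (ℚ.NonZero (y n)) λ nz → ℚ.∣ (x n ÷ y n) {{nz}} ℚ.- 1ℚ ∣ ℚ.< δ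
  from-≲ (c , d , 1≤c , δd≡c) = mapᵉ
    (λ n ((β≤ , α≤) , 1≤α) → y≢0 n 1≤α , close c d n 1≤c δd≡c β≤ α≤ 1≤α)
    -- The parameter is d + 2: d + 1 is the denominator of δ, and one more is spent on strictness in
    -- `∣-∣-small`.
    ((β≲α k (suc (suc d)) ⊓ᵉ α≲β k (suc (suc d))) ⊓ᵉ α-positive k)
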